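{- Let $c$ be a constant and let $G$ be a bipartite graph on $n$ vertices with edge weights in $[n^c]$, given as a dynamic stream of updates $(e, w_e, \Delta)$, $\Delta\in\{+1,-1\}$ (each update inserts or deletes an edge together with its full weight; final edge multiplicities are in $\{0,1\}$; stream length is polynomial in $n$). There exists a streaming interactive proof for verifying the maximum-weight matching of $G$ with $O(\log n)$ rounds of communication, verifier space $O(\log^2 n)$ bits and communication $O(n\log n)$ bits.
   Context: A streaming interactive proof (SIP) for a function $f$ of a data stream $\tau$: a randomized verifier $V$ reads $\tau$ once in a streaming fashion (as does the prover $P$); after the stream has passed, $V$ and $P$ exchange messages, after which $V$ outputs a value or $\perp$ (rejection). There must be a prover strategy causing $V$ to output $f(\tau)$ with probability at least $2/3$, and for every prover strategy $V$ must output a value in $\{f(\tau),\perp\}$ with probability at least $2/3$. The weight of a matching is the sum of weights of its edges. -}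

module Defs where

open import Data.Bool using (Bool; if_then_else_)
open import Data.Fin using (Fin; toℕ)
import Data.Fin as Fin
import Data.Fin.Properties as Fin
open import Data.Integer using (ℤ; 0ℤ; 1ℤ; _◃_)
import Data.Integer as ℤ
open import Data.List using (List; []; _∷_; length; map; sum)
open import Data.List.Relation.Unary.All using (All)
open import Data.List.Relation.Unary.AllPairs using (AllPairs)
open import Data.Maybe using (Maybe; just; nothing; maybe; Is-just)
import Data.Maybe.Properties as Maybe
open import Data.Nat using (ℕ; zero; suc; _+_; _*_; _^_; _≤_)
import Data.Nat.Properties as ℕ
open import Data.Nat.Logarithm using (⌈log₂_⌉)
open import Data.Product using (_×_; _,_; ∃-syntax; Σ-syntax)
open import Data.Rational using (ℚ; 0ℚ; 1ℚ; ½)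
import Data.Rational as ℚ
open import Data.Sign using (Sign)
open import Data.Vec using (Vec)
open import Function using (_↣_)
open import Relation.Binary.Definitions using (DecidableEquality)
open import Relation.Binary.PropositionalEquality using (_≡_; _≢_; refl)
open import Relation.Nullary using (yes; no; does)
open import Relation.Nullary.Decidable using (_⊎-dec_; _×-dec_)
open import Relation.Unary using (Decidable)

infix 4 _∈O_

_∈O_ : (ℕ → ℕ) → (ℕ → ℕ) → Set
f ∈O g = ∃[ K ] ∃[ n₀ ] (∀ n → n₀ ≤ n → f n ≤ K * g n)

log : ℕ → ℕ
log n = ⌈log₂ n ⌉

data Rand (A : Set) : Set where
  return : A → Rand A
  toss   : Rand A → Rand A → Rand A

infixl 1 _>>=_

_>>=_ : {A B : Set} → Rand A → (A → Rand B) → Rand B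
return x >>= k = k x
toss l r >>= k = toss (l >>= k) (r >>= k)

Pr : {A : Set} {P : A → Set} → Decidable P → Rand A → ℚ
Pr P? (return x) = if does (P? x) then 1ℚ else 0ℚ
Pr P? (toss l r) = ½ ℚ.* (Pr P? l ℚ.+ Pr P? r)

-- One round: the verifier sends `challenge` bits, then the prover answers
-- with `response` bits (either number may be 0).
record Round : Set where
  constructor round
  field
    challenge : ℕ
    response  : ℕ

-- The verifier is a probabilistic automaton all of whose states fit in
-- `space` bits.  Everything it retains from one step to the next, including
-- past coin tosses, positions and round counters, has to be part of the
-- state.  It reads the prover's messages, like the stream, in one pass, one
-- bit at a time.  The output `nothing` is rejection (⊥).
record Verifier (Token : Set) : Set₁ where
  field
    State    : Set
    space    : ℕ
    encode   : State ↣ Vec Bool space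
    init     : Rand State
    read     : Token → State → Rand State
    schedule : List Round
    send     : State → Rand (Bool × State)
    receive  : Bool → State → Rand State
    output   : State → Maybe ℕ

  rounds : ℕ
  rounds = length schedule

  communication : ℕ
  communication = sum (map (λ r → Round.challenge r + Round.response r) schedule)

-- All bits exchanged so far in both directions, most recent first; the
-- schedule determines who sent which bit.
Transcript : Set
Transcript = List Bool

-- A prover's strategy for the conversation.  It does not see the verifier's
-- coins or state.  The dependence on the stream comes from quantifying over
-- strategies after the stream in `IsSIPFor`.
Strategy : Set
Strategy = Transcript → Bool

module _ {Token : Set} (V : Verifier Token) where
  open Verifier V

  readAll : List Token → State → Rand State
  readAll []      s = return s
  readAll (x ∷ τ) s = read x s >>= readAll τ

  verifierMessage : ℕ → State × Transcript → Rand (State × Transcript)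
  verifierMessage zero    c       = return c
  verifierMessage (suc k) (s , t) =
    send s >>= λ { (b , s′) → verifierMessage k (s′ , b ∷ t) }

  proverMessage : Strategy → ℕ → State × Transcript → Rand (State × Transcript)
  proverMessage P zero    c       = return c
  proverMessage P (suc k) (s , t) =
    receive (P t) s >>= λ s′ → proverMessage P k (s′ , P t ∷ t)

  converse : Strategy → List Round → State × Transcript → Rand (State × Transcript)
  converse P []                c = return c
  converse P (round a b ∷ rs) c =
    verifierMessage a c >>= proverMessage P b >>= converse P rs

  run : Strategy → List Token → Rand (Maybe ℕ)
  run P τ =
    init >>= readAll τ >>= λ s →
    converse P schedule (s , []) >>= λ { (s′ , _) → return (output s′) }

_≟ₒ_ : DecidableEquality (Maybe ℕ)
_≟ₒ_ = Maybe.≡-dec ℕ._≟_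

2/3 : ℚ
2/3 = ℤ.+ 2 ℚ./ 3

-- The function to be computed is partial (defined on the streams satisfying
-- a promise) and is given by its graph: `f τ v` says that τ satisfies the
-- promise and that the value at τ is v.
record IsSIPFor {Token : Set} (f : List Token → ℕ → Set) (V : Verifier Token) : Set where
  field
    complete : ∀ τ v → f τ v →
               ∃[ P ] 2/3 ℚ.≤ Pr (λ o → o ≟ₒ just v) (run V P τ)
    sound    : ∀ τ v → f τ v → ∀ (P : Strategy) →
               2/3 ℚ.≤ Pr (λ o → (o ≟ₒ just v) ⊎-dec (o ≟ₒ nothing)) (run V P τ)

-- The unordered pair {src , tgt}, listed in increasing order.  The order is
-- unrelated to any bipartition.
record Edge (n : ℕ) : Set where
  constructor edge
  field
    src      : Fin n
    tgt      : Fin n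
    .src<tgt : src Fin.< tgt

open Edge public

_≟ₑ_ : ∀ {n} → DecidableEquality (Edge n)
edge u v _ ≟ₑ edge u′ v′ _ with u Fin.≟ u′ | v Fin.≟ v′
... | yes refl | yes refl = yes refl
... | no u≢u′  | _        = no λ { refl → u≢u′ refl }
... | yes _    | no v≢v′  = no λ { refl → v≢v′ refl }

-- [W] = {1, …, W}: the element i of Fin W stands for the weight i + 1.
value : ∀ {W} → Fin W → ℕ
value w = suc (toℕ w)

-- A simple graph on n vertices with edge weights in [W]; `nothing` marks the
-- non-edges.
Graph : ℕ → ℕ → Set
Graph n W = Edge n → Maybe (Fin W)

module _ {n W : ℕ} (G : Graph n W) where

  IsEdge : Edge n → Set
  IsEdge e = Is-just (G e)

  IsBipartite : Set
  IsBipartite = Σ[ side ∈ (Fin n → Bool) ] (∀ e → IsEdge e → side (src e) ≢ side (tgt e))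

  edgeWeight : Edge n → ℕ
  edgeWeight e = maybe value 0 (G e)

Disjoint : ∀ {n} → Edge n → Edge n → Set
Disjoint e f = src e ≢ src f × src e ≢ tgt f × tgt e ≢ src f × tgt e ≢ tgt f

module _ {n W : ℕ} (G : Graph n W) where

  record IsMatching (M : List (Edge n)) : Set where
    field
      edges    : All (IsEdge G) M
      disjoint : AllPairs Disjoint M

  matchingWeight : List (Edge n) → ℕ
  matchingWeight M = sum (map (edgeWeight G) M)

  record IsMaxMatchingWeight (v : ℕ) : Set where
    field
      attained : ∃[ M ] (IsMatching M × matchingWeight M ≡ v)
      maximal  : ∀ M → IsMatching M → matchingWeight M ≤ v

record Update (n W : ℕ) : Set where
  constructor update
  field
    target : Edge n
    weight : Fin W
    Δ      : Sign

Stream : ℕ → ℕ → Set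
Stream n W = List (Update n W)

multiplicity : ∀ {n W} → Stream n W → Edge n → Fin W → ℤ
multiplicity []                    e w = 0ℤ
multiplicity (update e′ w′ Δ ∷ τ) e w =
  (if does ((e′ ≟ₑ e) ×-dec (w′ Fin.≟ w)) then Δ ◃ 1 else 0ℤ) ℤ.+ multiplicity τ e w

-- The final multiplicity of an edge with a given weight is 1 if G has that
-- edge with that weight and 0 otherwise.  Nothing is required of the
-- multiplicities before the end of the stream.
_Describes_ : ∀ {n W} → Stream n W → Graph n W → Set
τ Describes G = ∀ e w →
  multiplicity τ e w ≡ (if does (Maybe.≡-dec Fin._≟_ (G e) (just w)) then 1ℤ else 0ℤ)

-- The partial function taking a stream of length at most n ^ d that
-- describes a bipartite graph to the maximum weight of a matching in it.
record MaxWeightBipartiteMatching (n c d : ℕ) (τ : Stream n (n ^ c)) (v : ℕ) : Set where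
  field
    graph     : Graph n (n ^ c)
    describes : τ Describes graph
    bipartite : IsBipartite graph
    short     : length τ ≤ n ^ d
    maximum   : IsMaxMatchingWeight graph v

{-# OPTIONS --safe #-}

-- For every vertex u the prover announces a dual value y(u) and a partner.
-- The pairs that are edges and name each other always form a matching, so for
-- a penalty exceeding every matching weight the single integer equation
--
--   Σ_{uv ∈ E} ([u and v name each other] w(uv) − penalty [y(u) + y(v) < w(uv)]) = Σ_u y(u)
--
-- forces y to be feasible and, by weak duality, Σ_u y(u) to be the maximum
-- weight; by Egerváry's theorem an honest prover can satisfy it.  The left
-- side is the sum over a cube {0,1}^K, K = O(log n), of a product of four
-- tables, whose points list u, v, w and candidate answers a, b of u and v: the
-- edges, "a is the answer of u", "b is the answer of v", and the summand.  It
-- is verified by sumcheck at a secret point drawn before the stream, where the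
-- multilinear extensions of the tables are accumulated token by token.
--
-- No finite field is needed: K integer challenges of O(log n) bits make all
-- values O(log² n) bits long, so the sumcheck is run over ℤ.
module Submission where

open import Defs
open import Algebra.Structures using (IsCommutativeSemiring)
open import Data.Bool using (Bool; true; false; if_then_else_; _∧_; _∨_)
import Data.Bool.Properties as Bool
open import Data.Empty using (⊥; ⊥-elim)
open import Data.Fin using (Fin; toℕ; fromℕ<)
import Data.Fin as Fin
import Data.Fin.Properties as Fin
open import Data.Integer using (ℤ; 0ℤ; 1ℤ; _◃_; ∣_∣)
import Data.Integer as ℤ
import Data.Integer.Properties as ℤ
open import Data.Integer.Tactic.RingSolver using () renaming (solve-∀ to ℤ-solve)
open import Data.List using (List; []; _∷_; _++_; _ʳ++_; allFin; cartesianProduct; drop; foldr; length; map; mapMaybe; reverse; take)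
import Data.List.Properties as List
open import Data.List.Membership.Propositional using (_∈_)
open import Data.List.Membership.Propositional.Properties using (∈-allFin; ∈-cartesianProduct⁺)
open import Data.List.Relation.Unary.All using (All; []; _∷_)
import Data.List.Relation.Unary.All as All
open import Data.List.Relation.Unary.AllPairs using (AllPairs; []; _∷_)
open import Data.List.Relation.Unary.Any using (here; there)
open import Data.List.Relation.Unary.Unique.Propositional using (Unique)
open import Data.List.Relation.Unary.Unique.Propositional.Properties using (allFin⁺; cartesianProduct⁺)
open import Data.Maybe using (Maybe; just; nothing; maybe′; is-just)
import Data.Maybe.Properties as Maybe
import Data.Maybe.Relation.Unary.Any as Maybe
open import Data.Nat using (ℕ; zero; suc; _+_; _*_; _∸_; _^_; _/_; _%_; _≤_; _<_; _≡ᵇ_; _<ᵇ_; _≤ᵇ_; z≤n; s≤s; s≤s⁻¹; ⌊_/2⌋; ⌈_/2⌉)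
import Data.Nat.DivMod as ℕ
open import Data.Nat.Induction using (<-rec)
open import Data.Nat.ListAction using (sum)
open import Data.Nat.Logarithm using (⌈log₂⌉-mono-≤; ⌈log₂⌈n/2⌉⌉≡⌈log₂n⌉∸1; ⌈log₂2^n⌉≡n)
import Data.Nat.Properties as ℕ
open import Data.Nat.Tactic.RingSolver using () renaming (solve-∀ to ℕ-solve)
open import Data.Product using (_×_; _,_; proj₁; proj₂; ∃; ∃-syntax; Σ-syntax)
import Data.Product.Properties as Product
open import Data.Rational using (ℚ; 0ℚ; 1ℚ; ½)
import Data.Rational as ℚ
import Data.Rational.Properties as ℚ
open import Data.Sum using (_⊎_; inj₁; inj₂; [_,_]′)
open import Data.Vec using (Vec; []; _∷_; lookup; tabulate; toList)
import Data.Vec as Vec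
import Data.Vec.Properties as Vec
open import Data.Vec.Relation.Unary.All using ([]; _∷_) renaming (All to Allᵛ)
open import Function using (_∘_; id; case_of_; Equivalence)
open import Function.Construct.Identity using (↣-id)
open import Relation.Binary.Definitions using (DecidableEquality; tri<; tri≈; tri>)
open import Relation.Binary.PropositionalEquality using (_≡_; _≢_; refl; sym; trans; cong; cong₂; subst; subst₂; module ≡-Reasoning)
open import Relation.Nullary using (¬_; Dec; yes; no; does)
open import Relation.Nullary.Decidable using (_×-dec_; _⊎-dec_; dec-false; dec-true; decidable-stable; from-yes; map′; recompute)
open import Relation.Nullary.Negation using (contradiction)
open import Relation.Unary using (Decidable)

-- The summand of an edge looks up two announced answers, and there is no room to store them.
-- Letting `a` and `b` range over all candidate answers turns each lookup into an indicator. Three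
-- tables are then sums of contributions of single tokens or single answers, so each extension fits
-- in one register. The fourth couples all coordinates but is known in advance.
--
-- A point drawn before the stream is as good as fresh challenges because each challenge is revealed
-- only after the message that it tests, and the answers, which determine two of the tables, precede
-- all challenges.
--
-- Over ℤ, as over a field, a nonzero polynomial has few roots among the `2 ^ m` challenges. The
-- price is growth, by a factor `2 ^ suc m` per variable, and it has to be controlled for cheating
-- provers too: the verifier's states are bit vectors, so an overflow would corrupt its memory. This
-- is why an invariant bounding every register accompanies the whole conversation.

-- Finite sums

module ListSum {C : Set} {_⊕_ _⊗_ : C → C → C} {0# 1# : C}
               (isCSR : IsCommutativeSemiring _≡_ _⊕_ _⊗_ 0# 1#) where
  open IsCommutativeSemiring isCSR using (+-identityˡ; +-identityʳ; +-assoc; +-comm)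

  ∑ : {A : Set} → List A → (A → C) → C
  ∑ xs f = foldr _⊕_ 0# (map f xs)

  module _ {A : Set} where

    ∑-cong : ∀ (xs : List A) {f g : A → C} → (∀ x → f x ≡ g x) → ∑ xs f ≡ ∑ xs g
    ∑-cong []       e = refl
    ∑-cong (x ∷ xs) e = cong₂ _⊕_ (e x) (∑-cong xs e)

    ∑-zero : ∀ (xs : List A) {f : A → C} → All (λ x → f x ≡ 0#) xs → ∑ xs f ≡ 0#
    ∑-zero []       []       = refl
    ∑-zero (x ∷ xs) (e ∷ es) = trans (cong₂ _⊕_ e (∑-zero xs es)) (+-identityˡ 0#)

    ∑-⊕ : ∀ (xs : List A) (f g : A → C) → ∑ xs (λ x → f x ⊕ g x) ≡ ∑ xs f ⊕ ∑ xs g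
    ∑-⊕ []       f g = sym (+-identityˡ 0#)
    ∑-⊕ (x ∷ xs) f g = begin
      (f x ⊕ g x) ⊕ ∑ xs (λ x → f x ⊕ g x)  ≡⟨ cong ((f x ⊕ g x) ⊕_) (∑-⊕ xs f g) ⟩
      (f x ⊕ g x) ⊕ (∑ xs f ⊕ ∑ xs g)       ≡⟨ +-assoc (f x) (g x) _ ⟩
      f x ⊕ (g x ⊕ (∑ xs f ⊕ ∑ xs g))       ≡⟨ cong (f x ⊕_) (sym (+-assoc (g x) _ _)) ⟩
      f x ⊕ ((g x ⊕ ∑ xs f) ⊕ ∑ xs g)       ≡⟨ cong (λ z → f x ⊕ (z ⊕ ∑ xs g)) (+-comm (g x) _) ⟩
      f x ⊕ ((∑ xs f ⊕ g x) ⊕ ∑ xs g)       ≡⟨ cong (f x ⊕_) (+-assoc _ (g x) _) ⟩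
      f x ⊕ (∑ xs f ⊕ (g x ⊕ ∑ xs g))       ≡⟨ sym (+-assoc (f x) _ _) ⟩
      (f x ⊕ ∑ xs f) ⊕ (g x ⊕ ∑ xs g)       ∎
      where open ≡-Reasoning

    ∑-single : ∀ {xs y} {f : A → C} → Unique xs → y ∈ xs → (∀ x → x ≢ y → f x ≡ 0#) →
               ∑ xs f ≡ f y
    ∑-single {x ∷ xs} {_} {f} (x∉ ∷ _) (here refl) off =
      trans (cong (f x ⊕_) (∑-zero xs (All.map (λ x≢z → off _ (x≢z ∘ sym)) x∉))) (+-identityʳ (f x))
    ∑-single {x ∷ xs} {y} {f} (x∉ ∷ u) (there y∈) off =
      trans (cong (_⊕ ∑ xs f) (off x (All.lookup x∉ y∈)))
            (trans (+-identityˡ _) (∑-single u y∈ off))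

    ∑-delta : (_≟_ : DecidableEquality A) → ∀ {xs y} (h : A → C) → Unique xs → y ∈ xs →
              ∑ xs (λ x → if does (x ≟ y) then h x else 0#) ≡ h y
    ∑-delta _≟_ {xs} {y} h u y∈ = trans (∑-single u y∈ off) on
      where
      off : ∀ x → x ≢ y → (if does (x ≟ y) then h x else 0#) ≡ 0#
      off x x≢y with x ≟ y
      ... | yes x≡y = ⊥-elim (x≢y x≡y)
      ... | no  _   = refl
      on : (if does (y ≟ y) then h y else 0#) ≡ h y
      on with y ≟ y
      ... | yes _  = refl
      ... | no y≢y = ⊥-elim (y≢y refl)

  ∑-swap : ∀ {A B : Set} (xs : List A) (ys : List B) (f : A → B → C) →
           ∑ xs (λ x → ∑ ys (f x)) ≡ ∑ ys (λ y → ∑ xs (λ x → f x y))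
  ∑-swap []       ys f = sym (∑-zero ys (All.universal (λ _ → refl) ys))
  ∑-swap (x ∷ xs) ys f = trans (cong (∑ ys (f x) ⊕_) (∑-swap xs ys f)) (sym (∑-⊕ ys (f x) _))

open ListSum ℕ.+-*-isCommutativeSemiring
module ℤSum = ListSum ℤ.+-*-isCommutativeSemiring

module _ {A : Set} where

  ∑-mono : ∀ (xs : List A) {f g : A → ℕ} → (∀ x → f x ≤ g x) → ∑ xs f ≤ ∑ xs g
  ∑-mono []       le = z≤n
  ∑-mono (x ∷ xs) le = ℕ.+-mono-≤ (le x) (∑-mono xs le)

  ∑-mono-< : ∀ {xs : List A} {y} {f g : A → ℕ} → (∀ x → f x ≤ g x) → y ∈ xs → f y < g y →
             ∑ xs f < ∑ xs g
  ∑-mono-< {_ ∷ xs} le (here refl) lt = ℕ.+-mono-<-≤ lt (∑-mono xs le)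
  ∑-mono-< {x ∷ _}  le (there y∈)  lt = ℕ.+-mono-≤-< (le x) (∑-mono-< le y∈ lt)

  ∈⇒≤∑ : ∀ {xs : List A} {y} (f : A → ℕ) → y ∈ xs → f y ≤ ∑ xs f
  ∈⇒≤∑ f (here refl) = ℕ.m≤m+n _ _
  ∈⇒≤∑ {x ∷ _} f (there y∈) = ℕ.≤-trans (∈⇒≤∑ f y∈) (ℕ.m≤n+m _ (f x))

  ∑-const : ∀ (xs : List A) c → ∑ xs (λ _ → c) ≡ length xs * c
  ∑-const []       c = refl
  ∑-const (x ∷ xs) c = cong (c +_) (∑-const xs c)

-- Egerváry's theorem up to double negation

¬¬-bind : {A B : Set} → ¬ ¬ A → (A → ¬ ¬ B) → ¬ ¬ B
¬¬-bind p f q = p λ a → f a q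

¬¬-em : (A : Set) → ¬ ¬ Dec A
¬¬-em A k = k (no λ a → k (yes a))

-- Double-negation shift, valid because `Fin n` is finite. It lets the switching argument treat
-- reachability as decidable at all vertices at once.
¬¬-all : ∀ {n} {P : Fin n → Set} → (∀ i → ¬ ¬ P i) → ¬ ¬ (∀ i → P i)
¬¬-all {zero}  p k = k λ ()
¬¬-all {suc n} p k = p Fin.zero λ p₀ → ¬¬-all (p ∘ Fin.suc) λ ps →
  k λ { Fin.zero → p₀ ; (Fin.suc i) → ps i }

module Egervary {n : ℕ} (side : Fin n → Bool) where

  Weight : Set
  Weight = Fin n → Fin n → ℕ

  record Bip (w : Weight) : Set where
    field
      symm : ∀ x y → w x y ≡ w y x
      bip  : ∀ x y → 0 < w x y → side x ≢ side y

    diag : ∀ x → w x x ≡ 0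
    diag x with w x x in eq
    ... | zero  = refl
    ... | suc k = contradiction refl (bip x x (subst (0 <_) (sym eq) (s≤s z≤n)))

  -- As an involution whose fixed points are the exposed vertices, a matching can be augmented or
  -- switched by redefining it pointwise.
  record Matching (w : Weight) (m : Fin n → Fin n) : Set where
    field
      invol  : ∀ x → m (m x) ≡ x
      proper : ∀ x → m x ≢ x → 0 < w x (m x)

  -- Counting on the `true` side only meets every matched edge once. An exposed vertex contributes
  -- `w x x`, which is 0 by `diag`.
  sideWeight : Weight → (Fin n → Fin n) → Fin n → ℕ
  sideWeight w m x = if side x then w x (m x) else 0

  total : Weight → (Fin n → Fin n) → ℕ
  total w m = ∑ (allFin n) (sideWeight w m)

  IsMax : Weight → (Fin n → Fin n) → Set
  IsMax w m = Matching w m × (∀ m′ → Matching w m′ → total w m′ ≤ total w m)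

  module _ {w : Weight} (B : Bip w) where
    open Bip B

    module _ {m : Fin n → Fin n} (M : Matching w m) where
      open Matching M

      same-side : ∀ x → side (m x) ≡ side x → m x ≡ x
      same-side x eq with m x Fin.≟ x
      ... | yes e = e
      ... | no ne = contradiction (sym eq) (bip x (m x) (proper x ne))

      add-edge : ∀ {a b} → side a ≡ true → side b ≡ false → 0 < w a b → m a ≡ a → m b ≡ b →
                 ∃[ m′ ] (Matching w m′ × total w m < total w m′)
      add-edge {a} {b} sa sb wab ma mb = m′ , record { invol = inv ; proper = prop } ,
        ∑-mono-< le (∈-allFin a) lt
        where
        m′ : Fin n → Fin n
        m′ x = if does (x Fin.≟ a) then b else if does (x Fin.≟ b) then a else m x
        b≢a : b ≢ a
        b≢a refl = case trans (sym sa) sb of λ ()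
        m′a : m′ a ≡ b
        m′a with a Fin.≟ a
        ... | yes _ = refl
        ... | no ne = contradiction refl ne
        m′b : m′ b ≡ a
        m′b with b Fin.≟ a
        ... | yes e = contradiction e b≢a
        ... | no _ with b Fin.≟ b
        ...   | yes _ = refl
        ...   | no ne = contradiction refl ne
        m′o : ∀ {x} → x ≢ a → x ≢ b → m′ x ≡ m x
        m′o {x} xa xb with x Fin.≟ a
        ... | yes e = contradiction e xa
        ... | no _ with x Fin.≟ b
        ...   | yes e = contradiction e xb
        ...   | no _ = refl
        inv : ∀ x → m′ (m′ x) ≡ x
        inv x with x Fin.≟ a
        ... | yes refl = m′b
        ... | no xa with x Fin.≟ b
        ...   | yes refl = m′a
        ...   | no xb = trans (m′o (λ e → xa (trans (sym (invol x)) (trans (cong m e) ma)))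
                                   (λ e → xb (trans (sym (invol x)) (trans (cong m e) mb))))
                              (invol x)
        prop : ∀ x → m′ x ≢ x → 0 < w x (m′ x)
        prop x ne with x Fin.≟ a
        ... | yes refl = wab
        ... | no xa with x Fin.≟ b
        ...   | yes refl = subst (0 <_) (symm a b) wab
        ...   | no xb = proper x ne
        le : ∀ x → sideWeight w m x ≤ sideWeight w m′ x
        le x with side x
        ... | false = z≤n
        ... | true with x Fin.≟ a
        ...   | yes refl = ℕ.≤-trans (ℕ.≤-reflexive (trans (cong (w a) ma) (diag a))) z≤n
        ...   | no xa with x Fin.≟ b
        ...     | yes refl = ℕ.≤-trans (ℕ.≤-reflexive (trans (cong (w b) mb) (diag b))) z≤n
        ...     | no xb = ℕ.≤-refl
        lt : sideWeight w m a < sideWeight w m′ a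
        lt rewrite sa | m′a | ma | diag a = wab

    -- The complement of a set closed under an involution is closed too, so the two halves are glued
    -- without cutting a matched pair.
    mix : ∀ {f g} {C : Fin n → Set} → Matching w f → Matching w g → (C? : ∀ x → Dec (C x)) →
          (∀ x → C x → C (f x)) → (∀ x → C x → C (g x)) →
          Matching w (λ x → if does (C? x) then f x else g x)
    mix {f} {g} {C} F G C? cf cg = record { invol = inv ; proper = prop }
      where
      open Matching
      inv : ∀ x → (if does (C? (if does (C? x) then f x else g x))
                   then f (if does (C? x) then f x else g x)
                   else g (if does (C? x) then f x else g x)) ≡ x
      inv x with C? x
      ... | yes c with C? (f x)
      ...   | yes _ = invol F x
      ...   | no ¬c = contradiction (cf x c) ¬c
      inv x | no ¬c with C? (g x)
      ...   | yes c = contradiction (subst C (invol G x) (cg _ c)) ¬c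
      ...   | no _  = invol G x
      prop : ∀ x → (if does (C? x) then f x else g x) ≢ x →
             0 < w x (if does (C? x) then f x else g x)
      prop x ne with C? x
      ... | yes _ = proper F x ne
      ... | no  _ = proper G x ne

    -- Otherwise switching a maximum matching along the alternating path from a
    -- frees both ends of the edge ab.
    not-both-exposed : ∀ {a b} → side a ≡ true → side b ≡ false → 0 < w a b →
                       ∀ {f g} → IsMax w f → f a ≡ a → IsMax w g → g b ≡ b → ⊥
    not-both-exposed {a} {b} sa sb wab {f} {g} (F , maxF) fa (G , maxG) gb =
      ¬¬-all (λ x → ¬¬-em (Alt x)) switch
      where
      open Matching

      -- The path follows `g` from the `true` side and `f` from the `false` side. A step of the
      -- other kind leads back or stands still, so the set is closed under both.
      data Alt : Fin n → Set where
        start : Alt a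
        via-g : ∀ {x} → Alt x → side x ≡ true → Alt (g x)
        via-f : ∀ {x} → Alt x → side x ≡ false → Alt (f x)

      closed-f : ∀ x → Alt x → Alt (f x)
      closed-f x c with side x in sx
      ... | false = via-f c sx
      closed-f _ start | true = subst Alt (sym fa) start
      closed-f _ (via-g {x} c s) | true =
        subst (Alt ∘ f) (sym (same-side G x (trans sx (sym s)))) (closed-f x c)
      closed-f _ (via-f {x} c s) | true = subst Alt (sym (invol F x)) c

      closed-g : ∀ x → Alt x → Alt (g x)
      closed-g x c with side x in sx
      ... | true = via-g c sx
      closed-g _ start | false = contradiction (trans (sym sa) sx) λ ()
      closed-g _ (via-g {x} c s) | false = subst Alt (sym (invol G x)) c
      closed-g _ (via-f {x} c s) | false =
        subst (Alt ∘ g) (sym (same-side F x (trans sx (sym s)))) (closed-g x c)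

      -- On the `false` side the path arrives along an edge of `g`; hence it never reaches `b`,
      -- which `g` exposes.
      covered : ∀ x → Alt x → side x ≡ false → g x ≢ x
      covered _ start s = contradiction (trans (sym sa) s) λ ()
      covered _ (via-g {x} c s) s′ e =
        contradiction (trans (sym s) (trans (cong side (sym (trans (sym e) (invol G x)))) s′)) λ ()
      covered _ (via-f {x} c s) s′ e =
        covered x c s (trans (cong g (sym fx)) (trans e fx))
        where fx = same-side F x (trans s′ (sym s))

      switch : (∀ x → Dec (Alt x)) → ⊥
      switch C? with add-edge G′ sa sb wab g′a g′b
        where
        G′ = mix F G C? closed-f closed-g
        g′a : (if does (C? a) then f a else g a) ≡ a
        g′a with C? a
        ... | yes _ = fa
        ... | no ¬c = contradiction start ¬c
        g′b : (if does (C? b) then f b else g b) ≡ b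
        g′b with C? b
        ... | yes c = contradiction gb (covered b c sb)
        ... | no _  = gb
      ... | (h , H , lt) = ℕ.<-irrefl refl (ℕ.<-≤-trans lt (ℕ.≤-trans (maxG h H) heavier))
        where
        -- Together the two matchings weigh as much as `f` and `g`. Since `f′` cannot outweigh `f`,
        -- `g′` is at least as heavy as `g`, yet it exposes both `a` and `b`.
        f′ g′ : Fin n → Fin n
        f′ x = if does (C? x) then g x else f x
        g′ x = if does (C? x) then f x else g x
        V = allFin n
        exchange : ∀ x → sideWeight w f′ x + sideWeight w g′ x ≡ sideWeight w f x + sideWeight w g x
        exchange x with C? x
        ... | yes _ = ℕ.+-comm (sideWeight w g x) _
        ... | no  _ = refl
        exchange-∑ : total w f′ + total w g′ ≡ total w f + total w g
        exchange-∑ = trans (sym (∑-⊕ V _ _)) (trans (∑-cong V exchange) (∑-⊕ V _ _))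
        heavier : total w g ≤ total w g′
        heavier = ℕ.+-cancelˡ-≤ (total w f) _ _ (begin
          total w f + total w g    ≡⟨ sym exchange-∑ ⟩
          total w f′ + total w g′  ≤⟨ ℕ.+-monoˡ-≤ _ (maxF f′ (mix G F C? closed-g closed-f)) ⟩
          total w f + total w g′   ∎)
          where open ℕ.≤-Reasoning

  volume : Weight → ℕ
  volume w = ∑ (allFin n) λ x → ∑ (allFin n) (w x)

  total-≤-volume : ∀ {w m} → total w m ≤ volume w
  total-≤-volume {w} {m} = ∑-mono (allFin n) λ x → le x
    where
    le : ∀ x → sideWeight w m x ≤ ∑ (allFin n) (w x)
    le x with side x
    ... | true  = ∈⇒≤∑ (w x) (∈-allFin (m x))
    ... | false = z≤n

  -- The slack `k` serves as fuel: every improvement uses up at least one unit. Whether an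
  -- improvement exists is not decided, hence the double negation.
  max-exists : ∀ {w} k m → Matching w m → volume w ≤ total w m + k → ¬ ¬ ∃ (IsMax w)
  max-exists {w} k m M le = ¬¬-bind (¬¬-em (∃[ m′ ] (Matching w m′ × total w m < total w m′))) step
    where
    improve : ∀ k → volume w ≤ total w m + k → ∃[ m′ ] (Matching w m′ × total w m < total w m′) →
              ¬ ¬ ∃ (IsMax w)
    improve zero le (m′ , M′ , lt) = contradiction
      (ℕ.<-≤-trans lt (ℕ.≤-trans (total-≤-volume {m = m′}) (ℕ.≤-trans le (ℕ.≤-reflexive (ℕ.+-identityʳ _)))))
      (ℕ.<-irrefl refl)
    improve (suc k) le (m′ , M′ , lt) = max-exists k m′ M′
      (ℕ.≤-trans le (ℕ.≤-trans (ℕ.≤-reflexive (ℕ.+-suc _ k)) (ℕ.+-monoˡ-≤ k lt)))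
    step : Dec (∃[ m′ ] (Matching w m′ × total w m < total w m′)) → ¬ ¬ ∃ (IsMax w)
    step (no ¬better) done = done (m , M , λ m′ M′ → ℕ.≮⇒≥ λ lt → ¬better (m′ , M′ , lt))
    step (yes better) = improve k le better

  Dual : Weight → (Fin n → ℕ) → Set
  Dual w y = ∀ u v → w u v ≤ y u + y v

  touches : Fin n → Fin n → Fin n → ℕ
  touches z x y = if does (x Fin.≟ z) ∨ does (y Fin.≟ z) then 1 else 0

  lower : Weight → Fin n → Weight
  lower w z x y = w x y ∸ touches z x y

  ind : Fin n → Fin n → ℕ
  ind z x = if does (x Fin.≟ z) then 1 else 0

  touches-≤ : ∀ z x y → touches z x y ≤ ind z x + ind z y
  touches-≤ z x y with does (x Fin.≟ z) | does (y Fin.≟ z)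
  ... | true  | true  = s≤s z≤n
  ... | true  | false = ℕ.≤-refl
  ... | false | true  = ℕ.≤-refl
  ... | false | false = ℕ.≤-refl

  touches-left : ∀ z y → touches z z y ≡ 1
  touches-left z y with z Fin.≟ z
  ... | yes _ = refl
  ... | no ne = contradiction refl ne

  touches-right : ∀ z x → touches z x z ≡ 1
  touches-right z x with z Fin.≟ z
  ... | yes _ = cong (λ b → if b then 1 else 0) (Bool.∨-zeroʳ (does (x Fin.≟ z)))
  ... | no ne = contradiction refl ne

  lower-bip : ∀ {w} z → Bip w → Bip (lower w z)
  lower-bip {w} z B = record
    { symm = λ x y → cong₂ _∸_ (symm x y)
                       (cong (λ b → if b then 1 else 0) (Bool.∨-comm (does (x Fin.≟ z)) _))
    ; bip  = λ x y lt → bip x y (ℕ.<-≤-trans lt (ℕ.m∸n≤m (w x y) (touches z x y))) }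
    where open Bip B

  ∸-strict : ∀ {a t} → t ≡ 1 → 0 < a → a ∸ t < a
  ∸-strict {suc a} refl _ = ℕ.≤-refl

  -- Lowering the weights at a vertex covered by every maximum matching lowers
  -- the maximum, which pays for one more unit of dual value at that vertex.
  -- The double negation does no harm: bounded dual values can be searched.
  egervary : ∀ k w → Bip w → volume w ≤ k →
             ¬ ¬ (∃[ m ] ∃[ y ] (Matching w m × Dual w y × ∑ (allFin n) y ≤ total w m))
  egervary k w B vol≤k with Fin.any? (λ a → Fin.any? λ b → 0 ℕ.<? w a b)
  ... | no none = λ done → done (id , (λ _ → 0) ,
          record { invol = λ _ → refl ; proper = λ x ne → contradiction refl ne } ,
          (λ u v → ℕ.≮⇒≥ λ lt → none (u , v , lt)) ,
          ℕ.≤-trans (ℕ.≤-reflexive (trans (∑-const (allFin n) 0) (ℕ.*-zeroʳ (length (allFin n))))) z≤n)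
  ... | yes (a , b , wab) with k
  ...   | zero = contradiction
            (ℕ.<-≤-trans wab (ℕ.≤-trans (∈⇒≤∑ (w a) (∈-allFin b))
              (ℕ.≤-trans (∈⇒≤∑ (λ x → ∑ (allFin n) (w x)) (∈-allFin a)) vol≤k)))
            λ ()
  ...   | suc k = ¬¬-bind (max-exists (volume w) id
                    (record { invol = λ _ → refl ; proper = λ x ne → contradiction refl ne })
                    (ℕ.m≤n+m _ _))
                  λ (M , maxM) →
                  ¬¬-bind covered λ (z , z∈ , cov) →
                  ¬¬-bind (egervary k (lower w z) (lower-bip z B) (volume-drops z z∈))
                  λ (m , y , isM , dual , ∑y≤) done →
                  done (M , (λ x → y x + ind z x) , proj₁ maxM , lift-dual {y = y} dual ,
                        lift-∑ maxM cov isM ∑y≤)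
    where
    open Bip B
    open Matching
    V = allFin n

    Covered : Fin n → Set
    Covered z = ∀ m → IsMax w m → m z ≢ z

    ¬¬-covered : ∀ a b → side a ≡ true → side b ≡ false → 0 < w a b →
                 ¬ ¬ (Covered a ⊎ Covered b)
    ¬¬-covered a b sa sb wab done =
      done (inj₁ λ f maxF fa → done (inj₂ λ g maxG gb →
        not-both-exposed B sa sb wab maxF fa maxG gb))

    covered : ¬ ¬ (∃[ z ] ((z ≡ a ⊎ z ≡ b) × Covered z))
    covered with side a in sa | side b in sb
    ... | true  | true  = contradiction (trans sa (sym sb)) (bip a b wab)
    ... | false | false = contradiction (trans sa (sym sb)) (bip a b wab)
    ... | true  | false = ¬¬-bind (¬¬-covered a b sa sb wab)
      λ { (inj₁ c) done → done (a , inj₁ refl , c) ; (inj₂ c) done → done (b , inj₂ refl , c) }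
    ... | false | true  = ¬¬-bind (¬¬-covered b a sb sa (subst (0 <_) (symm a b) wab))
      λ { (inj₁ c) done → done (b , inj₂ refl , c) ; (inj₂ c) done → done (a , inj₁ refl , c) }

    lower-≤ : ∀ z x y → lower w z x y ≤ w x y
    lower-≤ z x y = ℕ.m∸n≤m (w x y) (touches z x y)

    volume-drops : ∀ z → z ≡ a ⊎ z ≡ b → volume (lower w z) ≤ k
    volume-drops z z∈ = s≤s⁻¹ (ℕ.<-≤-trans
      (∑-mono-< (λ x → ∑-mono V (lower-≤ z x)) (∈-allFin a)
        (∑-mono-< (lower-≤ z a) (∈-allFin b) (∸-strict (hit z∈) wab)))
      vol≤k)
      where
      hit : ∀ {z} → z ≡ a ⊎ z ≡ b → touches z a b ≡ 1
      hit (inj₁ refl) = touches-left a b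
      hit (inj₂ refl) = touches-right b a

    lift-dual : ∀ {z y} → Dual (lower w z) y → Dual w (λ x → y x + ind z x)
    lift-dual {z} {y} dual u v = begin
      w u v                              ≤⟨ ℕ.m≤n+m∸n (w u v) (touches z u v) ⟩
      touches z u v + lower w z u v      ≤⟨ ℕ.+-mono-≤ (touches-≤ z u v) (dual u v) ⟩
      (ind z u + ind z v) + (y u + y v)  ≡⟨ ℕ.+-comm (ind z u + ind z v) _ ⟩
      (y u + y v) + (ind z u + ind z v)  ≡⟨ ℕ.+-assoc (y u) _ _ ⟩
      y u + (y v + (ind z u + ind z v))  ≡⟨ cong (y u +_) (ℕ.+-comm (y v) _) ⟩
      y u + (ind z u + ind z v + y v)    ≡⟨ cong (y u +_) (ℕ.+-assoc (ind z u) _ _) ⟩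
      y u + (ind z u + (ind z v + y v))  ≡⟨ cong (λ t → y u + (ind z u + t)) (ℕ.+-comm (ind z v) _) ⟩
      y u + (ind z u + (y v + ind z v))  ≡⟨ sym (ℕ.+-assoc (y u) _ _) ⟩
      (y u + ind z u) + (y v + ind z v)  ∎
      where open ℕ.≤-Reasoning

    lift-∑ : ∀ {M z m y} → IsMax w M → Covered z → Matching (lower w z) m →
             ∑ V y ≤ total (lower w z) m → ∑ V (λ x → y x + ind z x) ≤ total w M
    lift-∑ {M} {z} {m} {y} (isM , max) cov isL ∑y≤ = begin
      ∑ V (λ x → y x + ind z x)   ≡⟨ ∑-⊕ V y (ind z) ⟩
      ∑ V y + ∑ V (ind z)         ≡⟨ cong (∑ V y +_) (∑-delta Fin._≟_ (λ _ → 1) (allFin⁺ n) (∈-allFin z)) ⟩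
      ∑ V y + 1                   ≡⟨ ℕ.+-comm (∑ V y) 1 ⟩
      suc (∑ V y)                 ≤⟨ s≤s ∑y≤ ⟩
      suc (total (lower w z) m)   ≤⟨ room ⟩
      total w M                   ∎
      where
      open ℕ.≤-Reasoning
      is-w : Matching w m
      is-w = record { invol  = invol isL
                    ; proper = λ x ne → ℕ.<-≤-trans (proper isL x ne) (lower-≤ z x (m x)) }
      le : ∀ x → sideWeight (lower w z) m x ≤ sideWeight w m x
      le x with side x
      ... | true  = lower-≤ z x (m x)
      ... | false = z≤n
      -- The total is counted on the `true` side, so the unit lost at `z` shows either at `z` or at
      -- its partner.
      loses : m z ≢ z → total (lower w z) m < total w m
      loses ne with side z in sz
      ... | true = ∑-mono-< le (∈-allFin z) lt
        where
        lt : sideWeight (lower w z) m z < sideWeight w m z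
        lt rewrite sz = ∸-strict (touches-left z (m z)) (proper is-w z ne)
      ... | false = ∑-mono-< le (∈-allFin (m z)) lt
        where
        smz : side (m z) ≡ true
        smz with side (m z) in eq
        ... | true  = refl
        ... | false = contradiction (same-side B is-w z (trans eq (sym sz))) ne
        pos : 0 < w (m z) z
        pos = subst (0 <_) (symm z (m z)) (proper is-w z ne)
        lt : sideWeight (lower w z) m (m z) < sideWeight w m (m z)
        lt rewrite smz | invol isL z = ∸-strict (touches-right z (m z)) pos
      -- Either `m` weighs less than `M` under `w`, and then the strict inequality is already there;
      -- or `m` is maximum for `w` too, so it covers `z` and the lowering costs it a unit.
      room : suc (total (lower w z) m) ≤ total w M
      room with total w m ℕ.<? total w M
      ... | yes lt = ℕ.≤-trans (s≤s (∑-mono V le)) lt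
      ... | no ≮   = ℕ.≤-trans
        (loses (cov m (is-w , λ m′ M′ → ℕ.≤-trans (max m′ M′) (ℕ.≮⇒≥ ≮))))
        (max m is-w)

-- The list of all edges, and linear functionals of the stream

module _ {A B : Set} {f : A → Maybe B} where

  mapMaybe-All : ∀ {Q : B → Set} xs → (∀ {x b} → f x ≡ just b → Q b) → All Q (mapMaybe f xs)
  mapMaybe-All []       q = []
  mapMaybe-All (x ∷ xs) q with f x in eq
  ... | just b  = q eq ∷ mapMaybe-All xs q
  ... | nothing = mapMaybe-All xs q

  mapMaybe-AllPairs : ∀ {R : A → A → Set} {S : B → B → Set} {xs} → AllPairs R xs →
                      (∀ {x y b c} → R x y → f x ≡ just b → f y ≡ just c → S b c) →
                      AllPairs S (mapMaybe f xs)
  mapMaybe-AllPairs []                   s = []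
  mapMaybe-AllPairs {R} {S} {x ∷ xs} (rx ∷ rs) s with f x in eq
  ... | just b  = head rx ∷ mapMaybe-AllPairs rs s
    where
    head : ∀ {ys} → All (R x) ys → All (S b) (mapMaybe f ys)
    head []       = []
    head {y ∷ _} (r ∷ rs) with f y in eq′
    ... | just c  = s r eq eq′ ∷ head rs
    ... | nothing = head rs
  ... | nothing = mapMaybe-AllPairs rs s

  ∈-mapMaybe : ∀ {xs x b} → x ∈ xs → f x ≡ just b → b ∈ mapMaybe f xs
  ∈-mapMaybe (here refl) eq rewrite eq = here refl
  ∈-mapMaybe {y ∷ _} (there x∈) eq with f y
  ... | just _  = there (∈-mapMaybe x∈ eq)
  ... | nothing = ∈-mapMaybe x∈ eq

  ∑-mapMaybe : ∀ xs (h : B → ℕ) → ∑ (mapMaybe f xs) h ≡ ∑ xs (λ x → maybe′ h 0 (f x))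
  ∑-mapMaybe []       h = refl
  ∑-mapMaybe (x ∷ xs) h with f x
  ... | just b  = cong (h b +_) (∑-mapMaybe xs h)
  ... | nothing = ∑-mapMaybe xs h

src≢tgt : ∀ {n} (e : Edge n) → src e ≢ tgt e
src≢tgt (edge u v u<v) refl = Fin.<-irrefl refl (recompute (u Fin.<? v) u<v)

orient : ∀ {n} → Fin n × Fin n → Maybe (Edge n)
orient (u , v) with u Fin.<? v
... | yes u<v = just (edge u v u<v)
... | no  _   = nothing

orient-just : ∀ {n} {p : Fin n × Fin n} {e} → orient p ≡ just e → p ≡ (src e , tgt e)
orient-just {p = u , v} eq with u Fin.<? v | eq
... | yes _ | refl = refl

orient-edge : ∀ {n} (e : Edge n) → orient (src e , tgt e) ≡ just e
orient-edge (edge u v u<v) with u Fin.<? v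
... | yes _ = refl
... | no u≮v = contradiction (recompute (u Fin.<? v) u<v) u≮v

allEdges : ∀ n → List (Edge n)
allEdges n = mapMaybe orient (cartesianProduct (allFin n) (allFin n))

allEdges-unique : ∀ n → Unique (allEdges n)
allEdges-unique n = mapMaybe-AllPairs (cartesianProduct⁺ (allFin⁺ n) (allFin⁺ n))
  λ p≢q eq eq′ b≡c → p≢q (trans (orient-just eq)
    (trans (cong (λ e → src e , tgt e) b≡c) (sym (orient-just eq′))))

∈-allEdges : ∀ {n} (e : Edge n) → e ∈ allEdges n
∈-allEdges e = ∈-mapMaybe (∈-cartesianProduct⁺ (∈-allFin (src e)) (∈-allFin (tgt e))) (orient-edge e)

module _ {n W : ℕ} where

  streamSum : Stream n W → (Edge n → Fin W → ℤ) → ℤ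
  streamSum τ q = ℤSum.∑ τ λ (update e w Δ) → (Δ ◃ 1) ℤ.* q e w

  -- Grouping the tokens by edge and weight leaves only the final multiplicities, so the
  -- intermediate ones may be anything, even negative.
  streamSum-multiplicity : ∀ τ q → streamSum τ q ≡
    ℤSum.∑ (allEdges n) λ e → ℤSum.∑ (allFin W) λ w → multiplicity τ e w ℤ.* q e w
  streamSum-multiplicity [] q = sym (ℤSum.∑-zero (allEdges n) (All.universal
    (λ _ → ℤSum.∑-zero (allFin W) (All.universal (λ _ → refl) _)) _))
  streamSum-multiplicity (update e′ w′ Δ ∷ τ) q = sym (begin
      ℤSum.∑ E (λ e → ℤSum.∑ V λ w → (δ e w ℤ.+ multiplicity τ e w) ℤ.* q e w)
    ≡⟨ ℤSum.∑-cong E (λ e → trans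
         (ℤSum.∑-cong V λ w → ℤ.*-distribʳ-+ (q e w) (δ e w) (multiplicity τ e w))
         (ℤSum.∑-⊕ V (λ w → δ e w ℤ.* q e w) (λ w → multiplicity τ e w ℤ.* q e w))) ⟩
      ℤSum.∑ E (λ e → ℤSum.∑ V (λ w → δ e w ℤ.* q e w) ℤ.+ ℤSum.∑ V (λ w → multiplicity τ e w ℤ.* q e w))
    ≡⟨ ℤSum.∑-⊕ E (λ e → ℤSum.∑ V (λ w → δ e w ℤ.* q e w)) _ ⟩
      ℤSum.∑ E (λ e → ℤSum.∑ V (λ w → δ e w ℤ.* q e w)) ℤ.+ _
    ≡⟨ cong₂ ℤ._+_ single (sym (streamSum-multiplicity τ q)) ⟩
      (Δ ◃ 1) ℤ.* q e′ w′ ℤ.+ streamSum τ q ∎)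
    where
    open ≡-Reasoning
    E = allEdges n
    V = allFin W
    δ : Edge n → Fin W → ℤ
    δ e w = if does ((e′ ≟ₑ e) ×-dec (w′ Fin.≟ w)) then Δ ◃ 1 else 0ℤ
    off : ∀ e w → ¬ (e′ ≡ e × w′ ≡ w) → δ e w ℤ.* q e w ≡ 0ℤ
    off e w ne = cong (λ b → (if b then Δ ◃ 1 else 0ℤ) ℤ.* q e w)
      (dec-false ((e′ ≟ₑ e) ×-dec (w′ Fin.≟ w)) ne)
    on : δ e′ w′ ≡ Δ ◃ 1
    on = cong (λ b → if b then Δ ◃ 1 else 0ℤ)
      (dec-true ((e′ ≟ₑ e′) ×-dec (w′ Fin.≟ w′)) (refl , refl))
    single : ℤSum.∑ E (λ e → ℤSum.∑ V (λ w → δ e w ℤ.* q e w)) ≡ (Δ ◃ 1) ℤ.* q e′ w′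
    single = begin
      ℤSum.∑ E (λ e → ℤSum.∑ V (λ w → δ e w ℤ.* q e w))
        ≡⟨ ℤSum.∑-single (allEdges-unique n) (∈-allEdges e′)
             (λ e ne → ℤSum.∑-zero V (All.universal (λ w → off e w (ne ∘ sym ∘ proj₁)) _)) ⟩
      ℤSum.∑ V (λ w → δ e′ w ℤ.* q e′ w)
        ≡⟨ ℤSum.∑-single (allFin⁺ W) (∈-allFin w′) (λ w ne → off e′ w (ne ∘ sym ∘ proj₂)) ⟩
      δ e′ w′ ℤ.* q e′ w′
        ≡⟨ cong (ℤ._* q e′ w′) on ⟩
      (Δ ◃ 1) ℤ.* q e′ w′ ∎

  streamSum-describes : ∀ {τ} {G : Graph n W} q → τ Describes G →
    streamSum τ q ≡ ℤSum.∑ (allEdges n) λ e → maybe′ (q e) 0ℤ (G e)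
  streamSum-describes {τ} {G} q desc = trans (streamSum-multiplicity τ q)
    (ℤSum.∑-cong (allEdges n) λ e → trans
      (ℤSum.∑-cong (allFin W) λ w → cong (ℤ._* q e w) (desc e w))
      (collapse e (G e)))
    where
    collapse : ∀ e (g : Maybe (Fin W)) →
      ℤSum.∑ (allFin W) (λ w → (if does (Maybe.≡-dec Fin._≟_ g (just w)) then 1ℤ else 0ℤ) ℤ.* q e w)
        ≡ maybe′ (q e) 0ℤ g
    collapse e nothing = ℤSum.∑-zero (allFin W) (All.universal (λ _ → refl) _)
    collapse e (just w) = trans (ℤSum.∑-single (allFin⁺ W) (∈-allFin w) off) on
      where
      off : ∀ w′ → w′ ≢ w → (if does (w Fin.≟ w′) then 1ℤ else 0ℤ) ℤ.* q e w′ ≡ 0ℤ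
      off w′ ne with w Fin.≟ w′
      ... | yes eq = contradiction (sym eq) ne
      ... | no _   = refl
      on : (if does (w Fin.≟ w) then 1ℤ else 0ℤ) ℤ.* q e w ≡ q e w
      on with w Fin.≟ w
      ... | yes _ = ℤ.*-identityˡ _
      ... | no ne = contradiction refl ne

-- Weak duality and soundness of the certificate

incident : ∀ {n} → Edge n → Fin n → (Fin n → ℕ) → ℕ
incident e x y = (if does (x Fin.≟ src e) then y x else 0) + (if does (x Fin.≟ tgt e) then y x else 0)

-- Double counting: the left side charges `y x` once for each edge of `M` at `x`, and by
-- disjointness there is at most one.
disjoint-∑-≤ : ∀ {n} {M : List (Edge n)} → AllPairs Disjoint M → ∀ (y : Fin n → ℕ) →
               ∑ M (λ e → y (src e) + y (tgt e)) ≤ ∑ (allFin n) y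
disjoint-∑-≤ {n} {M} dis y = begin
  ∑ M (λ e → y (src e) + y (tgt e))        ≡⟨ ∑-cong M spread ⟩
  ∑ M (λ e → ∑ V (λ x → incident e x y))   ≡⟨ ∑-swap M V _ ⟩
  ∑ V (λ x → ∑ M (λ e → incident e x y))   ≤⟨ ∑-mono V (λ x → degree dis x) ⟩
  ∑ V y                                    ∎
  where
  open ℕ.≤-Reasoning
  V = allFin n
  spread : ∀ e → y (src e) + y (tgt e) ≡ ∑ V (λ x → incident e x y)
  spread e = sym (trans (∑-⊕ V _ _) (cong₂ _+_
    (∑-delta Fin._≟_ y (allFin⁺ n) (∈-allFin (src e)))
    (∑-delta Fin._≟_ y (allFin⁺ n) (∈-allFin (tgt e)))))
  away : ∀ {e x} → x ≢ src e → x ≢ tgt e → incident e x y ≡ 0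
  away {e} {x} xs xt with x Fin.≟ src e | x Fin.≟ tgt e
  ... | yes eq | _      = contradiction eq xs
  ... | no _   | yes eq = contradiction eq xt
  ... | no _   | no _   = refl
  degree : ∀ {M} → AllPairs Disjoint M → ∀ x → ∑ M (λ e → incident e x y) ≤ y x
  degree [] x = z≤n
  degree {e ∷ M} (d ∷ ds) x with x Fin.≟ src e | x Fin.≟ tgt e
  ... | no _ | no _ = degree ds x
  ... | yes refl | yes eq = contradiction eq (src≢tgt e)
  ... | yes refl | no _ = ℕ.≤-reflexive (trans
    (cong (y x + 0 +_) (∑-zero M (All.map (λ {f} (ss , st , _) → away {f} ss st) d)))
    (trans (ℕ.+-identityʳ _) (ℕ.+-identityʳ _)))
  ... | no _ | yes refl = ℕ.≤-reflexive (trans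
    (cong (y x +_) (∑-zero M (All.map (λ {f} (_ , _ , ts , tt) → away {f} ts tt) d)))
    (ℕ.+-identityʳ _))

module Certificate {n W : ℕ} (G : Graph n W) where

  Feasible : (Fin n → ℕ) → Set
  Feasible y = ∀ e w → G e ≡ just w → value w ≤ y (src e) + y (tgt e)

  feasible-edge : ∀ {y} → Feasible y → ∀ e → edgeWeight G e ≤ y (src e) + y (tgt e)
  feasible-edge feas e with G e in eq
  ... | just w  = feas e w eq
  ... | nothing = z≤n

  weak-duality : ∀ {y M} → Feasible y → IsMatching G M → matchingWeight G M ≤ ∑ (allFin n) y
  weak-duality {y} {M} feas isM = ℕ.≤-trans (∑-mono M (feasible-edge {y} feas))
    (disjoint-∑-≤ (IsMatching.disjoint isM) y)

  -- The constant dual value `W` is feasible, so weak duality applies to it.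
  weight-bound : ∀ {v} → IsMaxMatchingWeight G v → v ≤ n * W
  weight-bound isMax with IsMaxMatchingWeight.attained isMax
  ... | M , isM , refl = ℕ.≤-trans
    (weak-duality {λ _ → W} (λ e w _ → ℕ.≤-trans (Fin.toℕ<n w) (ℕ.m≤m+n W W)) isM)
    (ℕ.≤-reflexive (trans (∑-const (allFin n) W) (cong (_* W) (List.length-tabulate {n = n} id))))

  penalty : ℕ
  penalty = suc (n * W)

  module _ (y : Fin n → ℕ) (p : Fin n → Fin n → Bool) where

    gain loss : Edge n → Fin W → ℕ
    gain e w = if p (src e) (tgt e) ∧ p (tgt e) (src e) then value w else 0
    loss e w = if y (src e) + y (tgt e) <ᵇ value w then penalty else 0

    score : Edge n → Fin W → ℤ
    score e w = ℤ.+ gain e w ℤ.- ℤ.+ loss e w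

    totalScore : ℤ
    totalScore = ℤSum.∑ (allEdges n) λ e → maybe′ (score e) 0ℤ (G e)

    totalGain totalLoss : ℕ
    totalGain = ∑ (allEdges n) λ e → maybe′ (gain e) 0 (G e)
    totalLoss = ∑ (allEdges n) λ e → maybe′ (loss e) 0 (G e)

    -- The additive form lets `certificate-sound` make its comparisons in ℕ.
    totalScore-split : totalScore ℤ.+ ℤ.+ totalLoss ≡ ℤ.+ totalGain
    totalScore-split = go (allEdges n)
      where
      regroup : ∀ a b c d → (a ℤ.+ b) ℤ.+ (c ℤ.+ d) ≡ (a ℤ.+ c) ℤ.+ (b ℤ.+ d)
      regroup = ℤ-solve
      cancel : ∀ a b → (a ℤ.- b) ℤ.+ b ≡ a
      cancel = ℤ-solve
      edgewise : ∀ e → maybe′ (score e) 0ℤ (G e) ℤ.+ ℤ.+ maybe′ (loss e) 0 (G e)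
                     ≡ ℤ.+ maybe′ (gain e) 0 (G e)
      edgewise e with G e
      ... | just w  = cancel (ℤ.+ gain e w) (ℤ.+ loss e w)
      ... | nothing = refl
      go : ∀ es → ℤSum.∑ es (λ e → maybe′ (score e) 0ℤ (G e)) ℤ.+ ℤ.+ ∑ es (λ e → maybe′ (loss e) 0 (G e))
                ≡ ℤ.+ ∑ es (λ e → maybe′ (gain e) 0 (G e))
      go [] = refl
      go (e ∷ es) = trans (regroup (maybe′ (score e) 0ℤ (G e)) _ (ℤ.+ maybe′ (loss e) 0 (G e)) _)
        (cong₂ ℤ._+_ (edgewise e) (go es))

    module _ (functional : ∀ {u v v′} → p u v ≡ true → p u v′ ≡ true → v ≡ v′) where

      totalGain-≤ : ∀ {v} → IsMaxMatchingWeight G v → totalGain ≤ v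
      totalGain-≤ isMax = subst (_≤ _) weight
        (IsMaxMatchingWeight.maximal isMax matched record { edges = edges ; disjoint = disjoint })
        where
        select : Edge n → Maybe (Edge n)
        select e = if (p (src e) (tgt e) ∧ p (tgt e) (src e)) ∧ is-just (G e) then just e else nothing
        matched : List (Edge n)
        matched = mapMaybe select (allEdges n)
        select-just : ∀ {e f} → select e ≡ just f →
                      e ≡ f × p (src e) (tgt e) ≡ true × p (tgt e) (src e) ≡ true × IsEdge G e
        select-just {e} eq with p (src e) (tgt e) | p (tgt e) (src e) | G e | eq
        ... | true | true | just _ | refl = refl , refl , refl , Maybe.just _
        edges : All (IsEdge G) matched
        edges = mapMaybe-All (allEdges n) λ eq → case select-just eq of λ { (refl , _ , _ , is) → is }
        edge-≡ : ∀ {e f : Edge n} → src e ≡ src f → tgt e ≡ tgt f → e ≡ f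
        edge-≡ {edge _ _ _} {edge _ _ _} refl refl = refl
        -- Mutual naming makes two edges with a common endpoint agree in the other endpoint as well.
        -- Here it is excluded that they list the two in opposite orders.
        crossed : ∀ (e f : Edge n) → src e ≡ tgt f → tgt e ≡ src f → ⊥
        crossed (edge u v lt) (edge u′ v′ lt′) refl refl =
          Fin.<-asym (recompute (u Fin.<? v) lt) (recompute (u′ Fin.<? v′) lt′)
        shift : ∀ {u u′ v} → u ≡ u′ → p u′ v ≡ true → p u v ≡ true
        shift refl q = q
        disjoint : AllPairs Disjoint matched
        disjoint = mapMaybe-AllPairs (allEdges-unique n) λ {e} {f} e≢f eq eq′ →
          case select-just eq , select-just eq′ of λ { ((refl , p₁ , p₂ , _) , (refl , q₁ , q₂ , _)) →
            (λ ss → e≢f (edge-≡ ss (functional p₁ (shift ss q₁)))) ,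
            (λ st → crossed e f st (functional p₁ (shift st q₂))) ,
            (λ ts → crossed e f (functional p₂ (shift ts q₁)) ts) ,
            (λ tt → e≢f (edge-≡ (functional p₂ (shift tt q₂)) tt)) }
        weight : matchingWeight G matched ≡ totalGain
        weight = trans (∑-mapMaybe (allEdges n) (edgeWeight G)) (∑-cong (allEdges n) eq)
          where
          eq : ∀ e → maybe′ (edgeWeight G) 0 (select e) ≡ maybe′ (gain e) 0 (G e)
          eq e with p (src e) (tgt e) ∧ p (tgt e) (src e) | G e in g
          ... | true  | just _  = cong (maybe′ value 0) g
          ... | true  | nothing = refl
          ... | false | just _  = refl
          ... | false | nothing = refl

      -- Because dual values are nonnegative, `balance` bounds the loss by the gain, hence by
      -- `n * W`, which is less than the penalty of one violated edge. So `y` is feasible and weak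
      -- duality gives one inequality; `balance` itself gives the other.
      certificate-sound : ∀ {v} → IsMaxMatchingWeight G v → totalScore ≡ ℤ.+ ∑ (allFin n) y →
                          ∑ (allFin n) y ≡ v
      certificate-sound {v} isMax eq = ℕ.≤-antisym below above
        where
        balance : ∑ (allFin n) y + totalLoss ≡ totalGain
        balance = ℤ.+-injective (trans (cong (ℤ._+ ℤ.+ totalLoss) (sym eq)) totalScore-split)
        below : ∑ (allFin n) y ≤ v
        below = ℕ.≤-trans (ℕ.m≤m+n _ totalLoss) (ℕ.≤-trans (ℕ.≤-reflexive balance) (totalGain-≤ isMax))
        loss-≤ : totalLoss ≤ n * W
        loss-≤ = ℕ.≤-trans (ℕ.m≤n+m totalLoss (∑ (allFin n) y))
          (ℕ.≤-trans (ℕ.≤-reflexive balance) (ℕ.≤-trans (totalGain-≤ isMax) (weight-bound isMax)))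
        feasible : Feasible y
        feasible e w g with y (src e) + y (tgt e) ℕ.<? value w
        ... | no ≮   = ℕ.≮⇒≥ ≮
        ... | yes lt = contradiction (ℕ.≤-trans penalised loss-≤) (ℕ.<-irrefl refl)
          where
          at-e : penalty ≤ maybe′ (loss e) 0 (G e)
          at-e rewrite g | Bool.T-≡ .Equivalence.to (ℕ.<⇒<ᵇ lt) = ℕ.≤-refl
          penalised : penalty ≤ totalLoss
          penalised = ℕ.≤-trans at-e (∈⇒≤∑ (λ e → maybe′ (loss e) 0 (G e)) (∈-allEdges e))
        above : v ≤ ∑ (allFin n) y
        above with IsMaxMatchingWeight.attained isMax
        ... | M , isM , refl = weak-duality feasible isM

-- The honest certificate

-- Exhaustive search makes the existence of a bounded dual decidable, which is what removes the
-- double negation from Egerváry's theorem.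
search : ∀ n b {P : Vec (Fin b) n → Set} → Decidable P → Dec (∃ P)
search zero    b P? = map′ (λ p → [] , p) (λ { ([] , p) → p }) (P? [])
search (suc n) b P? = map′ (λ (i , is , p) → i ∷ is , p) (λ { (i ∷ is , p) → i , is , p })
  (Fin.any? λ i → search n b (λ is → P? (i ∷ is)))

toEdge : ∀ {n} → Fin n → Fin n → Maybe (Edge n)
toEdge x y with Fin.<-cmp x y
... | tri< x<y _ _ = just (edge x y x<y)
... | tri≈ _ _ _   = nothing
... | tri> _ _ y<x = just (edge y x y<x)

toEdge-sym : ∀ {n} (x y : Fin n) → toEdge x y ≡ toEdge y x
toEdge-sym x y with Fin.<-cmp x y | Fin.<-cmp y x
... | tri< _ _ _   | tri> _ _ _   = refl
... | tri> _ _ _   | tri< _ _ _   = refl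
... | tri≈ _ _ _   | tri≈ _ _ _   = refl
... | tri< a _ _   | tri< b _ _   = contradiction b (Fin.<-asym a)
... | tri< _ ne _  | tri≈ _ eq _  = contradiction (sym eq) ne
... | tri≈ _ eq _  | tri< _ ne _  = contradiction (sym eq) ne
... | tri≈ _ eq _  | tri> _ ne _  = contradiction (sym eq) ne
... | tri> _ ne _  | tri≈ _ eq _  = contradiction (sym eq) ne
... | tri> _ _ a   | tri> _ _ b   = contradiction b (Fin.<-asym a)

toEdge-just : ∀ {n} {x y : Fin n} {e} → toEdge x y ≡ just e →
              (src e ≡ x × tgt e ≡ y) ⊎ (src e ≡ y × tgt e ≡ x)
toEdge-just {x = x} {y} eq with Fin.<-cmp x y | eq
... | tri< _ _ _ | refl = inj₁ (refl , refl)
... | tri> _ _ _ | refl = inj₂ (refl , refl)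

toEdge-edge : ∀ {n} (e : Edge n) → toEdge (src e) (tgt e) ≡ just e
toEdge-edge (edge u v u<v) with Fin.<-cmp u v
... | tri< _ _ _   = refl
... | tri≈ ≮ _ _   = contradiction (recompute (u Fin.<? v) u<v) ≮
... | tri> ≮ _ _   = contradiction (recompute (u Fin.<? v) u<v) ≮

-- An uncovered vertex names itself; since edges have distinct endpoints, this creates no mutual
-- pair.
partner : ∀ {n} → List (Edge n) → Fin n → Fin n
partner []      x = x
partner (e ∷ M) x = if does (x Fin.≟ src e) then tgt e else
                    if does (x Fin.≟ tgt e) then src e else partner M x

partner-src : ∀ {n} {M : List (Edge n)} {e} → AllPairs Disjoint M → e ∈ M → partner M (src e) ≡ tgt e
partner-src {e = e} _ (here refl)
  rewrite dec-true (src e Fin.≟ src e) refl = refl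
partner-src {M = f ∷ M} {e} (d ∷ ds) (there e∈) with All.lookup d e∈
... | ss , st , ts , tt
  rewrite dec-false (src e Fin.≟ src f) (ss ∘ sym) | dec-false (src e Fin.≟ tgt f) (ts ∘ sym) = partner-src ds e∈

partner-tgt : ∀ {n} {M : List (Edge n)} {e} → AllPairs Disjoint M → e ∈ M → partner M (tgt e) ≡ src e
partner-tgt {e = e} _ (here refl)
  rewrite dec-false (tgt e Fin.≟ src e) (src≢tgt e ∘ sym) | dec-true (tgt e Fin.≟ tgt e) refl = refl
partner-tgt {M = f ∷ M} {e} (d ∷ ds) (there e∈) with All.lookup d e∈
... | ss , st , ts , tt
  rewrite dec-false (tgt e Fin.≟ src f) (st ∘ sym) | dec-false (tgt e Fin.≟ tgt f) (tt ∘ sym) = partner-tgt ds e∈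

-- Pairwise disjoint edges are distinct, so `M` is a part of `allEdges n` without repetitions.
∑-sublist-≤ : ∀ {n} {M : List (Edge n)} {f g : Edge n → ℕ} → AllPairs Disjoint M →
              (∀ {e} → e ∈ M → f e ≤ g e) → ∑ M f ≤ ∑ (allEdges n) g
∑-sublist-≤ {n} {M} {f} {g} dis le = begin
  ∑ M f                                                            ≡⟨ ∑-cong M spread ⟩
  ∑ M (λ e → ∑ E (λ x → if does (x ≟ₑ e) then f x else 0))         ≡⟨ ∑-swap M E _ ⟩
  ∑ E (λ x → ∑ M (λ e → if does (x ≟ₑ e) then f x else 0))         ≤⟨ ∑-mono E (λ x → inner x dis le) ⟩
  ∑ E g                                                            ∎
  where
  open ℕ.≤-Reasoning
  E = allEdges n
  spread : ∀ e → f e ≡ ∑ E (λ x → if does (x ≟ₑ e) then f x else 0)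
  spread e = sym (∑-delta _≟ₑ_ f (allEdges-unique n) (∈-allEdges e))
  inner : ∀ x {M} → AllPairs Disjoint M → (∀ {e} → e ∈ M → f e ≤ g e) →
          ∑ M (λ e → if does (x ≟ₑ e) then f x else 0) ≤ g x
  inner x [] le = z≤n
  inner x {e ∷ M} (d ∷ ds) le with does (x ≟ₑ e) in eq
  ... | false = inner x ds (le ∘ there)
  ... | true with x ≟ₑ e | eq
  ...   | yes refl | _ = ℕ.≤-trans (ℕ.≤-reflexive (trans
            (cong (f x +_) (∑-zero M (All.map off d))) (ℕ.+-identityʳ _))) (le (here refl))
    where
    off : ∀ {e} → Disjoint x e → (if does (x ≟ₑ e) then f x else 0) ≡ 0
    off {e} (ss , _) = cong (λ b → if b then f x else 0) (dec-false (x ≟ₑ e) λ { refl → ss refl })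

module _ {n W : ℕ} (G : Graph n W) where
  open Certificate G

  pairWeight : Fin n → Fin n → ℕ
  pairWeight x y = maybe′ (edgeWeight G) 0 (toEdge x y)

  pairWeight-pos : ∀ {x y} → 0 < pairWeight x y → ∃[ e ] (toEdge x y ≡ just e × IsEdge G e)
  pairWeight-pos {x} {y} lt with toEdge x y
  ... | just e = e , refl , isEdge lt
    where
    isEdge : 0 < edgeWeight G e → IsEdge G e
    isEdge lt with G e
    ... | just _ = Maybe.just _

  module _ {v : ℕ} (bipartite : IsBipartite G) (isMax : IsMaxMatchingWeight G v) where
    side = proj₁ bipartite
    open Egervary side

    pairWeight-bip : Bip pairWeight
    pairWeight-bip = record
      { symm = λ x y → cong (maybe′ (edgeWeight G) 0) (toEdge-sym x y)
      ; bip  = λ x y lt → case pairWeight-pos {x} {y} lt of λ (e , eq , is) →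
                 case toEdge-just {x = x} {y} eq of λ
                   { (inj₁ (refl , refl)) → proj₂ bipartite e is
                   ; (inj₂ (refl , refl)) → proj₂ bipartite e is ∘ sym } }

    -- Taking the edge at each covered vertex of the `true` side turns the involution into a list of
    -- edges of the same weight. The edges are disjoint because `m` is injective and changes sides
    -- along matched pairs; the four cases are the orientations of two edges.
    total-≤ : ∀ {m} → Matching pairWeight m → total pairWeight m ≤ v
    total-≤ {m} M = subst (_≤ v) weight
      (IsMaxMatchingWeight.maximal isMax chosen record { edges = edges ; disjoint = disjoint })
      where
      open Matching M
      V = allFin n
      select : Fin n → Maybe (Edge n)
      select x = if side x then toEdge x (m x) else nothing
      chosen = mapMaybe select V
      select-just : ∀ {x e} → select x ≡ just e →
                    side x ≡ true × side (m x) ≡ false × toEdge x (m x) ≡ just e × IsEdge G e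
      select-just {x} eq with side x in sx
      ... | true with m x Fin.≟ x
      ...   | yes mx rewrite mx with Fin.<-cmp x x
      ...     | tri< lt _ _ = contradiction lt (Fin.<-irrefl refl)
      ...     | tri> _ _ gt = contradiction gt (Fin.<-irrefl refl)
      select-just {x} eq | true | no ne with pairWeight-pos (proper x ne)
      ...   | e , eq′ , is with trans (sym eq) eq′
      ...     | refl = refl , other , eq′ , is
        where
        other : side (m x) ≡ false
        other with side (m x) in smx
        ... | false = refl
        ... | true  = contradiction (trans sx (sym smx)) (Bip.bip pairWeight-bip x (m x) (proper x ne))
      edges : All (IsEdge G) chosen
      edges = mapMaybe-All V λ eq → proj₂ (proj₂ (proj₂ (select-just eq)))
      opposite : ∀ {x y} → side x ≡ true → side y ≡ false → x ≢ y
      opposite sx sy refl = contradiction (trans (sym sx) sy) λ ()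
      m-inj : ∀ {x y} → x ≢ y → m x ≢ m y
      m-inj ne eq = ne (trans (sym (invol _)) (trans (cong m eq) (invol _)))
      disjoint : AllPairs Disjoint chosen
      disjoint = mapMaybe-AllPairs (allFin⁺ n) λ x≢y eq eq′ →
        case select-just eq , select-just eq′ of λ ((sx , smx , ex , _) , (sy , smy , ey , _)) →
        case toEdge-just ex , toEdge-just ey of λ
          { (inj₁ (refl , refl) , inj₁ (refl , refl)) →
              x≢y , opposite sx smy , opposite sy smx ∘ sym , m-inj x≢y
          ; (inj₁ (refl , refl) , inj₂ (refl , refl)) →
              opposite sx smy , x≢y , m-inj x≢y , opposite sy smx ∘ sym
          ; (inj₂ (refl , refl) , inj₁ (refl , refl)) →
              opposite sy smx ∘ sym , m-inj x≢y , x≢y , opposite sx smy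
          ; (inj₂ (refl , refl) , inj₂ (refl , refl)) →
              m-inj x≢y , opposite sy smx ∘ sym , opposite sx smy , x≢y }
      weight : matchingWeight G chosen ≡ total pairWeight m
      weight = trans (∑-mapMaybe V (edgeWeight G)) (∑-cong V eq)
        where
        eq : ∀ x → maybe′ (edgeWeight G) 0 (select x) ≡ sideWeight pairWeight m x
        eq x with side x
        ... | true  = refl
        ... | false = refl

    dual-feasible : ∀ {y} → Dual pairWeight y → Feasible y
    dual-feasible dual e w g = subst (_≤ _)
      (trans (cong (maybe′ (edgeWeight G) 0) (toEdge-edge e)) (cong (maybe′ value 0) g))
      (dual (src e) (tgt e))

    -- Each dual value is at most their sum, hence at most `v`: the search through `Fin (suc v)` is
    -- large enough.
    optimal-dual : ∃[ y ] (Feasible y × ∑ (allFin n) y ≡ v)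
    optimal-dual with decidable-stable (search n (suc v) good?) exists
      where
      Good : Vec (Fin (suc v)) n → Set
      Good ys = Dual pairWeight (toℕ ∘ lookup ys) × ∑ (allFin n) (toℕ ∘ lookup ys) ≤ v
      good? : Decidable Good
      good? ys = Fin.all? (λ _ → Fin.all? λ _ → _ ℕ.≤? _) ×-dec (_ ℕ.≤? _)
      exists : ¬ ¬ ∃ Good
      exists = ¬¬-bind (egervary _ pairWeight pairWeight-bip ℕ.≤-refl)
        λ (m , y , isM , dual , ∑≤) done →
          let ∑y≤v = ℕ.≤-trans ∑≤ (total-≤ isM)
              y< = λ x → s≤s (ℕ.≤-trans (∈⇒≤∑ y (∈-allFin x)) ∑y≤v)
              ys = tabulate (λ x → fromℕ< (y< x))
              ys≡y = λ x → trans (cong toℕ (Vec.lookup∘tabulate (λ x → fromℕ< (y< x)) x)) (Fin.toℕ-fromℕ< (y< x))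
          in done (ys , (λ a b → subst₂ (λ s t → _ ≤ s + t) (sym (ys≡y a)) (sym (ys≡y b)) (dual a b))
                      , subst (_≤ v) (sym (∑-cong (allFin n) ys≡y)) ∑y≤v)
    ... | ys , dual , ∑≤ = toℕ ∘ lookup ys , feasible , ℕ.≤-antisym ∑≤ above
      where
      feasible = dual-feasible {toℕ ∘ lookup ys} dual
      above : v ≤ ∑ (allFin n) (toℕ ∘ lookup ys)
      above with IsMaxMatchingWeight.attained isMax
      ... | M , isM , refl = weak-duality feasible isM

    -- The score is stated for all `y′` and `p` that agree pointwise with the certificate, since the
    -- protocol decodes its dual values and names from bit strings. The mates come from a maximum
    -- matching of `G`, not from the involution of `egervary`.
    certificate-complete : ∃[ y ] ∃[ mate ] (∑ (allFin n) y ≡ v ×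
      (∀ y′ p → (∀ u → y′ u ≡ y u) → (∀ u x → p u x ≡ does (mate u Fin.≟ x)) → totalScore y′ p ≡ ℤ.+ v))
    certificate-complete with optimal-dual | IsMaxMatchingWeight.attained isMax
    ... | y , feas , ∑y | M , isM , wM = y , partner M , ∑y , score-v
      where
      open IsMatching isM
      module _ (y′ : Fin n → ℕ) (p : Fin n → Fin n → Bool) (y≡ : ∀ u → y′ u ≡ y u) (p≡ : ∀ u x → p u x ≡ does (partner M u Fin.≟ x)) where
        p-true : ∀ {u x} → p u x ≡ true → partner M u ≡ x
        p-true {u} {x} eq with partner M u Fin.≟ x | trans (sym (p≡ u x)) eq
        ... | yes e | _ = e
        true-p : ∀ {u x} → partner M u ≡ x → p u x ≡ true
        true-p {u} {x} eq = trans (p≡ u x) (dec-true (partner M u Fin.≟ x) eq)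
        gain-≥ : v ≤ totalGain y′ p
        gain-≥ = subst (_≤ _) wM (∑-sublist-≤ disjoint at)
          where
          at : ∀ {e} → e ∈ M → edgeWeight G e ≤ maybe′ (gain y′ p e) 0 (G e)
          at {e} e∈ with G e
          ... | nothing = z≤n
          ... | just w rewrite true-p (partner-src disjoint e∈) | true-p (partner-tgt disjoint e∈) = ℕ.≤-refl
        gain-v : totalGain y′ p ≡ v
        gain-v = ℕ.≤-antisym (totalGain-≤ y′ p (λ a b → trans (sym (p-true a)) (p-true b)) isMax) gain-≥
        loss-0 : totalLoss y′ p ≡ 0
        loss-0 = ∑-zero (allEdges n) (All.universal at _)
          where
          at : ∀ e → maybe′ (loss y′ p e) 0 (G e) ≡ 0
          at e with G e in g
          ... | nothing = refl
          ... | just w with y′ (src e) + y′ (tgt e) <ᵇ value w in lt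
          ...   | false = refl
          ...   | true = contradiction
                  (ℕ.<ᵇ⇒< _ _ (Bool.T-≡ .Equivalence.from lt))
                  (ℕ.≤⇒≯ (subst₂ (λ a b → value w ≤ a + b) (sym (y≡ (src e))) (sym (y≡ (tgt e))) (feas e w g)))
        score-v : totalScore y′ p ≡ ℤ.+ v
        score-v = trans (sym (ℤ.+-identityʳ _))
          (trans (cong (λ l → totalScore y′ p ℤ.+ ℤ.+ l) (sym loss-0))
            (trans (totalScore-split y′ p) (cong ℤ.+_ gain-v)))

-- Probabilities over fair coins

½*-mono : ∀ {a b c d} → a ℚ.≤ c → b ℚ.≤ d → ½ ℚ.* (a ℚ.+ b) ℚ.≤ ½ ℚ.* (c ℚ.+ d)
½*-mono p q = ℚ.*-monoˡ-≤-nonNeg ½ (ℚ.+-mono-≤ p q)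

½*-double : ∀ q → ½ ℚ.* (q ℚ.+ q) ≡ q
½*-double q = trans (ℚ.*-distribˡ-+ ½ q q) (trans (sym (ℚ.*-distribʳ-+ q ½ ½)) (ℚ.*-identityˡ q))

ℚ-interchange : ∀ a b c d → (a ℚ.+ b) ℚ.+ (c ℚ.+ d) ≡ (a ℚ.+ c) ℚ.+ (b ℚ.+ d)
ℚ-interchange a b c d = begin
  (a ℚ.+ b) ℚ.+ (c ℚ.+ d)   ≡⟨ ℚ.+-assoc a b _ ⟩
  a ℚ.+ (b ℚ.+ (c ℚ.+ d))   ≡⟨ cong (a ℚ.+_) (sym (ℚ.+-assoc b c d)) ⟩
  a ℚ.+ ((b ℚ.+ c) ℚ.+ d)   ≡⟨ cong (λ z → a ℚ.+ (z ℚ.+ d)) (ℚ.+-comm b c) ⟩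
  a ℚ.+ ((c ℚ.+ b) ℚ.+ d)   ≡⟨ cong (a ℚ.+_) (ℚ.+-assoc c b d) ⟩
  a ℚ.+ (c ℚ.+ (b ℚ.+ d))   ≡⟨ sym (ℚ.+-assoc a c _) ⟩
  (a ℚ.+ c) ℚ.+ (b ℚ.+ d)   ∎
  where open ≡-Reasoning

½*-+ : ∀ a b c d → ½ ℚ.* ((a ℚ.+ b) ℚ.+ (c ℚ.+ d)) ≡ ½ ℚ.* (a ℚ.+ c) ℚ.+ ½ ℚ.* (b ℚ.+ d)
½*-+ a b c d = trans (cong (½ ℚ.*_) (ℚ-interchange a b c d)) (ℚ.*-distribˡ-+ ½ (a ℚ.+ c) (b ℚ.+ d))

0≤1ℚ : 0ℚ ℚ.≤ 1ℚ
0≤1ℚ = from-yes (0ℚ ℚ.≤? 1ℚ)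

module _ {A : Set} {P : A → Set} (P? : Decidable P) where

  Pr≤1 : ∀ t → Pr P? t ℚ.≤ 1ℚ
  Pr≤1 (return x) with does (P? x)
  ... | true  = ℚ.≤-refl
  ... | false = 0≤1ℚ
  Pr≤1 (toss l r) = ½*-mono (Pr≤1 l) (Pr≤1 r)

  Pr-all : (∀ x → P x) → ∀ t → 1ℚ ℚ.≤ Pr P? t
  Pr-all p (return x) with P? x
  ... | yes _ = ℚ.≤-refl
  ... | no ¬p = contradiction (p x) ¬p
  Pr-all p (toss l r) = ½*-mono (Pr-all p l) (Pr-all p r)

  Pr-none : (∀ x → ¬ P x) → ∀ t → Pr P? t ℚ.≤ 0ℚ
  Pr-none ¬p (return x) with P? x
  ... | yes p = contradiction p (¬p x)
  ... | no _  = ℚ.≤-refl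
  Pr-none ¬p (toss l r) = ½*-mono (Pr-none ¬p l) (Pr-none ¬p r)

  module _ {Q : A → Set} (Q? : Decidable Q) where

    -- Takes the place of complementation: an upper bound for one of two covering events becomes a
    -- lower bound for the other.
    Pr-cover : (∀ x → P x ⊎ Q x) → ∀ t → 1ℚ ℚ.≤ Pr P? t ℚ.+ Pr Q? t
    Pr-cover c (return x) with P? x | Q? x
    ... | yes _ | yes _ = from-yes (1ℚ ℚ.≤? 1ℚ ℚ.+ 1ℚ)
    ... | yes _ | no _  = ℚ.≤-refl
    ... | no _  | yes _ = ℚ.≤-refl
    ... | no ¬p | no ¬q = ⊥-elim ([ ¬p , ¬q ]′ (c x))
    Pr-cover c (toss l r) = ℚ.≤-trans (½*-mono (Pr-cover c l) (Pr-cover c r))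
      (ℚ.≤-reflexive (½*-+ (Pr P? l) (Pr Q? l) (Pr P? r) (Pr Q? r)))

    Pr-mono : (∀ x → P x → Q x) → ∀ t → Pr P? t ℚ.≤ Pr Q? t
    Pr-mono f (return x) with P? x | Q? x
    ... | yes _ | yes _ = ℚ.≤-refl
    ... | no _  | yes _ = 0≤1ℚ
    ... | no _  | no _  = ℚ.≤-refl
    ... | yes p | no ¬q = contradiction (f x p) ¬q
    Pr-mono f (toss l r) = ½*-mono (Pr-mono f l) (Pr-mono f r)

    Pr-union : ∀ {R : A → Set} (R? : Decidable R) → (∀ x → P x → Q x ⊎ R x) →
               ∀ t → Pr P? t ℚ.≤ Pr Q? t ℚ.+ Pr R? t
    Pr-union R? f (return x) with P? x | Q? x | R? x
    ... | no _  | no _  | no _  = ℚ.≤-refl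
    ... | no _  | yes _ | no _  = 0≤1ℚ
    ... | no _  | no _  | yes _ = 0≤1ℚ
    ... | no _  | yes _ | yes _ = from-yes (0ℚ ℚ.≤? 1ℚ ℚ.+ 1ℚ)
    ... | yes _ | yes _ | no _  = ℚ.≤-refl
    ... | yes _ | no _  | yes _ = ℚ.≤-refl
    ... | yes _ | yes _ | yes _ = from-yes (1ℚ ℚ.≤? 1ℚ ℚ.+ 1ℚ)
    ... | yes p | no ¬q | no ¬r = ⊥-elim ([ ¬q , ¬r ]′ (f x p))
    Pr-union R? f (toss l r) = ℚ.≤-trans (½*-mono (Pr-union R? f l) (Pr-union R? f r))
      (ℚ.≤-reflexive (½*-+ (Pr Q? l) (Pr R? l) (Pr Q? r) (Pr R? r)))

  -- A union bound over two stages: the first ends in `Q`, or else the second fails with probability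
  -- at most `δ`.
  Pr-bind : ∀ {B : Set} {Q : B → Set} (Q? : Decidable Q) (k : B → Rand A) {δ : ℚ} → 0ℚ ℚ.≤ δ →
            (∀ x → ¬ Q x → Pr P? (k x) ℚ.≤ δ) → ∀ t → Pr P? (t >>= k) ℚ.≤ Pr Q? t ℚ.+ δ
  Pr-bind Q? k {δ} 0≤δ le (return x) with Q? x
  ... | yes _ = ℚ.≤-trans (Pr≤1 (k x))
                  (ℚ.≤-trans (ℚ.≤-reflexive (sym (ℚ.+-identityʳ 1ℚ))) (ℚ.+-monoʳ-≤ 1ℚ 0≤δ))
  ... | no ¬q = ℚ.≤-trans (le x ¬q) (ℚ.≤-reflexive (sym (ℚ.+-identityˡ δ)))
  Pr-bind Q? k {δ} 0≤δ le (toss l r) =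
    ℚ.≤-trans (½*-mono (Pr-bind Q? k 0≤δ le l) (Pr-bind Q? k 0≤δ le r))
      (ℚ.≤-reflexive (trans (½*-+ (Pr Q? l) δ (Pr Q? r) δ) (cong (Pr Q? (toss l r) ℚ.+_) (½*-double δ))))

Pr-map : ∀ {A B : Set} {P : B → Set} (P? : Decidable P) (f : A → B) t →
         Pr P? (t >>= λ x → return (f x)) ≡ Pr (P? ∘ f) t
Pr-map P? f (return x) = refl
Pr-map P? f (toss l r) = cong₂ (λ a b → ½ ℚ.* (a ℚ.+ b)) (Pr-map P? f l) (Pr-map P? f r)

>>=-start : ∀ {A B C D : Set} (t : Rand A) (f : A → B) (k : B → Rand C) (k′ : C → Rand D) →
            (t >>= (λ x → return (f x)) >>= k >>= k′) ≡ (t >>= λ x → k (f x) >>= k′)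
>>=-start (return x) f k k′ = refl
>>=-start (toss l r) f k k′ = cong₂ toss (>>=-start l f k k′) (>>=-start r f k k′)

>>=-cong : ∀ {A B : Set} (t : Rand A) {k k′ : A → Rand B} → (∀ x → k x ≡ k′ x) → (t >>= k) ≡ (t >>= k′)
>>=-cong (return x) e = e x
>>=-cong (toss l r) e = cong₂ toss (>>=-cong l e) (>>=-cong r e)

uniform : ∀ m → Rand (Vec Bool m)
uniform zero    = return []
uniform (suc m) = toss (uniform m >>= λ v → return (false ∷ v)) (uniform m >>= λ v → return (true ∷ v))

½^ : ℕ → ℚ
½^ zero    = 1ℚ
½^ (suc m) = ½ ℚ.* ½^ m

-- Repeated addition collects the error terms of successive union bounds without casting ℕ into ℚ.
times : ℕ → ℚ → ℚ
times zero    q = 0ℚ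
times (suc k) q = q ℚ.+ times k q

½^-nonNeg : ∀ m → 0ℚ ℚ.≤ ½^ m
½^-nonNeg zero    = 0≤1ℚ
½^-nonNeg (suc m) = ℚ.*-monoˡ-≤-nonNeg ½ (½^-nonNeg m)

times-nonNeg : ∀ k {q} → 0ℚ ℚ.≤ q → 0ℚ ℚ.≤ times k q
times-nonNeg zero    p = ℚ.≤-refl
times-nonNeg (suc k) p = ℚ.+-mono-≤ p (times-nonNeg k p)

_≟ᵛ_ : ∀ {m} (u v : Vec Bool m) → Dec (u ≡ v)
_≟ᵛ_ = Vec.≡-dec Bool._≟_

Pr-uniform-≡ : ∀ {m} (v : Vec Bool m) → Pr (_≟ᵛ v) (uniform m) ℚ.≤ ½^ m
Pr-uniform-≡ [] = Pr≤1 (_≟ᵛ []) (return [])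
Pr-uniform-≡ {suc m} (b ∷ v) = ℚ.≤-trans (half b)
    (ℚ.*-monoˡ-≤-nonNeg ½ (Pr-uniform-≡ v))
  where
  hit : ∀ b → Pr (_≟ᵛ (b ∷ v)) (uniform m >>= λ u → return (b ∷ u)) ℚ.≤ Pr (_≟ᵛ v) (uniform m)
  hit b = ℚ.≤-trans (ℚ.≤-reflexive (Pr-map (_≟ᵛ (b ∷ v)) (b ∷_) (uniform m)))
    (Pr-mono ((_≟ᵛ (b ∷ v)) ∘ (b ∷_)) (_≟ᵛ v) (λ { u refl → refl }) (uniform m))
  miss : ∀ {b c} → c ≢ b → Pr (_≟ᵛ (b ∷ v)) (uniform m >>= λ u → return (c ∷ u)) ℚ.≤ 0ℚ
  miss {b} {c} ne = ℚ.≤-trans (ℚ.≤-reflexive (Pr-map (_≟ᵛ (b ∷ v)) (c ∷_) (uniform m)))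
    (Pr-none ((_≟ᵛ (b ∷ v)) ∘ (c ∷_)) (λ { u refl → ne refl }) (uniform m))
  half : ∀ b → Pr (_≟ᵛ (b ∷ v)) (uniform (suc m)) ℚ.≤ ½ ℚ.* Pr (_≟ᵛ v) (uniform m)
  half true  = ℚ.≤-trans (½*-mono (miss λ ()) (hit true))
    (ℚ.≤-reflexive (cong (½ ℚ.*_) (ℚ.+-identityˡ (Pr (_≟ᵛ v) (uniform m)))))
  half false = ℚ.≤-trans (½*-mono (hit false) (miss λ ()))
    (ℚ.≤-reflexive (cong (½ ℚ.*_) (ℚ.+-identityʳ (Pr (_≟ᵛ v) (uniform m)))))

anyBits? : ∀ m {P : Vec Bool m → Set} → Decidable P → Dec (∃ P)
anyBits? zero    P? = map′ ([] ,_) (λ { ([] , p) → p }) (P? [])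
anyBits? (suc m) P? = map′
  (λ { (inj₁ (v , p)) → false ∷ v , p ; (inj₂ (v , p)) → true ∷ v , p })
  (λ { (false ∷ v , p) → inj₁ (v , p) ; (true ∷ v , p) → inj₂ (v , p) })
  (anyBits? m (P? ∘ (false ∷_)) ⊎-dec anyBits? m (P? ∘ (true ∷_)))

-- Polynomials over ℤ and their roots among the challenges

num : List Bool → ℕ
num []      = 0
num (b ∷ l) = (if b then 1 else 0) + 2 * num l

num-injective : ∀ {m} (u v : Vec Bool m) → num (toList u) ≡ num (toList v) → u ≡ v
num-injective [] [] _ = refl
num-injective (false ∷ u) (false ∷ v) eq = cong (false ∷_) (num-injective u v (ℕ.*-cancelˡ-≡ _ _ 2 eq))
num-injective (true ∷ u) (true ∷ v) eq = cong (true ∷_) (num-injective u v (ℕ.*-cancelˡ-≡ _ _ 2 (ℕ.suc-injective eq)))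
num-injective (false ∷ u) (true ∷ v) eq = contradiction eq (ℕ.even≢odd (num (toList u)) (num (toList v)))
num-injective (true ∷ u) (false ∷ v) eq = contradiction (sym eq) (ℕ.even≢odd (num (toList v)) (num (toList u)))

ι : ∀ {m} → Vec Bool m → ℤ
ι v = ℤ.+ num (toList v)

-- A vector of coefficients, constant term first.
Poly : ℕ → Set
Poly = Vec ℤ

eval : ∀ {d} → Poly d → ℤ → ℤ
eval []      x = 0ℤ
eval (c ∷ p) x = c ℤ.+ x ℤ.* eval p x

-- Synthetic division by the linear factor with root `ρ`: by Horner's rule the coefficients of the
-- quotient are the values at `ρ` of the tails of `p`.
quotient : ∀ {d} → Poly (suc d) → ℤ → Poly d
quotient (c ∷ [])        ρ = []
quotient (c ∷ p@(_ ∷ _)) ρ = eval p ρ ∷ quotient p ρ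

quotient-eval : ∀ {d} (p : Poly (suc d)) ρ x →
                eval p x ≡ eval p ρ ℤ.+ (x ℤ.- ρ) ℤ.* eval (quotient p ρ) x
quotient-eval (c ∷ []) ρ x = lemma c ρ x
  where
  lemma : ∀ c ρ x → c ℤ.+ x ℤ.* 0ℤ ≡ (c ℤ.+ ρ ℤ.* 0ℤ) ℤ.+ (x ℤ.- ρ) ℤ.* 0ℤ
  lemma = ℤ-solve
quotient-eval (c ∷ p@(_ ∷ _)) ρ x =
  trans (cong (λ z → c ℤ.+ x ℤ.* z) (quotient-eval p ρ x)) (lemma c ρ x (eval p ρ) (eval (quotient p ρ) x))
  where
  lemma : ∀ c ρ x a q → c ℤ.+ x ℤ.* (a ℤ.+ (x ℤ.- ρ) ℤ.* q) ≡
                        (c ℤ.+ ρ ℤ.* a) ℤ.+ (x ℤ.- ρ) ℤ.* (a ℤ.+ x ℤ.* q)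
  lemma = ℤ-solve

-- Splitting off one root among the challenges shortens the polynomial by one coefficient, and ℤ has
-- no zero divisors. Being nonzero is witnessed by a value at some `x₀`, a condition that passes to
-- the quotient.
root-bound : ∀ {d} m (p : Poly d) x₀ → eval p x₀ ≢ 0ℤ →
             Pr (λ r → eval p (ι r) ℤ.≟ 0ℤ) (uniform m) ℚ.≤ times d (½^ m)
root-bound m [] x₀ ne = contradiction refl ne
root-bound {suc d} m p x₀ ne with anyBits? m (λ r → eval p (ι r) ℤ.≟ 0ℤ)
... | no none = ℚ.≤-trans (Pr-none (λ r → eval p (ι r) ℤ.≟ 0ℤ) (λ r eq → none (r , eq)) (uniform m))
                  (times-nonNeg (suc d) (½^-nonNeg m))
... | yes (v , root) = ℚ.≤-trans
    (Pr-union (λ r → eval p (ι r) ℤ.≟ 0ℤ) (_≟ᵛ v) (λ r → eval q (ι r) ℤ.≟ 0ℤ) split (uniform m))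
    (ℚ.+-mono-≤ (Pr-uniform-≡ v) (root-bound m q x₀ q≢0))
  where
  q = quotient p (ι v)
  factor : ∀ x → eval p x ≡ (x ℤ.- ι v) ℤ.* eval q x
  factor x = trans (quotient-eval p (ι v) x) (trans (cong (λ z → z ℤ.+ (x ℤ.- ι v) ℤ.* eval q x) root) (ℤ.+-identityˡ _))
  q≢0 : eval q x₀ ≢ 0ℤ
  q≢0 eq = ne (trans (factor x₀) (trans (cong ((x₀ ℤ.- ι v) ℤ.*_) eq) (ℤ.*-zeroʳ (x₀ ℤ.- ι v))))
  split : ∀ r → eval p (ι r) ≡ 0ℤ → r ≡ v ⊎ eval q (ι r) ≡ 0ℤ
  split r eq with ℤ.i*j≡0⇒i≡0∨j≡0 (ι r ℤ.- ι v) (trans (sym (factor (ι r))) eq)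
  ... | inj₁ z = inj₁ (num-injective r v (ℤ.+-injective (ℤ.i-j≡0⇒i≡j (ι r) (ι v) z)))
  ... | inj₂ z = inj₂ z

-- Sumcheck

Table : Set
Table = List Bool → ℤ

∑ᵇ : ℕ → Table → ℤ
∑ᵇ zero    f = f []
∑ᵇ (suc k) f = ∑ᵇ k (λ x → f (false ∷ x)) ℤ.+ ∑ᵇ k (λ x → f (true ∷ x))

restrict : ℤ → Table → Table
restrict r f x = f (false ∷ x) ℤ.+ r ℤ.* (f (true ∷ x) ℤ.- f (false ∷ x))

-- The value at (r₁ , … , r_k) of the multilinear polynomial that agrees with
-- f on {0,1}^k.
mle : Table → List ℤ → ℤ
mle f []       = f []
mle f (r ∷ rs) = mle (restrict r f) rs

∏ : ∀ {J} → Vec Table J → Table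
∏ []       x = 1ℤ
∏ (f ∷ fs) x = f x ℤ.* ∏ fs x

-- The product of the extensions, not the extension of the product: in each variable it has degree
-- up to `J`.
∏-mle : ∀ {J} → Vec Table J → List ℤ → ℤ
∏-mle fs []       = ∏ fs []
∏-mle fs (r ∷ rs) = ∏-mle (Vec.map (restrict r) fs) rs

∑ᵇ-cong : ∀ k {f g : Table} → (∀ x → f x ≡ g x) → ∑ᵇ k f ≡ ∑ᵇ k g
∑ᵇ-cong zero    e = e []
∑ᵇ-cong (suc k) e = cong₂ ℤ._+_ (∑ᵇ-cong k (e ∘ (false ∷_))) (∑ᵇ-cong k (e ∘ (true ∷_)))

-- Schoolbook multiplication by a linear polynomial: `carry` is what the previous coefficient
-- contributes to the current one.
linMul : ∀ {d} → ℤ → ℤ → ℤ → Poly d → Poly (suc d)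
linMul α β carry []      = carry ∷ []
linMul α β carry (c ∷ p) = carry ℤ.+ α ℤ.* c ∷ linMul α β (β ℤ.* c) p

linMul-eval : ∀ {d} α β carry (p : Poly d) x →
              eval (linMul α β carry p) x ≡ carry ℤ.+ (α ℤ.+ x ℤ.* β) ℤ.* eval p x
linMul-eval α β carry [] x = lemma α β carry x
  where
  lemma : ∀ α β carry x → carry ℤ.+ x ℤ.* 0ℤ ≡ carry ℤ.+ (α ℤ.+ x ℤ.* β) ℤ.* 0ℤ
  lemma = ℤ-solve
linMul-eval α β carry (c ∷ p) x =
  trans (cong (λ z → (carry ℤ.+ α ℤ.* c) ℤ.+ x ℤ.* z) (linMul-eval α β (β ℤ.* c) p x))
        (lemma α β carry c x (eval p x))
  where
  lemma : ∀ α β carry c x e → (carry ℤ.+ α ℤ.* c) ℤ.+ x ℤ.* (β ℤ.* c ℤ.+ (α ℤ.+ x ℤ.* β) ℤ.* e) ≡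
                              carry ℤ.+ (α ℤ.+ x ℤ.* β) ℤ.* (c ℤ.+ x ℤ.* e)
  lemma = ℤ-solve

_+ᵖ_ : ∀ {d} → Poly d → Poly d → Poly d
_+ᵖ_ = Vec.zipWith ℤ._+_

+ᵖ-eval : ∀ {d} (p q : Poly d) x → eval (p +ᵖ q) x ≡ eval p x ℤ.+ eval q x
+ᵖ-eval []      []      x = refl
+ᵖ-eval (c ∷ p) (e ∷ q) x = trans (cong (λ z → (c ℤ.+ e) ℤ.+ x ℤ.* z) (+ᵖ-eval p q x))
  (lemma c e x (eval p x) (eval q x))
  where
  lemma : ∀ c e x a b → (c ℤ.+ e) ℤ.+ x ℤ.* (a ℤ.+ b) ≡ (c ℤ.+ x ℤ.* a) ℤ.+ (e ℤ.+ x ℤ.* b)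
  lemma = ℤ-solve

_-ᵖ_ : ∀ {d} → Poly d → Poly d → Poly d
_-ᵖ_ = Vec.zipWith ℤ._-_

-ᵖ-eval : ∀ {d} (p q : Poly d) x → eval (p -ᵖ q) x ≡ eval p x ℤ.- eval q x
-ᵖ-eval []      []      x = refl
-ᵖ-eval (c ∷ p) (e ∷ q) x = trans (cong (λ z → (c ℤ.- e) ℤ.+ x ℤ.* z) (-ᵖ-eval p q x))
  (lemma c e x (eval p x) (eval q x))
  where
  lemma : ∀ c e x a b → (c ℤ.- e) ℤ.+ x ℤ.* (a ℤ.- b) ≡ (c ℤ.+ x ℤ.* a) ℤ.- (e ℤ.+ x ℤ.* b)
  lemma = ℤ-solve

-- The restriction of ∏ fs to the line of points (X , x).
linePoly : ∀ {J} → Vec Table J → List Bool → Poly (suc J)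
linePoly []       x = 1ℤ ∷ []
linePoly (f ∷ fs) x = linMul (f (false ∷ x)) (f (true ∷ x) ℤ.- f (false ∷ x)) 0ℤ (linePoly fs x)

linePoly-eval : ∀ {J} (fs : Vec Table J) x r → eval (linePoly fs x) r ≡ ∏ (Vec.map (restrict r) fs) x
linePoly-eval []       x r = cong (λ z → 1ℤ ℤ.+ z) (ℤ.*-zeroʳ r)
linePoly-eval (f ∷ fs) x r =
  trans (linMul-eval (f (false ∷ x)) _ 0ℤ (linePoly fs x) r)
    (trans (ℤ.+-identityˡ _) (cong (restrict r f x ℤ.*_) (linePoly-eval fs x r)))

∑ᵖ : ∀ (k : ℕ) {d} → (List Bool → Poly d) → Poly d
∑ᵖ zero    p = p []
∑ᵖ (suc k) p = ∑ᵖ k (λ x → p (false ∷ x)) +ᵖ ∑ᵖ k (λ x → p (true ∷ x))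

∑ᵖ-eval : ∀ k {d} (p : List Bool → Poly d) r → eval (∑ᵖ k p) r ≡ ∑ᵇ k (λ x → eval (p x) r)
∑ᵖ-eval zero    p r = refl
∑ᵖ-eval (suc k) p r = trans (+ᵖ-eval (∑ᵖ k (p ∘ (false ∷_))) _ r)
  (cong₂ ℤ._+_ (∑ᵖ-eval k (p ∘ (false ∷_)) r) (∑ᵖ-eval k (p ∘ (true ∷_)) r))

-- The honest message of a round. Its degree is at most the number of tables, as each factor is
-- linear in the variable.
roundPoly : ∀ (k : ℕ) {J} → Vec Table J → Poly (suc J)
roundPoly k fs = ∑ᵖ k (linePoly fs)

roundPoly-eval : ∀ k {J} (fs : Vec Table J) r →
                 eval (roundPoly k fs) r ≡ ∑ᵇ k (∏ (Vec.map (restrict r) fs))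
roundPoly-eval k fs r = trans (∑ᵖ-eval k (linePoly fs) r) (∑ᵇ-cong k (λ x → linePoly-eval fs x r))

∏-restrict-0 : ∀ {J} (fs : Vec Table J) x → ∏ (Vec.map (restrict 0ℤ) fs) x ≡ ∏ fs (false ∷ x)
∏-restrict-0 []       x = refl
∏-restrict-0 (f ∷ fs) x = cong₂ ℤ._*_ (ℤ.+-identityʳ (f (false ∷ x))) (∏-restrict-0 fs x)

∏-restrict-1 : ∀ {J} (fs : Vec Table J) x → ∏ (Vec.map (restrict 1ℤ) fs) x ≡ ∏ fs (true ∷ x)
∏-restrict-1 []       x = refl
∏-restrict-1 (f ∷ fs) x = cong₂ ℤ._*_ (lemma (f (false ∷ x)) (f (true ∷ x))) (∏-restrict-1 fs x)
  where
  lemma : ∀ a b → a ℤ.+ 1ℤ ℤ.* (b ℤ.- a) ≡ b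
  lemma = ℤ-solve

endpoints : ∀ {d} → Poly d → ℤ
endpoints g = eval g 0ℤ ℤ.+ eval g 1ℤ

roundPoly-endpoints : ∀ k {J} (fs : Vec Table J) → endpoints (roundPoly k fs) ≡ ∑ᵇ (suc k) (∏ fs)
roundPoly-endpoints k fs = cong₂ ℤ._+_
  (trans (roundPoly-eval k fs 0ℤ) (∑ᵇ-cong k (∏-restrict-0 fs)))
  (trans (roundPoly-eval k fs 1ℤ) (∑ᵇ-cong k (∏-restrict-1 fs)))

draws : ∀ m k → Rand (Vec (Vec Bool m) k)
draws m zero    = return []
draws m (suc k) = uniform m >>= λ r → draws m k >>= λ rs → return (r ∷ rs)

-- The tree shape records that a message may depend on the earlier challenges only, although all
-- challenges are drawn at the outset.
data Adversary (m d : ℕ) : ℕ → Set where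
  stop : Adversary m d 0
  move : ∀ {k} → Poly d → (Vec Bool m → Adversary m d k) → Adversary m d (suc k)

-- The claim left after the last round, and whether all checks succeeded.
play : ∀ {m d k} → Adversary m d k → ℤ × Bool → Vec (Vec Bool m) k → ℤ × Bool
play stop       s        []       = s
play (move g a) (c , ok) (r ∷ rs) = play (a r) (eval g (ι r) , ok ∧ does (endpoints g ℤ.≟ c)) rs

ιs : ∀ {m k} → Vec (Vec Bool m) k → List ℤ
ιs rs = map ι (toList rs)

Fooled : ∀ {m d k J} → Adversary m d k → Vec Table J → ℤ × Bool → Vec (Vec Bool m) k → Set
Fooled a fs s rs = play a s rs ≡ (∏-mle fs (ιs rs) , true)

fooled? : ∀ {m d k J} (a : Adversary m d k) (fs : Vec Table J) s → Decidable (Fooled a fs s)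
fooled? a fs s rs = Product.≡-dec ℤ._≟_ Bool._≟_ (play a s rs) _

play-false : ∀ {m d k} (a : Adversary m d k) c rs → proj₂ (play a (c , false) rs) ≡ false
play-false stop       c []       = refl
play-false (move g a) c (r ∷ rs) = play-false (a r) (eval g (ι r)) rs

-- A false claim either fails the endpoint check or is backed by a polynomial other than the honest
-- one. The two then differ at the challenge, so that the next claim is false again, unless the
-- challenge is among the few roots of the difference.
sumcheck-sound : ∀ {m k J} (a : Adversary m (suc J) k) (fs : Vec Table J) c ok → c ≢ ∑ᵇ k (∏ fs) →
                 Pr (fooled? a fs (c , ok)) (draws m k) ℚ.≤ times k (times (suc J) (½^ m))
sumcheck-sound {m} {J = J} stop fs c ok ne =
  Pr-none (fooled? {m} {suc J} stop fs (c , ok)) (λ { [] eq → ne (cong proj₁ eq) }) (return [])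
sumcheck-sound {m} {suc k} {J} (move g a) fs c ok ne with endpoints g ℤ.≟ c
... | no  wrong = ℚ.≤-trans
    (Pr-none (fooled? (move g a) fs (c , ok)) caught (draws m (suc k)))
    (times-nonNeg (suc k) (times-nonNeg (suc J) (½^-nonNeg m)))
  where
  caught : ∀ rs → ¬ Fooled (move g a) fs (c , ok) rs
  caught (r ∷ rs) eq with endpoints g ℤ.≟ c
  ... | yes right = wrong right
  ... | no _ rewrite Bool.∧-zeroʳ ok =
    contradiction (trans (sym (cong proj₂ eq)) (play-false (a r) (eval g (ι r)) rs)) λ ()
... | yes right = ℚ.≤-trans
    (Pr-bind (fooled? (move g a) fs (c , ok)) (λ r → eval p (ι r) ℤ.≟ 0ℤ) _
      (times-nonNeg k (times-nonNeg (suc J) (½^-nonNeg m))) descend (uniform m))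
    (ℚ.+-monoˡ-≤ _ nonzero)
  where
  h = roundPoly k fs
  p = g -ᵖ h
  agree : ∀ {x} → eval p x ≡ 0ℤ → eval g x ≡ eval h x
  agree {x} eq = ℤ.i-j≡0⇒i≡j (eval g x) (eval h x) (trans (sym (-ᵖ-eval g h x)) eq)
  -- Agreement with the honest polynomial at both 0 and 1 would make the claim true, so one of these
  -- two points is a witness for `root-bound`.
  nonzero : Pr (λ r → eval p (ι r) ℤ.≟ 0ℤ) (uniform m) ℚ.≤ times (suc J) (½^ m)
  nonzero with eval p 0ℤ ℤ.≟ 0ℤ | eval p 1ℤ ℤ.≟ 0ℤ
  ... | no p₀ | _     = root-bound m p 0ℤ p₀
  ... | _     | no p₁ = root-bound m p 1ℤ p₁
  ... | yes p₀ | yes p₁ = contradiction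
    (trans (sym right) (trans (cong₂ ℤ._+_ (agree p₀) (agree p₁)) (roundPoly-endpoints k fs))) ne
  descend : ∀ r → eval p (ι r) ≢ 0ℤ →
    Pr (fooled? (move g a) fs (c , ok)) (draws m k >>= λ rs → return (r ∷ rs))
      ℚ.≤ times k (times (suc J) (½^ m))
  descend r p≢0 = ℚ.≤-trans
    (ℚ.≤-reflexive (Pr-map (fooled? (move g a) fs (c , ok)) (r ∷_) (draws m k)))
    (ℚ.≤-trans
      (Pr-mono (fooled? (move g a) fs (c , ok) ∘ (r ∷_))
        (fooled? (a r) (Vec.map (restrict (ι r)) fs) _) (λ _ → id) (draws m k))
      (sumcheck-sound (a r) (Vec.map (restrict (ι r)) fs) (eval g (ι r)) _ differ))
    where
    differ : eval g (ι r) ≢ ∑ᵇ k (∏ (Vec.map (restrict (ι r)) fs))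
    differ eq = p≢0 (trans (-ᵖ-eval g h (ι r))
      (ℤ.i≡j⇒i-j≡0 (trans eq (sym (roundPoly-eval k fs (ι r))))))

-- Binary expansions and sums over the cube

bits : ℕ → ℕ → List Bool
bits zero    k = []
bits (suc ℓ) k = (k % 2 ≡ᵇ 1) ∷ bits ℓ (k / 2)

length-bits : ∀ ℓ k → length (bits ℓ k) ≡ ℓ
length-bits zero    k = refl
length-bits (suc ℓ) k = cong suc (length-bits ℓ (k / 2))

num-bits : ∀ ℓ {k} → k < 2 ^ ℓ → num (bits ℓ k) ≡ k
num-bits zero    {zero} _ = refl
num-bits zero    {suc k} (s≤s ())
num-bits (suc ℓ) {k} k< = begin
  (if k % 2 ≡ᵇ 1 then 1 else 0) + 2 * num (bits ℓ (k / 2))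
    ≡⟨ cong₂ _+_ (bit (k % 2) (ℕ.m%n<n k 2)) (cong (2 *_) (num-bits ℓ half<)) ⟩
  k % 2 + 2 * (k / 2)  ≡⟨ cong (k % 2 +_) (ℕ.*-comm 2 (k / 2)) ⟩
  k % 2 + k / 2 * 2    ≡⟨ sym (ℕ.m≡m%n+[m/n]*n k 2) ⟩
  k                    ∎
  where
  open ≡-Reasoning
  bit : ∀ r → r < 2 → (if r ≡ᵇ 1 then 1 else 0) ≡ r
  bit 0 _ = refl
  bit 1 _ = refl
  bit (suc (suc _)) (s≤s (s≤s ()))
  half< : k / 2 < 2 ^ ℓ
  half< = ℕ.m<n*o⇒m/o<n (subst (k <_) (ℕ.*-comm 2 (2 ^ ℓ)) k<)

bits-injective : ∀ ℓ {j k} → j < 2 ^ ℓ → k < 2 ^ ℓ → bits ℓ j ≡ bits ℓ k → j ≡ k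
bits-injective ℓ j< k< eq = trans (sym (num-bits ℓ j<)) (trans (cong num eq) (num-bits ℓ k<))

num-< : ∀ l → num l < 2 ^ length l
num-< []      = s≤s z≤n
num-< (b ∷ l) = begin-strict
  (if b then 1 else 0) + 2 * num l  ≤⟨ ℕ.+-monoˡ-≤ _ (bit b) ⟩
  1 + 2 * num l                     <⟨ ℕ.n<1+n _ ⟩
  2 + 2 * num l                     ≡⟨ sym (ℕ.*-suc 2 (num l)) ⟩
  2 * suc (num l)                   ≤⟨ ℕ.*-monoʳ-≤ 2 (num-< l) ⟩
  2 * 2 ^ length l                  ∎
  where
  open ℕ.≤-Reasoning
  bit : ∀ b → (if b then 1 else 0) ≤ 1
  bit true  = ℕ.≤-refl
  bit false = z≤n

num-take-< : ∀ k l → num (take k l) < 2 ^ k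
num-take-< k l = ℕ.<-≤-trans (num-< (take k l)) (ℕ.^-monoʳ-≤ 2
  (ℕ.≤-trans (ℕ.≤-reflexive (List.length-take k l)) (ℕ.m⊓n≤m k (length l))))

∑ᵇ-zero : ∀ k {f : Table} → (∀ x → f x ≡ 0ℤ) → ∑ᵇ k f ≡ 0ℤ
∑ᵇ-zero zero    z = z []
∑ᵇ-zero (suc k) z = cong₂ ℤ._+_ (∑ᵇ-zero k (z ∘ (false ∷_))) (∑ᵇ-zero k (z ∘ (true ∷_)))

∑ᵇ-+ : ∀ k (f g : Table) → ∑ᵇ k (λ x → f x ℤ.+ g x) ≡ ∑ᵇ k f ℤ.+ ∑ᵇ k g
∑ᵇ-+ zero    f g = refl
∑ᵇ-+ (suc k) f g = trans (cong₂ ℤ._+_ (∑ᵇ-+ k _ _) (∑ᵇ-+ k _ _)) (lemma (∑ᵇ k _) _ _ _)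
  where
  lemma : ∀ a b c d → (a ℤ.+ b) ℤ.+ (c ℤ.+ d) ≡ (a ℤ.+ c) ℤ.+ (b ℤ.+ d)
  lemma = ℤ-solve

∑ᵇ-*ˡ : ∀ k c (f : Table) → ∑ᵇ k (λ x → c ℤ.* f x) ≡ c ℤ.* ∑ᵇ k f
∑ᵇ-*ˡ zero    c f = refl
∑ᵇ-*ˡ (suc k) c f = trans (cong₂ ℤ._+_ (∑ᵇ-*ˡ k c _) (∑ᵇ-*ˡ k c _)) (sym (ℤ.*-distribˡ-+ c _ _))

∑ᵇ-single : ∀ y {f : Table} → (∀ x → x ≢ y → f x ≡ 0ℤ) → ∑ᵇ (length y) f ≡ f y
∑ᵇ-single []          off = refl
∑ᵇ-single (false ∷ y) {f} off = trans
  (cong₂ ℤ._+_ (∑ᵇ-single y (λ x ne → off (false ∷ x) (ne ∘ List.∷-injectiveʳ)))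
               (∑ᵇ-zero (length y) (λ x → off (true ∷ x) λ ())))
  (ℤ.+-identityʳ _)
∑ᵇ-single (true ∷ y) {f} off = trans
  (cong₂ ℤ._+_ (∑ᵇ-zero (length y) (λ x → off (false ∷ x) λ ()))
               (∑ᵇ-single y (λ x ne → off (true ∷ x) (ne ∘ List.∷-injectiveʳ))))
  (ℤ.+-identityˡ _)

∑ᵇ-single′ : ∀ {k} y {f : Table} → length y ≡ k → (∀ x → x ≢ y → f x ≡ 0ℤ) → ∑ᵇ k f ≡ f y
∑ᵇ-single′ y refl = ∑ᵇ-single y

∑ᵇ-split : ∀ j k (H : List Bool → List Bool → ℤ) →
           ∑ᵇ (j + k) (λ x → H (take j x) (drop j x)) ≡ ∑ᵇ j (λ x → ∑ᵇ k (H x))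
∑ᵇ-split zero    k H = refl
∑ᵇ-split (suc j) k H = cong₂ ℤ._+_ (∑ᵇ-split j k (H ∘ (false ∷_))) (∑ᵇ-split j k (H ∘ (true ∷_)))

-- Multilinear extensions

mle-cong : ∀ {f g : Table} rs → (∀ x → f x ≡ g x) → mle f rs ≡ mle g rs
mle-cong []       e = e []
mle-cong (r ∷ rs) e = mle-cong rs λ x →
  cong₂ (λ a b → a ℤ.+ r ℤ.* (b ℤ.- a)) (e (false ∷ x)) (e (true ∷ x))

mle-zero : ∀ rs → mle (λ _ → 0ℤ) rs ≡ 0ℤ
mle-zero []       = refl
mle-zero (r ∷ rs) = trans (mle-cong rs λ _ → trans (ℤ.+-identityˡ _) (ℤ.*-zeroʳ r)) (mle-zero rs)

mle-+ : ∀ (f g : Table) rs → mle (λ x → f x ℤ.+ g x) rs ≡ mle f rs ℤ.+ mle g rs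
mle-+ f g []       = refl
mle-+ f g (r ∷ rs) = trans
  (mle-cong rs λ x → lemma (f (false ∷ x)) (g (false ∷ x)) (f (true ∷ x)) (g (true ∷ x)) r)
  (mle-+ (restrict r f) (restrict r g) rs)
  where
  lemma : ∀ a b c d r → (a ℤ.+ b) ℤ.+ r ℤ.* ((c ℤ.+ d) ℤ.- (a ℤ.+ b)) ≡
                        (a ℤ.+ r ℤ.* (c ℤ.- a)) ℤ.+ (b ℤ.+ r ℤ.* (d ℤ.- b))
  lemma = ℤ-solve

mle-*ˡ : ∀ c (f : Table) rs → mle (λ x → c ℤ.* f x) rs ≡ c ℤ.* mle f rs
mle-*ˡ c f []       = refl
mle-*ˡ c f (r ∷ rs) = trans
  (mle-cong rs λ x → lemma c (f (false ∷ x)) (f (true ∷ x)) r)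
  (mle-*ˡ c (restrict r f) rs)
  where
  lemma : ∀ c a b r → c ℤ.* a ℤ.+ r ℤ.* (c ℤ.* b ℤ.- c ℤ.* a) ≡ c ℤ.* (a ℤ.+ r ℤ.* (b ℤ.- a))
  lemma = ℤ-solve

-- Linearity in the table is what makes streaming possible: each token or answer adds the extension
-- of its own indicator at the secret point.
mle-∑ : ∀ {A : Set} (xs : List A) (F : A → Table) rs →
        mle (λ x → ℤSum.∑ xs (λ a → F a x)) rs ≡ ℤSum.∑ xs (λ a → mle (F a) rs)
mle-∑ []       F rs = mle-zero rs
mle-∑ (a ∷ xs) F rs = trans (mle-+ (F a) _ rs) (cong (λ z → mle (F a) rs ℤ.+ z) (mle-∑ xs F rs))

∏-mle-4 : ∀ f g h k rs → ∏-mle (f ∷ g ∷ h ∷ k ∷ []) rs ≡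
          mle f rs ℤ.* (mle g rs ℤ.* (mle h rs ℤ.* (mle k rs ℤ.* 1ℤ)))
∏-mle-4 f g h k []       = refl
∏-mle-4 f g h k (r ∷ rs) = ∏-mle-4 (restrict r f) (restrict r g) (restrict r h) (restrict r k) rs

_==_ : List Bool → List Bool → Bool
l == l′ = does (List.≡-dec Bool._≟_ l l′)

==-refl : ∀ l → (l == l) ≡ true
==-refl l = dec-true (List.≡-dec Bool._≟_ l l) refl

==-≢ : ∀ {l l′} → l ≢ l′ → (l == l′) ≡ false
==-≢ {l} {l′} ne = dec-false (List.≡-dec Bool._≟_ l l′) ne

==-true : ∀ {l l′} → (l == l′) ≡ true → l ≡ l′
==-true {l} {l′} eq with List.≡-dec Bool._≟_ l l′ | eq
... | yes e | _ = e

⟦_⟧ : Bool → ℤ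
⟦ b ⟧ = if b then 1ℤ else 0ℤ

-- The tables of the protocol.  A point of the cube lists the bits of two
-- endpoints u and v, of a weight w, and of the answers a and b that the
-- prover might have given for u and v; an answer is a dual value followed by
-- the name of the partner.

module Tables (n W ℓ ω ψ : ℕ) where

  A K : ℕ
  A = ψ + ℓ
  K = ℓ + (ℓ + (ω + (A + A)))

  Local : Set
  Local = (u v w a b : List Bool) → ℤ

  flat : Local → Table
  flat H x = H (take ℓ x) (take ℓ (drop ℓ x)) (take ω (drop ℓ (drop ℓ x)))
               (take A (drop ω (drop ℓ (drop ℓ x)))) (drop A (drop ω (drop ℓ (drop ℓ x))))

  ∑⁵ : Local → ℤ
  ∑⁵ H = ∑ᵇ ℓ λ u → ∑ᵇ ℓ λ v → ∑ᵇ ω λ w → ∑ᵇ A λ a → ∑ᵇ A λ b → H u v w a b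

  ∑ᵇ-flat : ∀ H → ∑ᵇ K (flat H) ≡ ∑⁵ H
  ∑ᵇ-flat H =
    trans (∑ᵇ-split ℓ (ℓ + (ω + (A + A)))
      λ u x → H u (take ℓ x) (take ω (drop ℓ x)) (take A (drop ω (drop ℓ x))) (drop A (drop ω (drop ℓ x)))) (
    ∑ᵇ-cong ℓ λ u → trans (∑ᵇ-split ℓ (ω + (A + A))
      λ v x → H u v (take ω x) (take A (drop ω x)) (drop A (drop ω x))) (
    ∑ᵇ-cong ℓ λ v → trans (∑ᵇ-split ω (A + A) λ w x → H u v w (take A x) (drop A x)) (
    ∑ᵇ-cong ω λ w → ∑ᵇ-split A A (H u v w))))

  -- The coordinates are pinned one after another because the answer `a` is determined only once `u`
  -- is, and `b` only once `v` is; each hypothesis takes the earlier coordinates as already fixed.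
  ∑⁵-single : ∀ {H : Local} ũ ṽ w̃ ã b̃ → length ũ ≡ ℓ → length ṽ ≡ ℓ → length w̃ ≡ ω →
              length ã ≡ A → length b̃ ≡ A →
              (∀ u v w a b → u ≢ ũ → H u v w a b ≡ 0ℤ) →
              (∀ v w a b → v ≢ ṽ → H ũ v w a b ≡ 0ℤ) →
              (∀ w a b → w ≢ w̃ → H ũ ṽ w a b ≡ 0ℤ) →
              (∀ a b → a ≢ ã → H ũ ṽ w̃ a b ≡ 0ℤ) →
              (∀ b → b ≢ b̃ → H ũ ṽ w̃ ã b ≡ 0ℤ) →
              ∑⁵ H ≡ H ũ ṽ w̃ ã b̃
  ∑⁵-single ũ ṽ w̃ ã b̃ lu lv lw la lb zu zv zw za zb =
    trans (∑ᵇ-single′ ũ lu λ u ne → ∑ᵇ-zero ℓ λ v → ∑ᵇ-zero ω λ w → ∑ᵇ-zero A λ a → ∑ᵇ-zero A λ b → zu u v w a b ne) (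
    trans (∑ᵇ-single′ ṽ lv λ v ne → ∑ᵇ-zero ω λ w → ∑ᵇ-zero A λ a → ∑ᵇ-zero A λ b → zv v w a b ne) (
    trans (∑ᵇ-single′ w̃ lw λ w ne → ∑ᵇ-zero A λ a → ∑ᵇ-zero A λ b → zw w a b ne) (
    trans (∑ᵇ-single′ ã la λ a ne → ∑ᵇ-zero A λ b → za a b ne)
          (∑ᵇ-single′ b̃ lb zb))))

  dual : List Bool → ℕ
  dual a = num (take ψ a)

  mate : List Bool → List Bool
  mate a = drop ψ a

  edgeLocal : Edge n → Fin W → Local
  edgeLocal e w u v w′ a b =
    ⟦ u == bits ℓ (toℕ (src e)) ⟧ ℤ.* (⟦ v == bits ℓ (toℕ (tgt e)) ⟧ ℤ.* ⟦ w′ == bits ω (toℕ w) ⟧)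

  srcLocal tgtLocal : ℕ → List Bool → Local
  srcLocal i ans u v w a b = ⟦ u == bits ℓ i ⟧ ℤ.* ⟦ a == ans ⟧
  tgtLocal i ans u v w a b = ⟦ v == bits ℓ i ⟧ ℤ.* ⟦ b == ans ⟧

  -- The successor of `num w` is the weight itself, since weights are stored as indices counted from
  -- 0. The table depends neither on the stream nor on the prover, so no register is kept for it.
  scoreLocal : Local
  scoreLocal u v w a b =
    ℤ.+ (if (mate a == v) ∧ (mate b == u) then suc (num w) else 0) ℤ.-
    ℤ.+ (if dual a + dual b <ᵇ suc (num w) then suc (n * W) else 0)

  scoreTable : Table
  scoreTable = flat scoreLocal

  streamTable : Stream n W → Table
  streamTable τ x = ℤSum.∑ τ λ (update e w Δ) → (Δ ◃ 1) ℤ.* flat (edgeLocal e w) x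

  srcTable tgtTable : (Fin n → List Bool) → Table
  srcTable ans x = ℤSum.∑ (allFin n) λ i → flat (srcLocal (toℕ i) (ans i)) x
  tgtTable ans x = ℤSum.∑ (allFin n) λ i → flat (tgtLocal (toℕ i) (ans i)) x

  tables : Stream n W → (Fin n → List Bool) → Vec Table 4
  tables τ ans = streamTable τ ∷ srcTable ans ∷ tgtTable ans ∷ scoreTable ∷ []

  module _ (n≤ : n ≤ 2 ^ ℓ) (W≤ : W ≤ 2 ^ ω) (ans : Fin n → List Bool)
           (length-ans : ∀ i → length (ans i) ≡ A) where

    dualOf : Fin n → ℕ
    dualOf i = dual (ans i)

    names : Fin n → Fin n → Bool
    names i j = mate (ans i) == bits ℓ (toℕ j)

    vertex-injective : ∀ {i j : Fin n} → bits ℓ (toℕ i) ≡ bits ℓ (toℕ j) → i ≡ j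
    vertex-injective {i} {j} eq = Fin.toℕ-injective
      (bits-injective ℓ (ℕ.<-≤-trans (Fin.toℕ<n i) n≤) (ℕ.<-≤-trans (Fin.toℕ<n j) n≤) eq)

    names-functional : ∀ {i j j′} → names i j ≡ true → names i j′ ≡ true → j ≡ j′
    names-functional {i} q q′ = vertex-injective (trans (sym (==-true {mate (ans i)} q)) (==-true {mate (ans i)} q′))

    -- Distinct vertices have distinct bit strings because `n ≤ 2 ^ ℓ`, so only the summand of `i`
    -- survives.
    select : ∀ i a → ℤSum.∑ (allFin n) (λ j → ⟦ bits ℓ (toℕ i) == bits ℓ (toℕ j) ⟧ ℤ.* ⟦ a == ans j ⟧)
                   ≡ ⟦ a == ans i ⟧
    select i a = trans (ℤSum.∑-single (allFin⁺ n) (∈-allFin i) off)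
      (trans (cong (λ b → ⟦ b ⟧ ℤ.* ⟦ a == ans i ⟧) (==-refl (bits ℓ (toℕ i)))) (ℤ.*-identityˡ _))
      where
      off : ∀ j → j ≢ i → ⟦ bits ℓ (toℕ i) == bits ℓ (toℕ j) ⟧ ℤ.* ⟦ a == ans j ⟧ ≡ 0ℤ
      off j ne = cong (λ b → ⟦ b ⟧ ℤ.* ⟦ a == ans j ⟧) (==-≢ (ne ∘ sym ∘ vertex-injective))

    module _ (G : Graph n W) where
      open Certificate G using (score)

      edge-sum : ∀ e w →
        ∑ᵇ K (λ x → flat (edgeLocal e w) x ℤ.*
                      (srcTable ans x ℤ.* (tgtTable ans x ℤ.* (scoreTable x ℤ.* 1ℤ))))
          ≡ score dualOf names e w
      edge-sum e w = trans (∑ᵇ-flat F) (trans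
        (∑⁵-single {F} ũ ṽ w̃ ã b̃ (length-bits ℓ _) (length-bits ℓ _) (length-bits ω _)
          (length-ans (src e)) (length-ans (tgt e)) zu zv zw za zb) on)
        where
        ũ = bits ℓ (toℕ (src e))
        ṽ = bits ℓ (toℕ (tgt e))
        w̃ = bits ω (toℕ w)
        ã = ans (src e)
        b̃ = ans (tgt e)
        S : List Bool → List Bool → ℤ
        S u a = ℤSum.∑ (allFin n) λ j → ⟦ u == bits ℓ (toℕ j) ⟧ ℤ.* ⟦ a == ans j ⟧
        combine : (s₁ s₂ s₃ s t q : ℤ) → ℤ
        combine s₁ s₂ s₃ s t q = (s₁ ℤ.* (s₂ ℤ.* s₃)) ℤ.* (s ℤ.* (t ℤ.* (q ℤ.* 1ℤ)))
        F : Local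
        F u v w a b = combine ⟦ u == ũ ⟧ ⟦ v == ṽ ⟧ ⟦ w == w̃ ⟧ (S u a) (S v b) (scoreLocal u v w a b)
        kill₂ : ∀ a c d e f → combine a 0ℤ c d e f ≡ 0ℤ
        kill₂ a c d e f = cong (λ z → z ℤ.* (d ℤ.* (e ℤ.* (f ℤ.* 1ℤ)))) (ℤ.*-zeroʳ a)
        kill₃ : ∀ a b d e f → combine a b 0ℤ d e f ≡ 0ℤ
        kill₃ a b d e f = trans (cong (λ z → (a ℤ.* z) ℤ.* (d ℤ.* (e ℤ.* (f ℤ.* 1ℤ)))) (ℤ.*-zeroʳ b)) (kill₂ a 0ℤ d e f)
        kill₄ : ∀ a b c e f → combine a b c 0ℤ e f ≡ 0ℤ
        kill₄ a b c e f = ℤ.*-zeroʳ (a ℤ.* (b ℤ.* c))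
        kill₅ : ∀ a b c d f → combine a b c d 0ℤ f ≡ 0ℤ
        kill₅ a b c d f = trans (cong ((a ℤ.* (b ℤ.* c)) ℤ.*_) (ℤ.*-zeroʳ d)) (kill₄ a b c 0ℤ f)
        keep : ∀ q → (1ℤ ℤ.* (1ℤ ℤ.* 1ℤ)) ℤ.* (1ℤ ℤ.* (1ℤ ℤ.* (q ℤ.* 1ℤ))) ≡ q
        keep = ℤ-solve
        zu : ∀ u v w a b → u ≢ ũ → F u v w a b ≡ 0ℤ
        zu u v w a b ne rewrite ==-≢ ne = refl
        zv : ∀ v w a b → v ≢ ṽ → F ũ v w a b ≡ 0ℤ
        zv v w a b ne rewrite ==-≢ ne = kill₂ ⟦ ũ == ũ ⟧ ⟦ w == w̃ ⟧ (S ũ a) (S v b) (scoreLocal ũ v w a b)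
        zw : ∀ w a b → w ≢ w̃ → F ũ ṽ w a b ≡ 0ℤ
        zw w a b ne rewrite ==-≢ ne = kill₃ ⟦ ũ == ũ ⟧ ⟦ ṽ == ṽ ⟧ (S ũ a) (S ṽ b) (scoreLocal ũ ṽ w a b)
        za : ∀ a b → a ≢ ã → F ũ ṽ w̃ a b ≡ 0ℤ
        za a b ne rewrite select (src e) a | ==-≢ ne =
          kill₄ ⟦ ũ == ũ ⟧ ⟦ ṽ == ṽ ⟧ ⟦ w̃ == w̃ ⟧ (S ṽ b) (scoreLocal ũ ṽ w̃ a b)
        zb : ∀ b → b ≢ b̃ → F ũ ṽ w̃ ã b ≡ 0ℤ
        zb b ne rewrite select (tgt e) b | ==-≢ ne =
          kill₅ ⟦ ũ == ũ ⟧ ⟦ ṽ == ṽ ⟧ ⟦ w̃ == w̃ ⟧ (S ũ ã) (scoreLocal ũ ṽ w̃ ã b)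
        on : F ũ ṽ w̃ ã b̃ ≡ score dualOf names e w
        on rewrite select (src e) ã | select (tgt e) b̃ | ==-refl ũ | ==-refl ṽ | ==-refl w̃
                 | ==-refl ã | ==-refl b̃ | num-bits ω (ℕ.<-≤-trans (Fin.toℕ<n w) W≤) = keep (score dualOf names e w)

      tables-sum : ∀ τ → ∑ᵇ K (∏ (tables τ ans)) ≡ streamSum τ (score dualOf names)
      tables-sum []                   = ∑ᵇ-zero K λ _ → refl
      tables-sum (update e w Δ ∷ τ) = begin
        ∑ᵇ K (λ x → (δ ℤ.* f x ℤ.+ streamTable τ x) ℤ.* R x)
          ≡⟨ ∑ᵇ-cong K (λ x → lemma δ (f x) (streamTable τ x) (R x)) ⟩
        ∑ᵇ K (λ x → δ ℤ.* (f x ℤ.* R x) ℤ.+ streamTable τ x ℤ.* R x)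
          ≡⟨ ∑ᵇ-+ K (λ x → δ ℤ.* (f x ℤ.* R x)) _ ⟩
        ∑ᵇ K (λ x → δ ℤ.* (f x ℤ.* R x)) ℤ.+ ∑ᵇ K (∏ (tables τ ans))
          ≡⟨ cong₂ ℤ._+_ (trans (∑ᵇ-*ˡ K δ (λ x → f x ℤ.* R x)) (cong (δ ℤ.*_) (edge-sum e w))) (tables-sum τ) ⟩
        δ ℤ.* score dualOf names e w ℤ.+ streamSum τ (score dualOf names) ∎
        where
        open ≡-Reasoning
        δ = Δ ◃ 1
        f = flat (edgeLocal e w)
        R : Table
        R x = srcTable ans x ℤ.* (tgtTable ans x ℤ.* (scoreTable x ℤ.* 1ℤ))
        lemma : ∀ d a b r → (d ℤ.* a ℤ.+ b) ℤ.* r ≡ d ℤ.* (a ℤ.* r) ℤ.+ b ℤ.* r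
        lemma = ℤ-solve

take-length-++ : ∀ {k} {a b : List Bool} → length a ≡ k → take k (a ++ b) ≡ a
take-length-++ {a = []}    refl = refl
take-length-++ {a = x ∷ a} refl = cong (x ∷_) (take-length-++ {a = a} refl)

drop-length-++ : ∀ {k} {a b : List Bool} → length a ≡ k → drop k (a ++ b) ≡ b
drop-length-++ {a = []}    refl = refl
drop-length-++ {a = x ∷ a} refl = drop-length-++ {a = a} refl

-- Serialisation

-- A flag in front of every bit tells whether the list goes on. Thus lists of varying length, as the
-- buffer makes them, fit a vector of fixed length at the cost of a factor 2.
pad : ∀ cap → List Bool → Vec Bool (cap * 2)
pad zero      l       = []
pad (suc cap) []      = false ∷ false ∷ pad cap []
pad (suc cap) (b ∷ l) = true ∷ b ∷ pad cap l

unpad : ∀ cap → Vec Bool (cap * 2) → List Bool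
unpad zero      []              = []
unpad (suc cap) (false ∷ _ ∷ v) = []
unpad (suc cap) (true ∷ b ∷ v)  = b ∷ unpad cap v

unpad-pad : ∀ cap l → length l ≤ cap → unpad cap (pad cap l) ≡ l
unpad-pad zero      []      le       = refl
unpad-pad (suc cap) []      le       = refl
unpad-pad (suc cap) (b ∷ l) (s≤s le) = cong (b ∷_) (unpad-pad cap l le)

isNegative : ℤ → Bool
isNegative (ℤ.+ _)    = false
isNegative ℤ.-[1+ _ ] = true

int : ℕ → ℤ → List Bool
int b z = isNegative z ∷ bits b ∣ z ∣

unint : List Bool → ℤ
unint []      = 0ℤ
unint (s ∷ l) = if s then ℤ.- (ℤ.+ num l) else ℤ.+ num l

unint-int : ∀ b z → ∣ z ∣ < 2 ^ b → unint (int b z) ≡ z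
unint-int b (ℤ.+ k)    lt = cong ℤ.+_ (num-bits b lt)
unint-int b ℤ.-[1+ k ] lt = cong (λ j → ℤ.- (ℤ.+ j)) (num-bits b lt)

-- The bits are arbitrary here, so even the messages of a cheating prover decode to small integers.
unint-bound : ∀ b l → ∣ unint (take (suc b) l) ∣ ≤ 2 ^ b
unint-bound b []          = z≤n
unint-bound b (true ∷ l)  = ℕ.≤-trans (ℕ.≤-reflexive (ℤ.∣-i∣≡∣i∣ (ℤ.+ num (take b l)))) (ℕ.<⇒≤ (num-take-< b l))
unint-bound b (false ∷ l) = ℕ.<⇒≤ (num-take-< b l)

ints : ∀ b {d} → Vec ℤ d → List Bool
ints b []      = []
ints b (z ∷ p) = int b z ++ ints b p

unints : ∀ (b d : ℕ) → List Bool → Vec ℤ d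
unints b zero    l = []
unints b (suc d) l = unint (take (suc b) l) ∷ unints b d (drop (suc b) l)

length-int : ∀ b z → length (int b z) ≡ suc b
length-int b z = cong suc (length-bits b ∣ z ∣)

length-ints : ∀ b {d} (p : Vec ℤ d) → length (ints b p) ≡ d * suc b
length-ints b []      = refl
length-ints b (z ∷ p) = trans (List.length-++ (int b z)) (cong₂ _+_ (length-int b z) (length-ints b p))

unints-ints : ∀ b {d} {p : Vec ℤ d} → Allᵛ (λ z → ∣ z ∣ < 2 ^ b) p →
              ∀ rest → unints b d (ints b p ++ rest) ≡ p
unints-ints b []                   rest = refl
unints-ints b {suc d} {z ∷ p} (lt ∷ lts) rest = cong₂ _∷_
  (trans (cong (unint ∘ take (suc b)) eq)
    (trans (cong unint (take-length-++ {a = int b z} (length-int b z))) (unint-int b z lt)))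
  (trans (cong (unints b d ∘ drop (suc b)) eq)
    (trans (cong (unints b d) (drop-length-++ {a = int b z} (length-int b z))) (unints-ints b lts rest)))
  where eq = List.++-assoc (int b z) (ints b p) rest

unints-bound : ∀ b d l → Allᵛ (λ z → ∣ z ∣ ≤ 2 ^ b) (unints b d l)
unints-bound b zero    l = []
unints-bound b (suc d) l = unint-bound b l ∷ unints-bound b d (drop (suc b) l)

-- Bounds

abs-+-≤ : ∀ i j {a b} → ∣ i ∣ ≤ a → ∣ j ∣ ≤ b → ∣ i ℤ.+ j ∣ ≤ a + b
abs-+-≤ i j p q = ℕ.≤-trans (ℤ.∣i+j∣≤∣i∣+∣j∣ i j) (ℕ.+-mono-≤ p q)

abs-∸-≤ : ∀ i j {a b} → ∣ i ∣ ≤ a → ∣ j ∣ ≤ b → ∣ i ℤ.- j ∣ ≤ a + b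
abs-∸-≤ i j p q = ℕ.≤-trans (ℤ.∣i-j∣≤∣i∣+∣j∣ i j) (ℕ.+-mono-≤ p q)

abs-*-≤ : ∀ i j {a b} → ∣ i ∣ ≤ a → ∣ j ∣ ≤ b → ∣ i ℤ.* j ∣ ≤ a * b
abs-*-≤ i j p q = ℕ.≤-trans (ℕ.≤-reflexive (ℤ.abs-* i j)) (ℕ.*-mono-≤ p q)

∑-abs-≤ : ∀ {X : Set} (xs : List X) (f : X → ℤ) {c} → (∀ x → ∣ f x ∣ ≤ c) → ∣ ℤSum.∑ xs f ∣ ≤ length xs * c
∑-abs-≤ []       f le = z≤n
∑-abs-≤ (x ∷ xs) f le = abs-+-≤ (f x) (ℤSum.∑ xs f) (le x) (∑-abs-≤ xs f le)

BoundedBy : ℕ → Table → Set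
BoundedBy C f = ∀ x → ∣ f x ∣ ≤ C

Coeffs≤ : ℕ → ∀ {d} → Poly d → Set
Coeffs≤ b p = Allᵛ (λ z → ∣ z ∣ ≤ b) p

Coeffs≤-weaken : ∀ {a b d} {p : Poly d} → a ≤ b → Coeffs≤ a p → Coeffs≤ b p
Coeffs≤-weaken le []       = []
Coeffs≤-weaken le (x ∷ xs) = ℕ.≤-trans x le ∷ Coeffs≤-weaken le xs

-- Fixing one variable costs `suc m` bits. Over all `K` variables this adds up to `suc m * K` bits,
-- which is the reason why exact integers are affordable.
restrict-bounded : ∀ m {C} f r → ∣ r ∣ < 2 ^ m → BoundedBy C f → BoundedBy (C * 2 ^ suc m) (restrict r f)
restrict-bounded m {C} f r r< le x = begin
  ∣ restrict r f x ∣      ≤⟨ abs-+-≤ f₀ (r ℤ.* (f₁ ℤ.- f₀)) (le _)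
                               (abs-*-≤ r (f₁ ℤ.- f₀) ℕ.≤-refl (abs-∸-≤ f₁ f₀ (le _) (le _))) ⟩
  C + ∣ r ∣ * (C + C)     ≡⟨ lemma C ∣ r ∣ ⟩
  C * (1 + 2 * ∣ r ∣)     ≤⟨ ℕ.*-monoʳ-≤ C (ℕ.≤-trans (ℕ.n≤1+n _) (ℕ.≤-reflexive (sym (ℕ.*-suc 2 ∣ r ∣)))) ⟩
  C * (2 * suc ∣ r ∣)     ≤⟨ ℕ.*-monoʳ-≤ C (ℕ.*-monoʳ-≤ 2 r<) ⟩
  C * 2 ^ suc m           ∎
  where
  open ℕ.≤-Reasoning
  f₀ = f (false ∷ x)
  f₁ = f (true ∷ x)
  lemma : ∀ C r → C + r * (C + C) ≡ C * (1 + 2 * r)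
  lemma = ℕ-solve

mle-bounded : ∀ m {C} f rs → All (λ r → ∣ r ∣ < 2 ^ m) rs → BoundedBy C f →
              ∣ mle f rs ∣ ≤ C * (2 ^ suc m) ^ length rs
mle-bounded m {C} f []       []         le = ℕ.≤-trans (le []) (ℕ.≤-reflexive (sym (ℕ.*-identityʳ C)))
mle-bounded m {C} f (r ∷ rs) (r< ∷ rs<) le = ℕ.≤-trans
  (mle-bounded m (restrict r f) rs rs< (restrict-bounded m f r r< le))
  (ℕ.≤-reflexive (ℕ.*-assoc C (2 ^ suc m) ((2 ^ suc m) ^ length rs)))

eval-bounded : ∀ m {C d} (g : Poly d) x → ∣ x ∣ < 2 ^ m → Coeffs≤ C g →
               ∣ eval g x ∣ ≤ C * (2 ^ suc m) ^ d
eval-bounded m []      x x< [] = z≤n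
eval-bounded m {C} {suc d} (c ∷ g) x x< (le ∷ les) = begin
  ∣ c ℤ.+ x ℤ.* eval g x ∣           ≤⟨ abs-+-≤ c (x ℤ.* eval g x) le
                                          (abs-*-≤ x (eval g x) (ℕ.<⇒≤ x<) (eval-bounded m g x x< les)) ⟩
  C + M * (C * Q ^ d)                ≤⟨ ℕ.+-monoˡ-≤ _ one ⟩
  M * (C * Q ^ d) + M * (C * Q ^ d)  ≡⟨ lemma M C (Q ^ d) ⟩
  C * (Q * Q ^ d)                    ∎
  where
  open ℕ.≤-Reasoning
  M = 2 ^ m
  Q = 2 ^ suc m
  one : C ≤ M * (C * Q ^ d)
  one = begin
    C                ≡⟨ sym (trans (ℕ.*-identityˡ (C * 1)) (ℕ.*-identityʳ C)) ⟩
    1 * (C * 1)      ≤⟨ ℕ.*-mono-≤ (ℕ.m^n>0 2 m) (ℕ.*-monoʳ-≤ C (ℕ.m^n>0 Q {{ℕ.m^n≢0 2 (suc m)}} d)) ⟩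
    M * (C * Q ^ d)  ∎
  lemma : ∀ M C q → M * (C * q) + M * (C * q) ≡ C * ((2 * M) * q)
  lemma = ℕ-solve

linMul-bounded : ∀ α β carry {C b d} (p : Poly d) → ∣ α ∣ ≤ C → ∣ β ∣ ≤ C → ∣ carry ∣ ≤ C * b →
                 Coeffs≤ b p → Coeffs≤ (C * b + C * b) (linMul α β carry p)
linMul-bounded α β carry []      α≤ β≤ c≤ [] = ℕ.≤-trans c≤ (ℕ.m≤m+n _ _) ∷ []
linMul-bounded α β carry (c ∷ p) α≤ β≤ c≤ (le ∷ les) =
  abs-+-≤ carry (α ℤ.* c) c≤ (abs-*-≤ α c α≤ le) ∷
  linMul-bounded α β (β ℤ.* c) p α≤ β≤ (abs-*-≤ β c β≤ le) les

-- A factor `4 * C` per table: the coefficients of a linear factor are at most `2 * C`, and each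
-- coefficient of the product is a sum of at most two terms.
linePoly-bounded : ∀ {C J} (fs : Vec Table J) → Allᵛ (BoundedBy C) fs →
                   ∀ x → Coeffs≤ ((4 * C) ^ J) (linePoly fs x)
linePoly-bounded []       []         x = ℕ.≤-refl ∷ []
linePoly-bounded {C} {suc J} (f ∷ fs) (le ∷ les) x = Coeffs≤-weaken
  (ℕ.≤-reflexive (lemma C ((4 * C) ^ J)))
  (linMul-bounded (f (false ∷ x)) (f (true ∷ x) ℤ.- f (false ∷ x)) 0ℤ (linePoly fs x)
    (ℕ.≤-trans (le _) (ℕ.m≤m+n C C))
    (abs-∸-≤ (f (true ∷ x)) (f (false ∷ x)) (le _) (le _)) z≤n (linePoly-bounded fs les x))
  where
  lemma : ∀ C e → (C + C) * e + (C + C) * e ≡ (4 * C) * e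
  lemma = ℕ-solve

+ᵖ-bounded : ∀ {a b d} (p q : Poly d) → Coeffs≤ a p → Coeffs≤ b q → Coeffs≤ (a + b) (p +ᵖ q)
+ᵖ-bounded []      []      []       []       = []
+ᵖ-bounded (c ∷ p) (e ∷ q) (x ∷ xs) (y ∷ ys) = abs-+-≤ c e x y ∷ +ᵖ-bounded p q xs ys

∑ᵖ-bounded : ∀ k {b d} (p : List Bool → Poly d) → (∀ x → Coeffs≤ b (p x)) → Coeffs≤ (2 ^ k * b) (∑ᵖ k p)
∑ᵖ-bounded zero    {b} p le = Coeffs≤-weaken (ℕ.≤-reflexive (sym (ℕ.*-identityˡ b))) (le [])
∑ᵖ-bounded (suc k) {b} p le = Coeffs≤-weaken (ℕ.≤-reflexive (lemma (2 ^ k) b))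
  (+ᵖ-bounded (∑ᵖ k (p ∘ (false ∷_))) (∑ᵖ k (p ∘ (true ∷_)))
    (∑ᵖ-bounded k (p ∘ (false ∷_)) (le ∘ (false ∷_))) (∑ᵖ-bounded k (p ∘ (true ∷_)) (le ∘ (true ∷_))))
  where
  lemma : ∀ k b → k * b + k * b ≡ (2 * k) * b
  lemma = ℕ-solve

-- The verifier as a machine with bounded memory

-- `D` bounds the length of the stream; `m` is the number of bits of a challenge, `β` that of the
-- magnitude of a received coefficient, and `ρ` that of the magnitude of a register.
module Machine (n W D ℓ ω ψ m β ρ : ℕ) where
  open Tables n W ℓ ω ψ

  -- Γ is the length of a sumcheck message.  At a challenge point, X bounds the
  -- extension of a table with entries 0 and 1, and Z any claim of the prover.
  Γ Q X Z : ℕ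
  Γ = 5 * suc β
  Q = 2 ^ suc m
  X = Q ^ K
  Z = 2 ^ β * Q ^ 5

  -- accE, accS and accT accumulate the extensions of streamTable, srcTable and
  -- tgtTable; blk counts the answers received so far; buf holds the part of the
  -- current answer or polynomial received so far.  Sent coins are moved to the
  -- end of the list, so that the next challenge is always in front and the
  -- list is back in its original order when all coins have been sent.
  record Mem : Set where
    constructor mem
    field
      coins  : List Bool
      accE   : ℤ
      accS   : ℤ
      accT   : ℤ
      val    : ℕ
      claim  : ℤ
      blk    : ℕ
      ok     : Bool
      buf    : List Bool

  open Mem

  chunk : ℕ → List Bool → List ℤ
  chunk zero    l = []
  chunk (suc k) l = ℤ.+ num (take m l) ∷ chunk k (drop m l)

  points : Mem → List ℤ
  points s = chunk K (coins s)

  start : List Bool → Mem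
  start c = mem c 0ℤ 0ℤ 0ℤ 0 0ℤ 0 true []

  readᴹ : Update n W → Mem → Mem
  readᴹ (update e w Δ) s@(mem c E S T v cl k o b) =
    mem c (E ℤ.+ (Δ ◃ 1) ℤ.* mle (flat (edgeLocal e w)) (points s)) S T v cl k o b

  absorbAnswer absorbPoly absorb : List Bool → Mem → Mem
  absorbAnswer l s@(mem c E S T v cl k o b) =
    mem c E (S ℤ.+ mle (flat (srcLocal k l)) (points s)) (T ℤ.+ mle (flat (tgtLocal k l)) (points s))
        -- The announced total is accumulated twice: as the value to be output and as the initial
        -- claim of the sumcheck, which later rounds overwrite.
        (v + dual l) (cl ℤ.+ ℤ.+ dual l) (suc k) o []
  absorbPoly l (mem c E S T v cl k o b) =
    -- The evaluation uses the challenge in front of the coins, which is sent only after the message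
    -- has been absorbed.
    mem c E S T v (eval g (ℤ.+ num (take m c))) k (o ∧ does (endpoints g ℤ.≟ cl)) []
    where g = unints β 5 l
  absorb l s = if blk s <ᵇ n then absorbAnswer l s else absorbPoly l s

  width : ℕ → ℕ
  width k = if k <ᵇ n then A else Γ

  receiveᴹ : Bool → Mem → Mem
  receiveᴹ x s@(mem c E S T v cl k o b) =
    if width k ≤ᵇ length (b ++ x ∷ []) then absorb (b ++ x ∷ []) s
    else mem c E S T v cl k o (b ++ x ∷ [])

  sendᴹ : Mem → Bool × Mem
  sendᴹ s@(mem []      E S T v cl k o b) = false , s
  sendᴹ   (mem (x ∷ c) E S T v cl k o b) = x , mem (c ++ x ∷ []) E S T v cl k o b

  outputᴹ : Mem → Maybe ℕ
  outputᴹ s = if ok s ∧ does (claim s ℤ.≟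
                 accE s ℤ.* (accS s ℤ.* (accT s ℤ.* (mle scoreTable (points s) ℤ.* 1ℤ))))
              then just (val s) else nothing

  -- The index `j` counts the tokens read. The bounds refer to no strategy, so they survive every
  -- conversation and guarantee that each reachable memory can be encoded.
  record Inv (j : ℕ) (s : Mem) : Set where
    field
      coins-length : length (coins s) ≡ K * m
      accE-≤       : ∣ accE s ∣ ≤ j * X
      accS-≤       : ∣ accS s ∣ ≤ blk s * X
      accT-≤       : ∣ accT s ∣ ≤ blk s * X
      val-≤        : val s ≤ blk s * 2 ^ ψ
      -- The first summand covers the claim while answers arrive, the second any value of a received
      -- polynomial.
      claim-≤      : ∣ claim s ∣ ≤ blk s * 2 ^ ψ + Z
      blk-≤        : blk s ≤ n
      buf-≤        : length (buf s) ≤ A + Γ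

  open Inv

  chunk-bounded : ∀ k l → All (λ r → ∣ r ∣ < 2 ^ m) (chunk k l)
  chunk-bounded zero    l = []
  chunk-bounded (suc k) l = num-take-< m l ∷ chunk-bounded k (drop m l)

  length-chunk : ∀ k l → length (chunk k l) ≡ k
  length-chunk zero    l = refl
  length-chunk (suc k) l = cong suc (length-chunk k (drop m l))

  ⟦⟧-≤ : ∀ b → ∣ ⟦ b ⟧ ∣ ≤ 1
  ⟦⟧-≤ true  = ℕ.≤-refl
  ⟦⟧-≤ false = z≤n

  edge-bounded : ∀ e w → BoundedBy 1 (flat (edgeLocal e w))
  edge-bounded e w x = abs-*-≤ ⟦ b₁ ⟧ (⟦ b₂ ⟧ ℤ.* ⟦ b₃ ⟧) (⟦⟧-≤ b₁) (abs-*-≤ ⟦ b₂ ⟧ ⟦ b₃ ⟧ (⟦⟧-≤ b₂) (⟦⟧-≤ b₃))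
    where
    b₁ = take ℓ x == bits ℓ (toℕ (src e))
    b₂ = take ℓ (drop ℓ x) == bits ℓ (toℕ (tgt e))
    b₃ = take ω (drop ℓ (drop ℓ x)) == bits ω (toℕ w)

  src-bounded : ∀ k l → BoundedBy 1 (flat (srcLocal k l))
  src-bounded k l x = abs-*-≤ ⟦ b₁ ⟧ ⟦ b₂ ⟧ (⟦⟧-≤ b₁) (⟦⟧-≤ b₂)
    where
    b₁ = take ℓ x == bits ℓ k
    b₂ = take A (drop ω (drop ℓ (drop ℓ x))) == l

  tgt-bounded : ∀ k l → BoundedBy 1 (flat (tgtLocal k l))
  tgt-bounded k l x = abs-*-≤ ⟦ b₁ ⟧ ⟦ b₂ ⟧ (⟦⟧-≤ b₁) (⟦⟧-≤ b₂)
    where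
    b₁ = take ℓ (drop ℓ x) == bits ℓ k
    b₂ = drop A (drop ω (drop ℓ (drop ℓ x))) == l

  point-bounded : ∀ f → BoundedBy 1 f → ∀ s → ∣ mle f (points s) ∣ ≤ X
  point-bounded f le s = ℕ.≤-trans (mle-bounded m f (points s) (chunk-bounded K (coins s)) le)
    (ℕ.≤-reflexive (trans (ℕ.*-identityˡ _) (cong (Q ^_) (length-chunk K (coins s)))))

  start-inv : ∀ {c} → length c ≡ K * m → Inv 0 (start c)
  start-inv len = record
    { coins-length = len ; accE-≤ = z≤n ; accS-≤ = z≤n ; accT-≤ = z≤n ; val-≤ = z≤n
    ; claim-≤ = z≤n ; blk-≤ = z≤n ; buf-≤ = z≤n }

  read-inv : ∀ {j} x s → Inv j s → Inv (suc j) (readᴹ x s)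
  read-inv {j} (update e w Δ) s I = record
    { coins-length = coins-length I
    ; accE-≤ = ℕ.≤-trans
        (abs-+-≤ (accE s) ((Δ ◃ 1) ℤ.* mle f (points s)) (accE-≤ I)
          (abs-*-≤ (Δ ◃ 1) (mle f (points s)) (ℕ.≤-reflexive (ℤ.abs-◃ Δ 1))
            (point-bounded f (edge-bounded e w) s)))
        (ℕ.≤-reflexive (trans (ℕ.+-comm (j * X) _) (cong (_+ j * X) (ℕ.*-identityˡ X))))
    ; accS-≤ = accS-≤ I ; accT-≤ = accT-≤ I ; val-≤ = val-≤ I ; claim-≤ = claim-≤ I
    ; blk-≤ = blk-≤ I ; buf-≤ = buf-≤ I }
    where f = flat (edgeLocal e w)

  send-inv : ∀ {j} s → Inv j s → Inv j (proj₂ (sendᴹ s))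
  send-inv (mem [] _ _ _ _ _ _ _ _) I = I
  send-inv (mem (x ∷ c) _ _ _ _ _ _ _ _) I = record
    { coins-length = trans (List.length-++ c) (trans (ℕ.+-comm (length c) 1) (coins-length I))
    ; accE-≤ = accE-≤ I ; accS-≤ = accS-≤ I ; accT-≤ = accT-≤ I ; val-≤ = val-≤ I
    ; claim-≤ = claim-≤ I ; blk-≤ = blk-≤ I ; buf-≤ = buf-≤ I }

  answer-inv : ∀ {j} l s → blk s < n → Inv j s → Inv j (absorbAnswer l s)
  answer-inv {j} l s k<n I = record
    { coins-length = coins-length I ; accE-≤ = accE-≤ I
    ; accS-≤ = add (accS s) (mle f (points s)) (accS-≤ I) (point-bounded f (src-bounded (blk s) l) s)
    ; accT-≤ = add (accT s) (mle g (points s)) (accT-≤ I) (point-bounded g (tgt-bounded (blk s) l) s)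
    ; val-≤ = ℕ.≤-trans (ℕ.+-mono-≤ (val-≤ I) (ℕ.<⇒≤ (num-take-< ψ l))) (ℕ.≤-reflexive (ℕ.+-comm (blk s * 2 ^ ψ) _))
    ; claim-≤ = ℕ.≤-trans (abs-+-≤ (claim s) (ℤ.+ dual l) (claim-≤ I) (ℕ.<⇒≤ (num-take-< ψ l)))
        (ℕ.≤-reflexive (lemma (blk s * 2 ^ ψ) Z (2 ^ ψ)))
    ; blk-≤ = k<n ; buf-≤ = z≤n }
    where
    f = flat (srcLocal (blk s) l)
    g = flat (tgtLocal (blk s) l)
    add : ∀ a b {c x} → ∣ a ∣ ≤ c → ∣ b ∣ ≤ x → ∣ a ℤ.+ b ∣ ≤ x + c
    add a b {c} {x} p q = ℕ.≤-trans (abs-+-≤ a b p q) (ℕ.≤-reflexive (ℕ.+-comm c x))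
    lemma : ∀ a b c → (a + b) + c ≡ (c + a) + b
    lemma = ℕ-solve

  poly-inv : ∀ {j} l s → Inv j s → Inv j (absorbPoly l s)
  poly-inv l s I = record
    { coins-length = coins-length I ; accE-≤ = accE-≤ I ; accS-≤ = accS-≤ I ; accT-≤ = accT-≤ I
    ; val-≤ = val-≤ I
    ; claim-≤ = ℕ.≤-trans
        (eval-bounded m (unints β 5 l) (ℤ.+ num (take m (coins s))) (num-take-< m (coins s)) (unints-bound β 5 l))
        (ℕ.m≤n+m Z (blk s * 2 ^ ψ))
    ; blk-≤ = blk-≤ I ; buf-≤ = z≤n }

  absorb-inv : ∀ {j} l s → Inv j s → Inv j (absorb l s)
  absorb-inv l s I with blk s <ᵇ n in eq
  ... | true  = answer-inv l s (ℕ.<ᵇ⇒< (blk s) n (Bool.T-≡ .Equivalence.from eq)) I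
  ... | false = poly-inv l s I

  width-≤ : ∀ k → width k ≤ A + Γ
  width-≤ k with k <ᵇ n
  ... | true  = ℕ.m≤m+n A Γ
  ... | false = ℕ.m≤n+m Γ A

  receive-inv : ∀ {j} x s → Inv j s → Inv j (receiveᴹ x s)
  receive-inv x s I with width (blk s) ≤ᵇ length (buf s ++ x ∷ []) in eq
  ... | true  = absorb-inv (buf s ++ x ∷ []) s I
  ... | false = record
    { coins-length = coins-length I ; accE-≤ = accE-≤ I ; accS-≤ = accS-≤ I ; accT-≤ = accT-≤ I
    ; val-≤ = val-≤ I ; claim-≤ = claim-≤ I ; blk-≤ = blk-≤ I
    ; buf-≤ = ℕ.≤-trans (ℕ.<⇒≤ (ℕ.≰⇒> λ le → contradiction
                (trans (sym (Bool.T-≡ .Equivalence.to (ℕ.≤⇒≤ᵇ le))) eq) λ ()))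
              (width-≤ (blk s)) }

  registers : Mem → Vec ℤ 6
  registers s = accE s ∷ accS s ∷ accT s ∷ ℤ.+ val s ∷ claim s ∷ ℤ.+ blk s ∷ []

  serialise : Mem → List Bool
  serialise s = coins s ++ (ints ρ (registers s) ++ (ok s ∷ buf s))

  rebuild : List Bool → Vec ℤ 6 → List Bool → Mem
  rebuild c (E ∷ S ∷ T ∷ v ∷ cl ∷ k ∷ []) []      = mem c E S T (∣ v ∣) cl (∣ k ∣) false []
  rebuild c (E ∷ S ∷ T ∷ v ∷ cl ∷ k ∷ []) (o ∷ b) = mem c E S T (∣ v ∣) cl (∣ k ∣) o b

  deserialise : List Bool → Mem
  deserialise l = rebuild (take (K * m) l) (unints ρ 6 l′) (drop (6 * suc ρ) l′)
    where l′ = drop (K * m) l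

  cap : ℕ
  cap = K * m + (6 * suc ρ + suc (A + Γ))

  encodeᴹ : Mem → Vec Bool (cap * 2)
  encodeᴹ s = pad cap (serialise s)

  decodeᴹ : Vec Bool (cap * 2) → Mem
  decodeᴹ v = deserialise (unpad cap v)

  module _ (fit : (n * 2 ^ ψ + Z) + (D * X + n * X) < 2 ^ ρ) where

    registers-fit : ∀ {j s} → j ≤ D → Inv j s → Allᵛ (λ z → ∣ z ∣ < 2 ^ ρ) (registers s)
    registers-fit {j} {s} j≤D I =
      below (ℕ.≤-trans (accE-≤ I) (ℕ.≤-trans (ℕ.*-monoˡ-≤ X j≤D) (ℕ.≤-trans (ℕ.m≤m+n (D * X) (n * X)) (ℕ.m≤n+m _ (n * 2 ^ ψ + Z))))) ∷
      below (vertices (accS-≤ I)) ∷ below (vertices (accT-≤ I)) ∷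
      below (ℕ.≤-trans (val-≤ I) (ℕ.≤-trans (ℕ.*-monoˡ-≤ (2 ^ ψ) (blk-≤ I)) (ℕ.≤-trans (ℕ.m≤m+n _ Z) (ℕ.m≤m+n _ _)))) ∷
      below (ℕ.≤-trans (claim-≤ I) (ℕ.≤-trans (ℕ.+-monoˡ-≤ Z (ℕ.*-monoˡ-≤ (2 ^ ψ) (blk-≤ I))) (ℕ.m≤m+n _ _))) ∷
      below (vertices (ℕ.≤-trans (ℕ.≤-reflexive (sym (ℕ.*-identityʳ (blk s))))
                        (ℕ.*-monoʳ-≤ (blk s) (ℕ.m^n>0 Q {{ℕ.m^n≢0 2 (suc m)}} K)))) ∷ []
      where
      below : ∀ {a} → a ≤ (n * 2 ^ ψ + Z) + (D * X + n * X) → a < 2 ^ ρ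
      below le = ℕ.≤-<-trans le fit
      vertices : ∀ {a} → a ≤ blk s * X → a ≤ (n * 2 ^ ψ + Z) + (D * X + n * X)
      vertices le = ℕ.≤-trans le (ℕ.≤-trans (ℕ.*-monoˡ-≤ X (blk-≤ I))
        (ℕ.≤-trans (ℕ.m≤n+m (n * X) (D * X)) (ℕ.m≤n+m _ (n * 2 ^ ψ + Z))))

    decode-encode : ∀ {j s} → j ≤ D → Inv j s → decodeᴹ (encodeᴹ s) ≡ s
    decode-encode {j} {s} j≤D I = trans (cong deserialise (unpad-pad cap (serialise s) short)) round-trip
      where
      tail = ok s ∷ buf s
      short : length (serialise s) ≤ cap
      short = begin
        length (serialise s)
          ≡⟨ List.length-++ (coins s) ⟩
        length (coins s) + length (ints ρ (registers s) ++ tail)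
          ≡⟨ cong₂ _+_ (coins-length I) (trans (List.length-++ (ints ρ (registers s)))
               (cong (_+ length tail) (length-ints ρ (registers s)))) ⟩
        K * m + (6 * suc ρ + suc (length (buf s)))
          ≤⟨ ℕ.+-monoʳ-≤ (K * m) (ℕ.+-monoʳ-≤ (6 * suc ρ) (s≤s (buf-≤ I))) ⟩
        cap ∎
        where open ℕ.≤-Reasoning
      rest : drop (K * m) (serialise s) ≡ ints ρ (registers s) ++ tail
      rest = drop-length-++ {a = coins s} (coins-length I)
      round-trip : deserialise (serialise s) ≡ s
      round-trip
        rewrite rest
              | take-length-++ {a = coins s} {ints ρ (registers s) ++ tail} (coins-length I)
              | unints-ints ρ (registers-fit j≤D I) tail
              | drop-length-++ {a = ints ρ (registers s)} {tail} (length-ints ρ (registers s))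
        = refl

  flatten : ∀ {k} → Vec (Vec Bool m) k → List Bool
  flatten []       = []
  flatten (r ∷ rs) = toList r ++ flatten rs

  -- States are the bit vectors themselves, so the space bound holds by construction and what
  -- remains to be shown is that decoding recovers every reachable memory, which is `decode-encode`.
  verifier : List Round → Verifier (Update n W)
  verifier sched = record
    { State    = Vec Bool (cap * 2)
    ; space    = cap * 2
    ; encode   = ↣-id _
    ; init     = draws m K >>= λ rs → return (encodeᴹ (start (flatten rs)))
    ; read     = λ x v → return (encodeᴹ (readᴹ x (decodeᴹ v)))
    ; schedule = sched
    ; send     = λ v → return (proj₁ (sendᴹ (decodeᴹ v)) , encodeᴹ (proj₂ (sendᴹ (decodeᴹ v))))
    ; receive  = λ b v → return (encodeᴹ (receiveᴹ b (decodeᴹ v)))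
    ; output   = λ v → outputᴹ (decodeᴹ v)
    }

-- The conversation as a deterministic computation

say : Strategy → ℕ → Transcript → List Bool
say P zero    t = []
say P (suc k) t = P t ∷ say P k (P t ∷ t)

length-say : ∀ P k t → length (say P k t) ≡ k
length-say P zero    t = refl
length-say P (suc k) t = cong suc (length-say P k (P t ∷ t))

module Conversation (n W D ℓ ω ψ m β ρ : ℕ) where
  open Tables n W ℓ ω ψ
  open Machine n W D ℓ ω ψ m β ρ

  readsᴹ : Stream n W → Mem → Mem
  readsᴹ []      s = s
  readsᴹ (x ∷ τ) s = readsᴹ τ (readᴹ x s)

  sendsᴹ : ℕ → Mem × Transcript → Mem × Transcript
  sendsᴹ zero    c       = c
  sendsᴹ (suc k) (s , t) = sendsᴹ k (proj₂ (sendᴹ s) , proj₁ (sendᴹ s) ∷ t)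

  receivesᴹ : Strategy → ℕ → Mem × Transcript → Mem × Transcript
  receivesᴹ P zero    c       = c
  receivesᴹ P (suc k) (s , t) = receivesᴹ P k (receiveᴹ (P t) s , P t ∷ t)

  converseᴹ : Strategy → List Round → Mem × Transcript → Mem × Transcript
  converseᴹ P []               c = c
  converseᴹ P (round a b ∷ rs) c = converseᴹ P rs (receivesᴹ P b (sendsᴹ a c))

  -- A round begins with the verifier, but in sumcheck the prover speaks first. Hence each variable
  -- takes two rounds, one without challenge and one without response.
  phases : ℕ → List Round
  phases zero    = []
  phases (suc k) = round 0 Γ ∷ round m 0 ∷ phases k

  protocol : List Round
  protocol = round 0 (n * A) ∷ phases K

  V : Verifier (Update n W)
  V = verifier protocol

  finalᴹ : Strategy → Stream n W → Vec (Vec Bool m) K → Mem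
  finalᴹ P τ rs = proj₁ (converseᴹ P protocol (readsᴹ τ (start (flatten rs)) , []))

  module _ (fit : (n * 2 ^ ψ + Z) + (D * X + n * X) < 2 ^ ρ) where

    encode₂ : Mem × Transcript → Vec Bool (cap * 2) × Transcript
    encode₂ (s , t) = encodeᴹ s , t

    module _ {j} (j≤D : j ≤ D) where

      simulate-sends : ∀ k s t → Inv j s →
        verifierMessage V k (encodeᴹ s , t) ≡ return (encode₂ (sendsᴹ k (s , t))) × Inv j (proj₁ (sendsᴹ k (s , t)))
      simulate-sends zero    s t I = refl , I
      simulate-sends (suc k) s t I = trans
          (cong (λ s → verifierMessage V k (encodeᴹ (proj₂ (sendᴹ s)) , proj₁ (sendᴹ s) ∷ t)) (decode-encode fit j≤D I))
          (proj₁ rest) , proj₂ rest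
        where rest = simulate-sends k (proj₂ (sendᴹ s)) (proj₁ (sendᴹ s) ∷ t) (send-inv s I)

      simulate-receives : ∀ P k s t → Inv j s →
        proverMessage V P k (encodeᴹ s , t) ≡ return (encode₂ (receivesᴹ P k (s , t))) × Inv j (proj₁ (receivesᴹ P k (s , t)))
      simulate-receives P zero    s t I = refl , I
      simulate-receives P (suc k) s t I = trans
          (cong (λ s → proverMessage V P k (encodeᴹ (receiveᴹ (P t) s) , P t ∷ t)) (decode-encode fit j≤D I))
          (proj₁ rest) , proj₂ rest
        where rest = simulate-receives P k (receiveᴹ (P t) s) (P t ∷ t) (receive-inv (P t) s I)

      simulate-converse : ∀ P sched s t → Inv j s →
        converse V P sched (encodeᴹ s , t) ≡ return (encode₂ (converseᴹ P sched (s , t))) × Inv j (proj₁ (converseᴹ P sched (s , t)))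
      simulate-converse P []                 s t I = refl , I
      simulate-converse P (round a b ∷ sched) s t I = trans
          (cong (λ c → c >>= proverMessage V P b >>= converse V P sched) (proj₁ sent))
          (trans (cong (_>>= converse V P sched) (proj₁ got)) (proj₁ rest)) , proj₂ rest
        where
        c₁ = sendsᴹ a (s , t)
        c₂ = receivesᴹ P b c₁
        sent = simulate-sends a s t I
        got  = simulate-receives P b (proj₁ c₁) (proj₂ c₁) (proj₂ sent)
        rest = simulate-converse P sched (proj₁ c₂) (proj₂ c₂) (proj₂ got)

    simulate-reads : ∀ {j} τ s → j + length τ ≤ D → Inv j s →
      readAll V τ (encodeᴹ s) ≡ return (encodeᴹ (readsᴹ τ s)) × Inv (j + length τ) (readsᴹ τ s)
    simulate-reads {j} []      s le I = refl , subst (λ k → Inv k s) (sym (ℕ.+-identityʳ j)) I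
    simulate-reads {j} (x ∷ τ) s le I = trans
        (cong (λ s → readAll V τ (encodeᴹ (readᴹ x s))) (decode-encode fit (ℕ.≤-trans (ℕ.m≤m+n j _) le) I))
        (proj₁ rest) , subst (λ k → Inv k (readsᴹ τ (readᴹ x s))) (sym (ℕ.+-suc j (length τ))) (proj₂ rest)
      where rest = simulate-reads τ (readᴹ x s) (subst (_≤ D) (ℕ.+-suc j (length τ)) le) (read-inv x s I)

    length-flatten : ∀ {k} (rs : Vec (Vec Bool m) k) → length (flatten rs) ≡ k * m
    length-flatten []       = refl
    length-flatten (r ∷ rs) = trans (List.length-++ (toList r))
      (cong₂ _+_ (Vec.length-toList r) (length-flatten rs))

    -- All randomness sits in the initial coins; afterwards a fixed strategy makes everything
    -- deterministic. Probabilities of outputs thus become probabilities over the challenges.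
    run-simulated : ∀ P τ → length τ ≤ D →
                    run V P τ ≡ (draws m K >>= λ rs → return (outputᴹ (finalᴹ P τ rs)))
    run-simulated P τ le = trans
      (>>=-start (draws m K) (encodeᴹ ∘ start ∘ flatten) (readAll V τ) _)
      (>>=-cong (draws m K) (step _ λ _ _ → refl))
      where
      -- The last continuation of `run` is an anonymous function; it enters as `h`, known only
      -- through its values.
      step : ∀ (h : Vec Bool (cap * 2) × Transcript → Rand (Maybe ℕ)) →
             (∀ v t → h (v , t) ≡ return (outputᴹ (decodeᴹ v))) → ∀ rs →
             (readAll V τ (encodeᴹ (start (flatten rs))) >>= λ s → converse V P protocol (s , []) >>= h)
               ≡ return (outputᴹ (finalᴹ P τ rs))
      step h h≡ rs = trans (cong (_>>= λ s → converse V P protocol (s , []) >>= h) (proj₁ reads))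
          (trans (cong (_>>= h) (proj₁ talk))
            (trans (h≡ _ _) (cong (return ∘ outputᴹ) (decode-encode fit le (proj₂ talk)))))
        where
        reads = simulate-reads {0} τ (start (flatten rs)) le (start-inv (length-flatten rs))
        talk  = simulate-converse le P protocol (readsᴹ τ (start (flatten rs))) [] (proj₂ reads)

-- The output as the outcome of a sumcheck game

∑-allFin-suc : ∀ {n} (f : Fin (suc n) → ℕ) → ∑ (allFin (suc n)) f ≡ f Fin.zero + ∑ (allFin n) (f ∘ Fin.suc)
∑-allFin-suc {n} f = cong (λ l → f Fin.zero + foldr _+_ 0 l)
  (trans (List.map-tabulate Fin.suc f) (sym (List.map-tabulate id (f ∘ Fin.suc))))

ℤ∑-allFin-suc : ∀ {n} (f : Fin (suc n) → ℤ) →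
                ℤSum.∑ (allFin (suc n)) f ≡ f Fin.zero ℤ.+ ℤSum.∑ (allFin n) (f ∘ Fin.suc)
ℤ∑-allFin-suc {n} f = cong (λ l → f Fin.zero ℤ.+ foldr ℤ._+_ 0ℤ l)
  (trans (List.map-tabulate Fin.suc f) (sym (List.map-tabulate id (f ∘ Fin.suc))))

n≮ᵇn : ∀ n → (n <ᵇ n) ≡ false
n≮ᵇn zero    = refl
n≮ᵇn (suc n) = n≮ᵇn n

<ᵇ-true : ∀ {k n} → k < n → (k <ᵇ n) ≡ true
<ᵇ-true lt = Bool.T-≡ .Equivalence.to (ℕ.<⇒<ᵇ lt)

≤ᵇ-true : ∀ {k n} → k ≤ n → (k ≤ᵇ n) ≡ true
≤ᵇ-true le = Bool.T-≡ .Equivalence.to (ℕ.≤⇒≤ᵇ le)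

≤ᵇ-false : ∀ {k n} → n < k → (k ≤ᵇ n) ≡ false
≤ᵇ-false {k} {n} lt with k ≤ᵇ n in eq
... | false = refl
... | true  = contradiction (ℕ.≤ᵇ⇒≤ k n (Bool.T-≡ .Equivalence.from eq)) (ℕ.<⇒≱ lt)

module Outcome (n W D ℓ ω ψ m β ρ : ℕ) where
  open Tables n W ℓ ω ψ
  open Machine n W D ℓ ω ψ m β ρ
  open Conversation n W D ℓ ω ψ m β ρ

  feed : List Bool → Mem → Mem
  feed []      s = s
  feed (x ∷ l) s = feed l (receiveᴹ x s)

  receives-feed : ∀ P k s t → receivesᴹ P k (s , t) ≡ (feed (say P k t) s , say P k t ʳ++ t)
  receives-feed P zero    s t = refl
  receives-feed P (suc k) s t = receives-feed P k (receiveᴹ (P t) s) (P t ∷ t)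

  receives-+ : ∀ P a b c → receivesᴹ P (a + b) c ≡ receivesᴹ P b (receivesᴹ P a c)
  receives-+ P zero    b c       = refl
  receives-+ P (suc a) b (s , t) = receives-+ P a b (receiveᴹ (P t) s , P t ∷ t)

  -- The induction moves bits from the input to the buffer `b`: a proper prefix of the block is too
  -- short to trigger `absorb`, and the last bit does so.
  feed-block : ∀ c E S T v cl k o b x l → length (b ++ x ∷ l) ≡ width k →
               feed (x ∷ l) (mem c E S T v cl k o b) ≡ absorb (b ++ x ∷ l) (mem c E S T v cl k o [])
  feed-block c E S T v cl k o b x [] len
    rewrite ≤ᵇ-true (ℕ.≤-reflexive (sym len)) = refl
  feed-block c E S T v cl k o b x (x′ ∷ l) len =
    trans (cong (feed (x′ ∷ l)) keep)
      (trans (feed-block c E S T v cl k o (b ++ x ∷ []) x′ l (trans (cong length assoc) len))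
        (cong (λ l → absorb l (mem c E S T v cl k o [])) assoc))
    where
    assoc = List.++-assoc b (x ∷ []) (x′ ∷ l)
    shorter : length (b ++ x ∷ []) < width k
    shorter = ℕ.<-≤-trans
      (ℕ.<-≤-trans (ℕ.m<m+n (length (b ++ x ∷ [])) (s≤s z≤n))
        (ℕ.≤-reflexive (sym (List.length-++ (b ++ x ∷ []) {x′ ∷ l}))))
      (ℕ.≤-reflexive (trans (cong length assoc) len))
    keep : receiveᴹ x (mem c E S T v cl k o b) ≡ mem c E S T v cl k o (b ++ x ∷ [])
    keep rewrite ≤ᵇ-false shorter = refl

  receive-block : ∀ P c E S T v cl k o t {w} → width k ≡ w → 0 < w →
    receivesᴹ P w (mem c E S T v cl k o [] , t) ≡
      (absorb (say P w t) (mem c E S T v cl k o []) , say P w t ʳ++ t)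
  receive-block P c E S T v cl k o t {w} w≡ pos = trans (receives-feed P w _ t)
    (cong (_, say P w t ʳ++ t) (go (say P w t) (length-say P w t)))
    where
    go : ∀ l → length l ≡ w → feed l (mem c E S T v cl k o []) ≡ absorb l (mem c E S T v cl k o [])
    go []      len = contradiction (subst (0 <_) (sym len) pos) λ ()
    go (x ∷ l) len = feed-block c E S T v cl k o [] x l (trans len (sym w≡))

  -- The answers are a function of the strategy and the transcript before any coin is sent.
  -- Therefore the tables in the soundness argument do not depend on the challenges.
  answers : Strategy → ∀ j → Transcript → Vec (List Bool) j
  answers P zero    t = []
  answers P (suc j) t = say P A t ∷ answers P j (say P A t ʳ++ t)

  afterAnswers : Strategy → ℕ → Transcript → Transcript
  afterAnswers P zero    t = t
  afterAnswers P (suc j) t = afterAnswers P j (say P A t ʳ++ t)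

  length-answers : ∀ P j t i → length (lookup (answers P j t) i) ≡ A
  length-answers P (suc j) t Fin.zero    = length-say P A t
  length-answers P (suc j) t (Fin.suc i) = length-answers P j _ i

  mem-cong : ∀ {c E o b S S′ T T′ v v′ cl cl′ k k′} → S ≡ S′ → T ≡ T′ → v ≡ v′ → cl ≡ cl′ → k ≡ k′ →
             mem c E S T v cl k o b ≡ mem c E S′ T′ v′ cl′ k′ o b
  mem-cong refl refl refl refl refl = refl

  -- Induction on the answers still to come, `k` of them having been absorbed; this is the origin of
  -- the offset in `k + toℕ i`.
  answers-stage : 0 < A → ∀ P j c E S T v cl k o t → k + j ≤ n →
    let a = lookup (answers P j t) in
    receivesᴹ P (j * A) (mem c E S T v cl k o [] , t) ≡
      (mem c E (S ℤ.+ ℤSum.∑ (allFin j) (λ i → mle (flat (srcLocal (k + toℕ i) (a i))) (chunk K c)))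
               (T ℤ.+ ℤSum.∑ (allFin j) (λ i → mle (flat (tgtLocal (k + toℕ i) (a i))) (chunk K c)))
               (v + ∑ (allFin j) (dual ∘ a)) (cl ℤ.+ ℤ.+ ∑ (allFin j) (dual ∘ a)) (k + j) o []
      , afterAnswers P j t)
  answers-stage A>0 P zero    c E S T v cl k o t le = cong (_, t)
    (mem-cong (sym (ℤ.+-identityʳ S)) (sym (ℤ.+-identityʳ T)) (sym (ℕ.+-identityʳ v))
      (sym (ℤ.+-identityʳ cl)) (sym (ℕ.+-identityʳ k)))
  answers-stage A>0 P (suc j) c E S T v cl k o t le = begin
      receivesᴹ P (A + j * A) (s , t)
    ≡⟨ receives-+ P A (j * A) (s , t) ⟩
      receivesᴹ P (j * A) (receivesᴹ P A (s , t))
    ≡⟨ cong (receivesᴹ P (j * A)) first ⟩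
      receivesᴹ P (j * A) (absorbAnswer l s , t₁)
    ≡⟨ answers-stage A>0 P j c E _ _ _ _ (suc k) o t₁ (subst (_≤ n) (ℕ.+-suc k j) le) ⟩
      _
    ≡⟨ cong (_, afterAnswers P j t₁) (mem-cong
         (shift S (λ k a → mle (flat (srcLocal k a)) (chunk K c)))
         (shift T (λ k a → mle (flat (tgtLocal k a)) (chunk K c)))
         (trans (ℕ.+-assoc v _ _) (cong (v +_) (sym (∑-allFin-suc (dual ∘ a)))))
         (trans (ℤ.+-assoc cl _ _) (cong (λ z → cl ℤ.+ ℤ.+ z) (sym (∑-allFin-suc (dual ∘ a)))))
         (sym (ℕ.+-suc k j))) ⟩
      _ ∎
    where
    open ≡-Reasoning
    s = mem c E S T v cl k o []
    l = say P A t
    t₁ = l ʳ++ t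
    a = lookup (answers P (suc j) t)
    k<n : (k <ᵇ n) ≡ true
    k<n = <ᵇ-true (ℕ.<-≤-trans (ℕ.m<m+n k (s≤s z≤n)) le)
    first : receivesᴹ P A (s , t) ≡ (absorbAnswer l s , t₁)
    first = trans (receive-block P c E S T v cl k o t (cong (λ b → if b then A else Γ) k<n) A>0)
      (cong (λ b → (if b then absorbAnswer l s else absorbPoly l s) , t₁) k<n)
    shift : ∀ S (F : ℕ → List Bool → ℤ) →
            (S ℤ.+ F k l) ℤ.+ ℤSum.∑ (allFin j) (λ i → F (suc k + toℕ i) (a (Fin.suc i))) ≡
            S ℤ.+ ℤSum.∑ (allFin (suc j)) (λ i → F (k + toℕ i) (a i))
    shift S F = trans (ℤ.+-assoc S _ _) (cong (λ z → S ℤ.+ z) (sym (trans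
      (ℤ∑-allFin-suc (λ i → F (k + toℕ i) (a i)))
      (cong₂ ℤ._+_ (cong (λ z → F z l) (ℕ.+-identityʳ k))
        (ℤSum.∑-cong (allFin j) λ i → cong (λ z → F z (a (Fin.suc i))) (ℕ.+-suc k (toℕ i)))))))

  reads-stage : ∀ τ c E S T v cl k o b →
    readsᴹ τ (mem c E S T v cl k o b) ≡
      mem c (E ℤ.+ ℤSum.∑ τ (λ (update e w Δ) → (Δ ◃ 1) ℤ.* mle (flat (edgeLocal e w)) (chunk K c))) S T v cl k o b
  reads-stage []      c E S T v cl k o b = cong (λ E → mem c E S T v cl k o b) (sym (ℤ.+-identityʳ E))
  reads-stage (x ∷ τ) c E S T v cl k o b = trans (reads-stage τ c _ S T v cl k o b)
    (cong (λ E → mem c E S T v cl k o b) (ℤ.+-assoc E _ _))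

  send-stage : ∀ {m′} (r : Vec Bool m′) rest E S T v cl k o b t →
    sendsᴹ m′ (mem (toList r ++ rest) E S T v cl k o b , t) ≡
      (mem (rest ++ toList r) E S T v cl k o b , toList r ʳ++ t)
  send-stage []      rest E S T v cl k o b t =
    cong (λ c → mem c E S T v cl k o b , t) (sym (List.++-identityʳ rest))
  send-stage (x ∷ r) rest E S T v cl k o b t
    rewrite List.++-assoc (toList r) rest (x ∷ []) =
    trans (send-stage r (rest ++ x ∷ []) E S T v cl k o b (x ∷ t))
          (cong (λ c → mem c E S T v cl k o b , toList r ʳ++ (x ∷ t)) (List.++-assoc rest (x ∷ []) (toList r)))

  adversary : Strategy → ∀ k → Transcript → Adversary m 5 k
  adversary P zero    t = stop
  adversary P (suc k) t = move (unints β 5 (say P Γ t))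
    (λ r → adversary P k (toList r ʳ++ (say P Γ t ʳ++ t)))

  -- `done` holds the revealed challenges, rotated behind the pending ones. At the end the coins are
  -- in their original order, so the final test uses the same point as the stream did.
  sumcheck-stage : ∀ P {k} (rs : Vec (Vec Bool m) k) done E S T v cl o t →
    let outcome = play (adversary P k t) (cl , o) rs in
    proj₁ (converseᴹ P (phases k) (mem (flatten rs ++ done) E S T v cl n o [] , t)) ≡
      mem (done ++ flatten rs) E S T v (proj₁ outcome) n (proj₂ outcome) []
  sumcheck-stage P [] done E S T v cl o t =
    cong (λ c → mem c E S T v cl n o []) (sym (List.++-identityʳ done))
  sumcheck-stage P {suc k} (r ∷ rs) done E S T v cl o t = begin
      proj₁ (converseᴹ P (phases k) (sendsᴹ m (receivesᴹ P Γ (s , t))))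
    ≡⟨ cong (λ z → proj₁ (converseᴹ P (phases k) (sendsᴹ m z))) first ⟩
      proj₁ (converseᴹ P (phases k) (sendsᴹ m (absorbPoly l s , t₁)))
    ≡⟨ cong (λ z → proj₁ (converseᴹ P (phases k) z)) second ⟩
      proj₁ (converseᴹ P (phases k) (mem (flatten rs ++ (done ++ toList r)) E S T v cl′ n o′ [] , toList r ʳ++ t₁))
    ≡⟨ sumcheck-stage P rs (done ++ toList r) E S T v cl′ o′ (toList r ʳ++ t₁) ⟩
      _
    ≡⟨ cong (λ c → mem c E S T v _ n _ []) (List.++-assoc done (toList r) (flatten rs)) ⟩
      _ ∎
    where
    open ≡-Reasoning
    coins₀ = (toList r ++ flatten rs) ++ done
    s = mem coins₀ E S T v cl n o []
    l = say P Γ t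
    t₁ = l ʳ++ t
    g = unints β 5 l
    cl′ = eval g (ι r)
    o′ = o ∧ does (endpoints g ℤ.≟ cl)
    first : receivesᴹ P Γ (s , t) ≡ (absorbPoly l s , t₁)
    first = trans (receive-block P coins₀ E S T v cl n o t (cong (λ b → if b then A else Γ) (n≮ᵇn n)) (s≤s z≤n))
      (cong (λ b → (if b then absorbAnswer l s else absorbPoly l s) , t₁) (n≮ᵇn n))
    split : coins₀ ≡ toList r ++ (flatten rs ++ done)
    split = List.++-assoc (toList r) (flatten rs) done
    second : sendsᴹ m (absorbPoly l s , t₁) ≡
             (mem (flatten rs ++ (done ++ toList r)) E S T v cl′ n o′ [] , toList r ʳ++ t₁)
    second = begin
      sendsᴹ m (mem coins₀ E S T v (eval g (ℤ.+ num (take m coins₀))) n o′ [] , t₁)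
        ≡⟨ cong₂ (λ c c′ → sendsᴹ m (mem c E S T v (eval g (ℤ.+ num c′)) n o′ [] , t₁)) split
             (trans (cong (take m) split) (take-length-++ {a = toList r} (Vec.length-toList r))) ⟩
      sendsᴹ m (mem (toList r ++ (flatten rs ++ done)) E S T v cl′ n o′ [] , t₁)
        ≡⟨ send-stage r (flatten rs ++ done) E S T v cl′ n o′ [] t₁ ⟩
      (mem ((flatten rs ++ done) ++ toList r) E S T v cl′ n o′ [] , toList r ʳ++ t₁)
        ≡⟨ cong (λ c → mem c E S T v cl′ n o′ [] , toList r ʳ++ t₁) (List.++-assoc (flatten rs) done (toList r)) ⟩
      (mem (flatten rs ++ (done ++ toList r)) E S T v cl′ n o′ [] , toList r ʳ++ t₁) ∎

  chunk-flatten : ∀ {k} (rs : Vec (Vec Bool m) k) → chunk k (flatten rs) ≡ ιs rs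
  chunk-flatten []       = refl
  chunk-flatten {suc k} (r ∷ rs) = cong₂ _∷_
    (cong (λ l → ℤ.+ num l) (take-length-++ {a = toList r} (Vec.length-toList r)))
    (trans (cong (chunk k) (drop-length-++ {a = toList r} (Vec.length-toList r))) (chunk-flatten rs))

  verdict : ℤ × Bool → ℤ → ℕ → Maybe ℕ
  verdict (c , o) target v = if o ∧ does (c ℤ.≟ target) then just v else nothing

  verdict-cases : ∀ out target v → verdict out target v ≡ nothing ⊎ (out ≡ (target , true) × verdict out target v ≡ just v)
  verdict-cases (c , false) target v = inj₁ refl
  verdict-cases (c , true) target v with c ℤ.≟ target
  ... | yes refl = inj₂ (refl , refl)
  ... | no _     = inj₁ refl

  verdict-accept : ∀ target v → verdict (target , true) target v ≡ just v
  verdict-accept target v with target ℤ.≟ target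
  ... | yes _ = refl
  ... | no ne = contradiction refl ne

  module _ (A>0 : 0 < A) where

    -- By linearity the three registers hold the extensions of their tables at the challenge point,
    -- so the final test compares the last claim of `play` with the value that occurs in `Fooled`.
    output-final : ∀ P τ rs → let a = lookup (answers P n []) in
      outputᴹ (finalᴹ P τ rs) ≡
        verdict (play (adversary P K (afterAnswers P n [])) (ℤ.+ ∑ (allFin n) (dual ∘ a) , true) rs)
                (∏-mle (tables τ a) (ιs rs)) (∑ (allFin n) (dual ∘ a))
    output-final P τ rs = trans (cong outputᴹ final) (cong₂ (λ z w → verdict out z w) target refl)
      where
      a = lookup (answers P n [])
      c = flatten rs
      pts = chunk K c
      total = ∑ (allFin n) (dual ∘ a)
      out = play (adversary P K (afterAnswers P n [])) (ℤ.+ total , true) rs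
      E′ = 0ℤ ℤ.+ ℤSum.∑ τ (λ (update e w Δ) → (Δ ◃ 1) ℤ.* mle (flat (edgeLocal e w)) pts)
      S′ = 0ℤ ℤ.+ ℤSum.∑ (allFin n) (λ i → mle (flat (srcLocal (toℕ i) (a i))) pts)
      T′ = 0ℤ ℤ.+ ℤSum.∑ (allFin n) (λ i → mle (flat (tgtLocal (toℕ i) (a i))) pts)
      final : finalᴹ P τ rs ≡ mem c E′ S′ T′ total (proj₁ out) n (proj₂ out) []
      final = begin
        proj₁ (converseᴹ P (phases K) (receivesᴹ P (n * A) (readsᴹ τ (start c) , [])))
          ≡⟨ cong (λ s → proj₁ (converseᴹ P (phases K) (receivesᴹ P (n * A) (s , []))))
               (reads-stage τ c 0ℤ 0ℤ 0ℤ 0 0ℤ 0 true []) ⟩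
        proj₁ (converseᴹ P (phases K) (receivesᴹ P (n * A) (mem c E′ 0ℤ 0ℤ 0 0ℤ 0 true [] , [])))
          ≡⟨ cong (λ z → proj₁ (converseᴹ P (phases K) z))
               (answers-stage A>0 P n c E′ 0ℤ 0ℤ 0 0ℤ 0 true [] ℕ.≤-refl) ⟩
        proj₁ (converseᴹ P (phases K) (mem c E′ S′ T′ total (ℤ.+ total) n true [] , afterAnswers P n []))
          ≡⟨ cong (λ c → proj₁ (converseᴹ P (phases K) (mem c E′ S′ T′ total (ℤ.+ total) n true [] , afterAnswers P n [])))
               (sym (List.++-identityʳ c)) ⟩
        proj₁ (converseᴹ P (phases K) (mem (c ++ []) E′ S′ T′ total (ℤ.+ total) n true [] , afterAnswers P n []))
          ≡⟨ sumcheck-stage P rs [] E′ S′ T′ total (ℤ.+ total) true (afterAnswers P n []) ⟩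
        mem c E′ S′ T′ total (proj₁ out) n (proj₂ out) [] ∎
        where open ≡-Reasoning
      E≡ : E′ ≡ mle (streamTable τ) pts
      E≡ = trans (ℤ.+-identityˡ _) (sym (trans
        (mle-∑ τ (λ (update e w Δ) x → (Δ ◃ 1) ℤ.* flat (edgeLocal e w) x) pts)
        (ℤSum.∑-cong τ λ (update e w Δ) → mle-*ˡ (Δ ◃ 1) (flat (edgeLocal e w)) pts)))
      S≡ : S′ ≡ mle (srcTable a) pts
      S≡ = trans (ℤ.+-identityˡ _) (sym (mle-∑ (allFin n) (λ i → flat (srcLocal (toℕ i) (a i))) pts))
      T≡ : T′ ≡ mle (tgtTable a) pts
      T≡ = trans (ℤ.+-identityˡ _) (sym (mle-∑ (allFin n) (λ i → flat (tgtLocal (toℕ i) (a i))) pts))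
      target : E′ ℤ.* (S′ ℤ.* (T′ ℤ.* (mle scoreTable pts ℤ.* 1ℤ))) ≡ ∏-mle (tables τ a) (ιs rs)
      target = trans
        (cong₂ ℤ._*_ E≡ (cong₂ ℤ._*_ S≡ (cong (ℤ._* (mle scoreTable pts ℤ.* 1ℤ)) T≡)))
        (trans (sym (∏-mle-4 (streamTable τ) (srcTable a) (tgtTable a) scoreTable pts))
               (cong (∏-mle (tables τ a)) (chunk-flatten rs)))

-- The honest prover's strategy

-- A strategy is a function of the whole transcript, while the honest prover is naturally a process
-- with a current position. A plan is such a process, turned into a strategy by replaying the
-- transcript.
data Plan : Set where
  end   : Plan
  utter : Bool → Plan → Plan
  hear  : (Bool → Plan) → Plan

-- The next bit to utter when the given bits, oldest first, have been exchanged.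
next : Plan → List Bool → Bool
next end         l       = false
next (utter b q) []      = b
next (utter b q) (_ ∷ l) = next q l
next (hear f)    []      = false
next (hear f)    (b ∷ l) = next (f b) l

-- `l` ranges over all continuations of `t`, so the property can be carried forward bit by bit,
-- whatever the verifier sends.
Follows : Strategy → Transcript → Plan → Set
Follows P t q = ∀ l → P (l ʳ++ t) ≡ next q l

utterAll : List Bool → Plan → Plan
utterAll []      q = q
utterAll (b ∷ l) q = utter b (utterAll l q)

hearAll : ℕ → (List Bool → Plan) → Plan
hearAll zero    f = f []
hearAll (suc m) f = hear λ b → hearAll m (f ∘ (b ∷_))

follow-utter : ∀ {P t q} l → Follows P t (utterAll l q) → ∀ {k} → length l ≡ k →
               say P k t ≡ l × Follows P (say P k t ʳ++ t) q
follow-utter []      fol refl = refl , fol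
follow-utter {P} {t} {q} (b ∷ l) fol refl with P t | fol []
... | _ | refl with follow-utter l (fol ∘ (b ∷_)) refl
...   | eq , fol′ = cong (b ∷_) eq , fol′

follow-hear : ∀ {P t m} f → Follows P t (hearAll m f) → (r : Vec Bool m) → Follows P (toList r ʳ++ t) (f (toList r))
follow-hear f fol []      = fol
follow-hear {P} {t} f fol (b ∷ r) = follow-hear {P} {b ∷ t} (f ∘ (b ∷_)) (fol ∘ (b ∷_)) r

follow-next : ∀ q → Follows (next q ∘ reverse) [] q
follow-next q l = cong (next q) (List.reverse-involutive l)

-- Soundness and completeness of the protocol

module Correctness (n W D ℓ ω ψ m β ρ : ℕ) where
  open Tables n W ℓ ω ψ
  open Machine n W D ℓ ω ψ m β ρ
  open Conversation n W D ℓ ω ψ m β ρ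
  open Outcome n W D ℓ ω ψ m β ρ

  honest : (k : ℕ) → Vec Table 4 → Plan
  honest zero    fs = end
  honest (suc k) fs = utterAll (ints β (roundPoly k fs))
    (hearAll m λ l → honest k (Vec.map (restrict (ℤ.+ num l)) fs))

  answerEach : ∀ {j} → Vec (List Bool) j → Plan → Plan
  answerEach []       q = q
  answerEach (l ∷ ls) q = utterAll l (answerEach ls q)

  follow-answers : ∀ {P q j} (ls : Vec (List Bool) j) t → Allᵛ (λ l → length l ≡ A) ls →
    Follows P t (answerEach ls q) → answers P j t ≡ ls × Follows P (afterAnswers P j t) q
  follow-answers []       t []         fol = refl , fol
  follow-answers (l ∷ ls) t (len ∷ lens) fol with follow-utter l fol len
  ... | said , fol′ with follow-answers ls _ lens fol′
  ...   | eq , fol″ = cong₂ _∷_ said eq , fol″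

  module _ (fit : (n * 2 ^ ψ + Z) + (D * X + n * X) < 2 ^ ρ) where

    Pr-run : ∀ P τ {Q : Maybe ℕ → Set} (Q? : Decidable Q) → length τ ≤ D →
             Pr Q? (run V P τ) ≡ Pr (λ rs → Q? (outputᴹ (finalᴹ P τ rs))) (draws m K)
    Pr-run P τ Q? le = trans (cong (Pr Q?) (run-simulated fit P τ le))
      (Pr-map Q? (λ rs → outputᴹ (finalᴹ P τ rs)) (draws m K))

    module _ (A>0 : 0 < A) (n≤ : n ≤ 2 ^ ℓ) (W≤ : W ≤ 2 ^ ω)
             {τ : Stream n W} {G : Graph n W} {v : ℕ}
             (describes : τ Describes G) (isMax : IsMaxMatchingWeight G v) (short : length τ ≤ D) where
      open Certificate G using (score; totalScore; certificate-sound; weight-bound)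

      module _ (P : Strategy) where
        a : Fin n → List Bool
        a = lookup (answers P n [])

        claimed : ℕ
        claimed = ∑ (allFin n) (dual ∘ a)

        cube-sum : ∑ᵇ K (∏ (tables τ a)) ≡ totalScore (dual ∘ a) (λ i j → mate (a i) == bits ℓ (toℕ j))
        cube-sum = trans (tables-sum n≤ W≤ a (length-answers P n []) G τ)
          (streamSum-describes {τ = τ} {G} (score (dual ∘ a) (λ i j → mate (a i) == bits ℓ (toℕ j))) describes)

        -- If the announced total is `v`, every outcome is `v` or rejection. Otherwise
        -- `certificate-sound` shows that the total differs from the cube sum, and acceptance means
        -- that the sumcheck was fooled.
        protocol-sound : times K (times 5 (½^ m)) ℚ.≤ ℤ.+ 1 ℚ./ 3 →
          2/3 ℚ.≤ Pr (λ o → (o ≟ₒ just v) ⊎-dec (o ≟ₒ nothing)) (run V P τ)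
        protocol-sound small = subst (2/3 ℚ.≤_) (sym (Pr-run P τ (λ o → (o ≟ₒ just v) ⊎-dec (o ≟ₒ nothing)) short)) likely
          where
          adv = adversary P K (afterAnswers P n [])
          f : Vec (Vec Bool m) K → Maybe ℕ
          f rs = outputᴹ (finalᴹ P τ rs)
          Good : Vec (Vec Bool m) K → Set
          Good rs = f rs ≡ just v ⊎ f rs ≡ nothing
          good? : (rs : Vec (Vec Bool m) K) → Dec (Good rs)
          good? rs = (f rs ≟ₒ just v) ⊎-dec (f rs ≟ₒ nothing)
          win = Pr good? (draws m K)
          fooled : ∀ rs → Dec (Fooled adv (tables τ a) (ℤ.+ claimed , true) rs)
          fooled = fooled? adv (tables τ a) (ℤ.+ claimed , true)
          cases : ∀ rs → f rs ≡ nothing ⊎ (Fooled adv (tables τ a) (ℤ.+ claimed , true) rs × f rs ≡ just claimed)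
          cases rs = subst (λ o → o ≡ nothing ⊎ (Fooled adv (tables τ a) (ℤ.+ claimed , true) rs × o ≡ just claimed))
            (sym (output-final A>0 P τ rs))
            (verdict-cases (play adv (ℤ.+ claimed , true) rs) (∏-mle (tables τ a) (ιs rs)) claimed)
          false-claim : claimed ≢ v → ℤ.+ claimed ≢ ∑ᵇ K (∏ (tables τ a))
          false-claim claimed≢v eq = claimed≢v (certificate-sound (dual ∘ a) (λ i j → mate (a i) == bits ℓ (toℕ j))
            (names-functional n≤ W≤ a (length-answers P n [])) isMax (sym (trans eq cube-sum)))
          cancel : (win ℚ.+ ℤ.+ 1 ℚ./ 3) ℚ.- ℤ.+ 1 ℚ./ 3 ≡ win
          cancel = trans (ℚ.+-assoc win (ℤ.+ 1 ℚ./ 3) (ℚ.- (ℤ.+ 1 ℚ./ 3)))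
            (trans (cong (win ℚ.+_) (ℚ.+-inverseʳ (ℤ.+ 1 ℚ./ 3))) (ℚ.+-identityʳ win))
          likely : 2/3 ℚ.≤ win
          likely with claimed ℕ.≟ v
          ... | yes eq = ℚ.≤-trans (from-yes (2/3 ℚ.≤? 1ℚ)) (Pr-all good? good (draws m K))
            where
            good : ∀ rs → Good rs
            good rs = case cases rs of λ
              { (inj₁ rejected)       → inj₂ rejected
              ; (inj₂ (_ , accepted)) → inj₁ (trans accepted (cong just eq)) }
          ... | no claimed≢v = ℚ.≤-trans (from-yes (2/3 ℚ.≤? 1ℚ ℚ.- ℤ.+ 1 ℚ./ 3))
              (ℚ.≤-trans (ℚ.+-monoˡ-≤ (ℚ.- (ℤ.+ 1 ℚ./ 3)) (ℚ.≤-trans (Pr-cover good? fooled cover (draws m K))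
                (ℚ.+-monoʳ-≤ win (ℚ.≤-trans
                  (sumcheck-sound adv (tables τ a) (ℤ.+ claimed) true (false-claim claimed≢v)) small))))
                (ℚ.≤-reflexive cancel))
            where
            cover : ∀ rs → Good rs ⊎ Fooled adv (tables τ a) (ℤ.+ claimed , true) rs
            cover rs = case cases rs of λ
              { (inj₁ rejected)     → inj₁ (inj₂ rejected)
              ; (inj₂ (passed , _)) → inj₂ passed }

      module _ (C : ℕ) (D≤ : D ≤ C) (n≤C : n ≤ C) (score≤ : 2 ^ ω + suc (n * W) ≤ C)
               (coeffs-fit : 2 ^ K * (4 * (C * X)) ^ 4 < 2 ^ β)
               (nW< : n * W < 2 ^ ψ) (bipartite : IsBipartite G) where

        tables-bounded : ∀ ans → Allᵛ (BoundedBy C) (tables τ ans)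
        tables-bounded ans = stream ∷ vertex srcLocal src-bounded ∷ vertex tgtLocal tgt-bounded ∷ scoreTable-bounded ∷ []
          where
          stream : BoundedBy C (streamTable τ)
          stream x = ℕ.≤-trans (∑-abs-≤ τ _ {1} λ (update e w Δ) →
              abs-*-≤ (Δ ◃ 1) (flat (edgeLocal e w) x) (ℕ.≤-reflexive (ℤ.abs-◃ Δ 1)) (edge-bounded e w x))
            (ℕ.≤-trans (ℕ.≤-reflexive (ℕ.*-identityʳ (length τ))) (ℕ.≤-trans short D≤))
          vertex : ∀ (L : ℕ → List Bool → Local) → (∀ k l → BoundedBy 1 (flat (L k l))) →
                   BoundedBy C (λ x → ℤSum.∑ (allFin n) λ i → flat (L (toℕ i) (ans i)) x)
          vertex L le x = ℕ.≤-trans (∑-abs-≤ (allFin n) _ {1} λ i → le (toℕ i) (ans i) x)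
            (ℕ.≤-trans (ℕ.≤-reflexive (trans (ℕ.*-identityʳ _) (List.length-tabulate {n = n} id))) n≤C)
          ite-≤ : ∀ b {i j} → i ≤ j → (if b then i else 0) ≤ j
          ite-≤ true  le = le
          ite-≤ false le = z≤n
          scoreTable-bounded : BoundedBy C scoreTable
          scoreTable-bounded x = ℕ.≤-trans
            (abs-∸-≤ (ℤ.+ (if matched then suc (num w) else 0)) (ℤ.+ (if violated then suc (n * W) else 0))
              (ite-≤ matched (num-take-< ω _)) (ite-≤ violated ℕ.≤-refl))
            score≤
            where
            u  = take ℓ x
            x₁ = take ℓ (drop ℓ x)
            w  = take ω (drop ℓ (drop ℓ x))
            a₁ = take A (drop ω (drop ℓ (drop ℓ x)))
            b₁ = drop A (drop ω (drop ℓ (drop ℓ x)))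
            matched  = (mate a₁ == x₁) ∧ (mate b₁ == u)
            violated = dual a₁ + dual b₁ <ᵇ suc (num w)

        -- `B` bounds the tables restricted so far. It grows by the factor `Q` in each round while
        -- `k` drops, so the product `B * Q ^ k` is constant and all coefficients stay within `β`
        -- bits.
        honest-play : ∀ {P t} (k : ℕ) (fs : Vec Table 4) {B} → Follows P t (honest k fs) → Allᵛ (BoundedBy B) fs →
          B * Q ^ k ≤ C * X → k ≤ K → (rs : Vec (Vec Bool m) k) →
          play (adversary P k t) (∑ᵇ k (∏ fs) , true) rs ≡ (∏-mle fs (ιs rs) , true)
        honest-play zero fs fol le small k≤K [] = refl
        honest-play {P} {t} (suc k) fs {B} fol le small k≤K (r ∷ rs)
          with follow-utter (ints β (roundPoly k fs)) fol (length-ints β (roundPoly k fs))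
        ... | said , fol′ = trans
            (cong (λ z → play (adversary P k t′) z rs) (trans
              (cong (λ g → eval g (ι r) , does (endpoints g ℤ.≟ ∑ᵇ (suc k) (∏ fs))) received)
              (cong₂ _,_ (roundPoly-eval k fs (ι r)) checked)))
            (honest-play k (Vec.map (restrict (ι r)) fs)
              (follow-hear {P} {say P Γ t ʳ++ t} (λ l → honest k (Vec.map (restrict (ℤ.+ num l)) fs)) fol′ r)
              (restricted le) (subst (_≤ C * X) (sym (ℕ.*-assoc B Q (Q ^ k))) small) (ℕ.<⇒≤ k≤K) rs)
          where
          t′ = toList r ʳ++ (say P Γ t ʳ++ t)
          checked : does (endpoints (roundPoly k fs) ℤ.≟ ∑ᵇ (suc k) (∏ fs)) ≡ true
          checked = dec-true (endpoints (roundPoly k fs) ℤ.≟ ∑ᵇ (suc k) (∏ fs)) (roundPoly-endpoints k fs)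
          fits : ∀ {d} {g : Poly d} → Coeffs≤ (2 ^ k * (4 * B) ^ 4) g → Allᵛ (λ z → ∣ z ∣ < 2 ^ β) g
          fits []       = []
          fits (x ∷ xs) = ℕ.≤-<-trans x bound ∷ fits xs
            where
            B≤ : B ≤ C * X
            B≤ = ℕ.≤-trans (ℕ.≤-trans (ℕ.≤-reflexive (sym (ℕ.*-identityʳ B)))
                   (ℕ.*-monoʳ-≤ B (ℕ.m^n>0 Q {{ℕ.m^n≢0 2 (suc m)}} (suc k)))) small
            bound : 2 ^ k * (4 * B) ^ 4 < 2 ^ β
            bound = ℕ.≤-<-trans (ℕ.*-mono-≤ (ℕ.^-monoʳ-≤ 2 (ℕ.<⇒≤ k≤K)) (ℕ.^-monoˡ-≤ 4 (ℕ.*-monoʳ-≤ 4 B≤))) coeffs-fit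
          received : unints β 5 (say P Γ t) ≡ roundPoly k fs
          received = trans (cong (unints β 5) (trans said (sym (List.++-identityʳ _))))
            (unints-ints β (fits (∑ᵖ-bounded k (linePoly fs) (linePoly-bounded fs le))) [])
          restricted : ∀ {J} {fs : Vec Table J} → Allᵛ (BoundedBy B) fs →
                       Allᵛ (BoundedBy (B * Q)) (Vec.map (restrict (ι r)) fs)
          restricted [] = []
          restricted {fs = f ∷ _} (x ∷ xs) =
            restrict-bounded m f (ι r) (ℕ.<-≤-trans (num-< (toList r))
              (ℕ.≤-reflexive (cong (2 ^_) (Vec.length-toList r)))) x ∷ restricted xs

        module _ (y : Fin n → ℕ) (partner : Fin n → Fin n) (∑y : ∑ (allFin n) y ≡ v)
                 (scored : ∀ y′ p → (∀ u → y′ u ≡ y u) → (∀ u x → p u x ≡ does (partner u Fin.≟ x)) →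
                           totalScore y′ p ≡ ℤ.+ v) where
          ans : Fin n → List Bool
          ans i = bits ψ (y i) ++ bits ℓ (toℕ (partner i))
          ls : Vec (List Bool) n
          ls = tabulate ans
          length-ans : ∀ i → length (ans i) ≡ A
          length-ans i = trans (List.length-++ (bits ψ (y i))) (cong₂ _+_ (length-bits ψ _) (length-bits ℓ _))
          lengths : ∀ {j} (g : Fin j → List Bool) → (∀ i → length (g i) ≡ A) → Allᵛ (λ l → length l ≡ A) (tabulate g)
          lengths {zero}  g e = []
          lengths {suc j} g e = e Fin.zero ∷ lengths (g ∘ Fin.suc) (e ∘ Fin.suc)
          plan : Plan
          plan = answerEach ls (honest K (tables τ (lookup ls)))
          P : Strategy
          P = next plan ∘ reverse
          followed = follow-answers {P} ls [] (lengths ans length-ans) (follow-next plan)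
          y< : ∀ i → y i < 2 ^ ψ
          y< i = ℕ.≤-<-trans (ℕ.≤-trans (∈⇒≤∑ y (∈-allFin i)) (ℕ.≤-trans (ℕ.≤-reflexive ∑y) (weight-bound isMax))) nW<
          dual≡ : ∀ i → dual (lookup ls i) ≡ y i
          dual≡ i = trans (cong dual (Vec.lookup∘tabulate ans i))
            (trans (cong num (take-length-++ {a = bits ψ (y i)} (length-bits ψ (y i)))) (num-bits ψ (y< i)))
          mate≡ : ∀ i j → (mate (lookup ls i) == bits ℓ (toℕ j)) ≡ does (partner i Fin.≟ j)
          mate≡ i j rewrite Vec.lookup∘tabulate ans i
            | drop-length-++ {a = bits ψ (y i)} {bits ℓ (toℕ (partner i))} (length-bits ψ (y i))
            with partner i Fin.≟ j
          ... | yes refl = ==-refl (bits ℓ (toℕ j))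
          ... | no ne    = ==-≢ (ne ∘ vertex-injective n≤ W≤ ans length-ans)
          total≡ : ∑ (allFin n) (dual ∘ lookup ls) ≡ v
          total≡ = trans (∑-cong (allFin n) dual≡) ∑y
          sum≡ : ∑ᵇ K (∏ (tables τ (lookup ls))) ≡ ℤ.+ v
          sum≡ = trans (tables-sum n≤ W≤ (lookup ls)
              (λ i → trans (cong length (Vec.lookup∘tabulate ans i)) (length-ans i)) G τ)
            (trans (streamSum-describes {τ = τ} {G} (score (dual ∘ lookup ls) (λ i j → mate (lookup ls i) == bits ℓ (toℕ j))) describes)
              (scored (dual ∘ lookup ls) (λ i j → mate (lookup ls i) == bits ℓ (toℕ j)) dual≡ mate≡))
          outcome : ∀ rs → outputᴹ (finalᴹ P τ rs) ≡ just v
          outcome rs = begin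
            outputᴹ (finalᴹ P τ rs)
              ≡⟨ output-final A>0 P τ rs ⟩
            verdictOn (answers P n [])
              ≡⟨ cong verdictOn (proj₁ followed) ⟩
            verdictOn ls
              ≡⟨ cong (λ z → verdict (play adv (ℤ.+ z , true) rs) target z) total≡ ⟩
            verdict (play adv (ℤ.+ v , true) rs) target v
              ≡⟨ cong (λ z → verdict (play adv (z , true) rs) target v) (sym sum≡) ⟩
            verdict (play adv (∑ᵇ K (∏ (tables τ (lookup ls))) , true) rs) target v
              ≡⟨ cong (λ z → verdict z target v) (honest-play {P} {afterAnswers P n []} K (tables τ (lookup ls))
                   (proj₂ followed) (tables-bounded (lookup ls)) ℕ.≤-refl ℕ.≤-refl rs) ⟩
            verdict (target , true) target v
              ≡⟨ verdict-accept target v ⟩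
            just v ∎
            where
            open ≡-Reasoning
            adv = adversary P K (afterAnswers P n [])
            target = ∏-mle (tables τ (lookup ls)) (ιs rs)
            -- The answers occur in the claim, in the tables and in the output; abstracting them
            -- allows all three to be replaced at once.
            verdictOn : Vec (List Bool) n → Maybe ℕ
            verdictOn as = verdict (play adv (ℤ.+ ∑ (allFin n) (dual ∘ lookup as) , true) rs)
              (∏-mle (tables τ (lookup as)) (ιs rs)) (∑ (allFin n) (dual ∘ lookup as))
          -- Completeness is perfect: `outcome` holds for every choice of challenges.
          likely : 2/3 ℚ.≤ Pr (λ o → o ≟ₒ just v) (run V P τ)
          likely = subst (2/3 ℚ.≤_) (sym (Pr-run P τ (λ o → o ≟ₒ just v) short))
            (ℚ.≤-trans (from-yes (2/3 ℚ.≤? 1ℚ)) (Pr-all _ outcome (draws m K)))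

        protocol-complete : ∃[ P ] 2/3 ℚ.≤ Pr (λ o → o ≟ₒ just v) (run V P τ)
        protocol-complete =
          let y , partner , ∑y , scored = certificate-complete G bipartite isMax
          in P y partner ∑y scored , likely y partner ∑y scored

-- The error probability

times-*ˡ : ∀ k a q → times k (a ℚ.* q) ≡ a ℚ.* times k q
times-*ˡ zero    a q = sym (ℚ.*-zeroʳ a)
times-*ˡ (suc k) a q = trans (cong (a ℚ.* q ℚ.+_) (times-*ˡ k a q)) (sym (ℚ.*-distribˡ-+ a q (times k q)))

½^≤1 : ∀ k → ½^ k ℚ.≤ 1ℚ
½^≤1 zero    = ℚ.≤-refl
½^≤1 (suc k) = ℚ.≤-trans (ℚ.*-monoˡ-≤-nonNeg ½ (½^≤1 k)) (from-yes (½ ℚ.* 1ℚ ℚ.≤? 1ℚ))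

times-½^ : ∀ k → times k (½^ k) ℚ.≤ 1ℚ
times-½^ zero    = 0≤1ℚ
times-½^ (suc k) = ℚ.≤-trans (ℚ.≤-reflexive eq) (½*-mono (½^≤1 k) (times-½^ k))
  where
  eq : ½ ℚ.* ½^ k ℚ.+ times k (½ ℚ.* ½^ k) ≡ ½ ℚ.* (½^ k ℚ.+ times k (½^ k))
  eq = trans (cong (½ ℚ.* ½^ k ℚ.+_) (times-*ˡ k ½ (½^ k))) (sym (ℚ.*-distribˡ-+ ½ (½^ k) (times k (½^ k))))

-- The 5 counts the coefficients of a polynomial of degree 4. The additive 4 in the exponent
-- contributes 1/16 and `K` divided by `2 ^ K` is at most 1, so the error is at most 5/16.
error-bound : ∀ k → times k (times 5 (½^ (4 + k))) ℚ.≤ ℤ.+ 1 ℚ./ 3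
error-bound k = ℚ.≤-trans (ℚ.≤-reflexive eq)
  (ℚ.≤-trans (ℚ.*-monoˡ-≤-nonNeg 5/16 (times-½^ k)) (from-yes (5/16 ℚ.* 1ℚ ℚ.≤? ℤ.+ 1 ℚ./ 3)))
  where
  5/16 = ℤ.+ 5 ℚ./ 16
  1/16 = ℤ.+ 1 ℚ./ 16
  sixteenth : ∀ q → ½ ℚ.* (½ ℚ.* (½ ℚ.* (½ ℚ.* q))) ≡ 1/16 ℚ.* q
  sixteenth q = sym (trans (ℚ.*-assoc ½ (ℤ.+ 1 ℚ./ 8) q) (cong (½ ℚ.*_)
    (trans (ℚ.*-assoc ½ (ℤ.+ 1 ℚ./ 4) q) (cong (½ ℚ.*_) (ℚ.*-assoc ½ ½ q)))))
  times-*ʳ : ∀ k a q → times k (a ℚ.* q) ≡ times k a ℚ.* q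
  times-*ʳ zero    a q = sym (ℚ.*-zeroˡ q)
  times-*ʳ (suc k) a q = trans (cong (a ℚ.* q ℚ.+_) (times-*ʳ k a q)) (sym (ℚ.*-distribʳ-+ q a (times k a)))
  eq : times k (times 5 (½^ (4 + k))) ≡ 5/16 ℚ.* times k (½^ k)
  eq = trans (cong (times k) (trans (cong (times 5) (sixteenth (½^ k))) (times-*ʳ 5 1/16 (½^ k))))
    (times-*ˡ k 5/16 (½^ k))

-- Asymptotics

1≤log : ∀ {n} → 2 ≤ n → 1 ≤ log n
1≤log 2≤n = ⌈log₂⌉-mono-≤ 2≤n

n≤2^log : ∀ n → n ≤ 2 ^ log n
n≤2^log = <-rec (λ n → n ≤ 2 ^ log n) step
  where
  step : ∀ n → (∀ {j} → j < n → j ≤ 2 ^ log j) → n ≤ 2 ^ log n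
  step zero ih = z≤n
  step (suc zero) ih = ℕ.≤-refl
  step n@(suc (suc k)) ih = begin
    n                              ≡⟨ sym (ℕ.⌊n/2⌋+⌈n/2⌉≡n n) ⟩
    ⌊ n /2⌋ + h                    ≤⟨ ℕ.+-monoˡ-≤ h (ℕ.⌊n/2⌋≤⌈n/2⌉ n) ⟩
    h + h                          ≡⟨ cong (h +_) (sym (ℕ.+-identityʳ h)) ⟩
    2 * h                          ≤⟨ ℕ.*-monoʳ-≤ 2 (ih (ℕ.⌈n/2⌉<n k)) ⟩
    2 ^ suc (log h)                ≡⟨ cong (λ e → 2 ^ suc e) (⌈log₂⌈n/2⌉⌉≡⌈log₂n⌉∸1 n) ⟩
    2 ^ suc (log n ∸ 1)            ≡⟨ cong (2 ^_) (ℕ.m+[n∸m]≡n (1≤log {n} (s≤s (s≤s z≤n)))) ⟩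
    2 ^ log n                      ∎
    where
    open ℕ.≤-Reasoning
    h = ⌈ n /2⌉

-- For `log n` equal to `suc j`, `n` exceeds `2 ^ j`. The intermediate polynomial
-- `j * j + 4 * j + 6` dominates the square, equals 6 at 0 and at most doubles from `j` to `suc j`.
log²≤6n : ∀ n → 2 ≤ n → log n * log n ≤ 6 * n
log²≤6n n 2≤n with log n in eq
... | zero  = z≤n
... | suc j = begin
    suc j * suc j              ≤⟨ ℕ.≤-trans (ℕ.m≤m+n (suc j * suc j) (2 * j + 5)) (ℕ.≤-reflexive (lemma₁ j)) ⟩
    j * j + 4 * j + 6          ≤⟨ quadratic j ⟩
    6 * 2 ^ j                  ≤⟨ ℕ.*-monoʳ-≤ 6 (ℕ.<⇒≤ (ℕ.≰⇒> below)) ⟩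
    6 * n                      ∎
  where
  open ℕ.≤-Reasoning
  lemma₁ : ∀ j → suc j * suc j + (2 * j + 5) ≡ j * j + 4 * j + 6
  lemma₁ = ℕ-solve
  lemma₂ : ∀ j → (suc j * suc j + 4 * suc j + 6) + (j * j + 2 * j + 1) ≡ 2 * (j * j + 4 * j + 6)
  lemma₂ = ℕ-solve
  lemma₃ : ∀ a → 2 * (6 * a) ≡ 6 * (2 * a)
  lemma₃ = ℕ-solve
  quadratic : ∀ j → j * j + 4 * j + 6 ≤ 6 * 2 ^ j
  quadratic zero    = ℕ.≤-refl
  quadratic (suc j) = begin
    suc j * suc j + 4 * suc j + 6   ≤⟨ ℕ.≤-trans (ℕ.m≤m+n _ (j * j + 2 * j + 1)) (ℕ.≤-reflexive (lemma₂ j)) ⟩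
    2 * (j * j + 4 * j + 6)         ≤⟨ ℕ.*-monoʳ-≤ 2 (quadratic j) ⟩
    2 * (6 * 2 ^ j)                 ≡⟨ lemma₃ (2 ^ j) ⟩
    6 * 2 ^ suc j                   ∎
  below : n ≤ 2 ^ j → _
  below n≤ = ℕ.<-irrefl refl (subst₂ _≤_ eq (⌈log₂2^n⌉≡n j) (⌈log₂⌉-mono-≤ n≤))

-- The comparison is asked only from 2 on, where `log` is positive; at 0 and 1 it vanishes.
O-≤ : ∀ {f g h : ℕ → ℕ} k → (∀ n → 2 ≤ n → g n ≤ k * h n) → f ∈O g → f ∈O h
O-≤ {f} {g} {h} k le (K , n₀ , p) = K * k , n₀ + 2 , λ n n≥ →
  ℕ.≤-trans (p n (ℕ.≤-trans (ℕ.m≤m+n n₀ 2) n≥))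
    (ℕ.≤-trans (ℕ.*-monoʳ-≤ K (le n (ℕ.≤-trans (ℕ.m≤n+m 2 n₀) n≥))) (ℕ.≤-reflexive (sym (ℕ.*-assoc K k (h n)))))

O-cong : ∀ {f g h : ℕ → ℕ} → (∀ n → f n ≡ g n) → g ∈O h → f ∈O h
O-cong eq (K , n₀ , p) = K , n₀ , λ n n≥ → ℕ.≤-trans (ℕ.≤-reflexive (eq n)) (p n n≥)

O-refl : ∀ {f : ℕ → ℕ} → f ∈O f
O-refl {f} = 1 , 0 , λ n _ → ℕ.≤-reflexive (sym (ℕ.*-identityˡ (f n)))

O-const : ∀ k → (λ _ → k) ∈O log
O-const k = O-≤ k (λ n 2≤n → ℕ.≤-trans (ℕ.≤-reflexive (sym (ℕ.*-identityʳ k))) (ℕ.*-monoʳ-≤ k (1≤log 2≤n))) O-refl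

O-+ : ∀ {f g h : ℕ → ℕ} → f ∈O h → g ∈O h → (λ n → f n + g n) ∈O h
O-+ {f} {g} {h} (K , n₀ , p) (K′ , n₁ , q) = K + K′ , n₀ + n₁ , λ n n≥ →
  ℕ.≤-trans (ℕ.+-mono-≤ (p n (ℕ.≤-trans (ℕ.m≤m+n n₀ n₁) n≥)) (q n (ℕ.≤-trans (ℕ.m≤n+m n₁ n₀) n≥)))
    (ℕ.≤-reflexive (sym (ℕ.*-distribʳ-+ (h n) K K′)))

O-* : ∀ {f g h k : ℕ → ℕ} → f ∈O h → g ∈O k → (λ n → f n * g n) ∈O (λ n → h n * k n)
O-* {f} {g} {h} {k} (K , n₀ , p) (K′ , n₁ , q) = K * K′ , n₀ + n₁ , λ n n≥ →
  ℕ.≤-trans (ℕ.*-mono-≤ (p n (ℕ.≤-trans (ℕ.m≤m+n n₀ n₁) n≥)) (q n (ℕ.≤-trans (ℕ.m≤n+m n₁ n₀) n≥)))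
    (ℕ.≤-reflexive (lemma K (h n) K′ (k n)))
  where
  lemma : ∀ a b c d → (a * b) * (c * d) ≡ (a * c) * (b * d)
  lemma = ℕ-solve

O-*ˡ : ∀ {f h : ℕ → ℕ} k → f ∈O h → (λ n → k * f n) ∈O h
O-*ˡ {f} {h} k (K , n₀ , p) = k * K , n₀ , λ n n≥ →
  ℕ.≤-trans (ℕ.*-monoʳ-≤ k (p n n≥)) (ℕ.≤-reflexive (sym (ℕ.*-assoc k K (h n))))

O-*ʳ : ∀ {f h : ℕ → ℕ} k → f ∈O h → (λ n → f n * k) ∈O h
O-*ʳ {f} {h} k (K , n₀ , p) = k * K , n₀ , λ n n≥ →
  ℕ.≤-trans (ℕ.≤-reflexive (ℕ.*-comm (f n) k)) (ℕ.≤-trans (ℕ.*-monoʳ-≤ k (p n n≥)) (ℕ.≤-reflexive (sym (ℕ.*-assoc k K (h n)))))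

log² : ℕ → ℕ
log² n = log n ^ 2

O-log² : ∀ {f} → f ∈O log → f ∈O log²
O-log² = O-≤ 1 λ n 2≤n → ℕ.≤-trans (ℕ.≤-reflexive (sym (ℕ.*-identityʳ (log n))))
  (ℕ.≤-trans (ℕ.*-monoʳ-≤ (log n) (ℕ.≤-trans (1≤log 2≤n) (ℕ.≤-reflexive (sym (ℕ.*-identityʳ (log n))))))
    (ℕ.≤-reflexive (sym (ℕ.*-identityˡ (log n ^ 2)))))

O-log*log : ∀ {f g} → f ∈O log → g ∈O log → (λ n → f n * g n) ∈O log²
O-log*log p q = O-≤ 1 (λ n _ → ℕ.≤-reflexive (lemma (log n))) (O-* p q)
  where
  lemma : ∀ l → l * l ≡ 1 * (l * (l * 1))
  lemma = ℕ-solve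

^-≤-2^ : ∀ {n} c → n ≤ 2 ^ log n → n ^ c ≤ 2 ^ (log n * c)
^-≤-2^ {n} c le = ℕ.≤-trans (ℕ.^-monoˡ-≤ c le) (ℕ.≤-reflexive (ℕ.^-*-assoc 2 (log n) c))

2^-+ : ∀ a b → 2 ^ a * 2 ^ b ≡ 2 ^ (a + b)
2^-+ a b = sym (ℕ.^-distribˡ-+-* 2 a b)

module Parameters (c d : ℕ) where

  -- The error 5 K / 2 ^ m of the sumcheck is at most 1 / 3; 2 ^ γ bounds the
  -- tables, 2 ^ β the coefficients of the honest polynomials and 2 ^ ρ the
  -- registers.
  ω ψ A K m γ β σ ρ : ℕ → ℕ
  ω n = log n * c
  ψ n = suc (log n + ω n)
  A n = Tables.A n (n ^ c) (log n) (ω n) (ψ n)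
  K n = Tables.K n (n ^ c) (log n) (ω n) (ψ n)
  m n = 4 + K n
  γ n = suc (log n * d + ψ n)
  β n = suc (K n + (2 + (γ n + suc (m n) * K n)) * 4)
  σ n = (log n + ψ n + (β n + suc (m n) * 5)) + (log n * d + suc (m n) * K n + (log n + suc (m n) * K n))
  ρ n = 3 + σ n

  ω∈ : ω ∈O log
  ω∈ = O-*ʳ c O-refl
  ψ∈ : ψ ∈O log
  ψ∈ = O-+ (O-const 1) (O-+ O-refl ω∈)
  A∈ : A ∈O log
  A∈ = O-+ ψ∈ O-refl
  K∈ : K ∈O log
  K∈ = O-+ O-refl (O-+ O-refl (O-+ ω∈ (O-+ A∈ A∈)))
  m∈ : m ∈O log
  m∈ = O-+ (O-const 4) K∈
  sm∈ : (λ n → suc (m n)) ∈O log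
  sm∈ = O-+ (O-const 1) m∈
  smK∈ : (λ n → suc (m n) * K n) ∈O log²
  smK∈ = O-log*log sm∈ K∈
  β∈ : β ∈O log²
  β∈ = O-+ (O-log² (O-const 1)) (O-+ (O-log² K∈) (O-*ʳ 4 (O-+ (O-log² (O-const 2))
    (O-+ (O-log² (O-+ (O-const 1) (O-+ (O-*ʳ d O-refl) ψ∈))) smK∈))))
  ρ∈ : ρ ∈O log²
  ρ∈ = O-+ (O-log² (O-const 3)) (O-+
    (O-+ (O-log² (O-+ O-refl ψ∈)) (O-+ β∈ (O-log² (O-*ʳ 5 sm∈))))
    (O-+ (O-+ (O-log² (O-*ʳ d O-refl)) smK∈) (O-+ (O-log² O-refl) smK∈)))
  Γ∈ : (λ n → 5 * suc (β n)) ∈O log²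
  Γ∈ = O-*ˡ 5 (O-+ (O-log² (O-const 1)) β∈)

  module _ (n : ℕ) where
    open Conversation n (n ^ c) (n ^ d) (log n) (ω n) (ψ n) (m n) (β n) (ρ n) public using (V; phases)
    open Machine n (n ^ c) (n ^ d) (log n) (ω n) (ψ n) (m n) (β n) (ρ n) using (Γ; X; Z)
    open Correctness n (n ^ c) (n ^ d) (log n) (ω n) (ψ n) (m n) (β n) (ρ n)

    private
      W = n ^ c
      D = n ^ d
      L = log n
      sm = suc (m n)
      n≤ = n≤2^log n

      nW≤ : n * W ≤ 2 ^ (L + ω n)
      nW≤ = ℕ.≤-trans (ℕ.*-mono-≤ n≤ (^-≤-2^ c n≤)) (ℕ.≤-reflexive (2^-+ L (ω n)))

      mono : ∀ {a b} → a ≤ b → 2 ^ a ≤ 2 ^ b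
      mono = ℕ.^-monoʳ-≤ 2

      double : ∀ e {a b} → a ≤ 2 ^ e → b ≤ 2 ^ e → a + b ≤ 2 ^ suc e
      double e p q = ℕ.≤-trans (ℕ.+-mono-≤ p q)
        (ℕ.≤-reflexive (cong (2 ^ e +_) (sym (ℕ.+-identityʳ (2 ^ e)))))

      X≡ : X ≡ 2 ^ (sm * K n)
      X≡ = ℕ.^-*-assoc 2 sm (K n)

    W≤ : W ≤ 2 ^ ω n
    W≤ = ^-≤-2^ c n≤

    nW< : n * W < 2 ^ ψ n
    nW< = ℕ.≤-<-trans nW≤ (ℕ.^-monoʳ-< 2 (s≤s (s≤s z≤n)) (ℕ.n<1+n (L + ω n)))

    D≤ : D ≤ 2 ^ γ n
    D≤ = ℕ.≤-trans (^-≤-2^ d n≤) (mono (ℕ.≤-trans (ℕ.m≤m+n (L * d) (ψ n)) (ℕ.n≤1+n _)))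

    n≤C : n ≤ 2 ^ γ n
    n≤C = ℕ.≤-trans n≤ (mono (ℕ.≤-trans (ℕ.m≤m+n L (ω n)) (ℕ.≤-trans (ℕ.n≤1+n _)
      (ℕ.≤-trans (ℕ.m≤n+m (ψ n) (L * d)) (ℕ.n≤1+n _)))))

    score≤ : 2 ^ ω n + suc (n * W) ≤ 2 ^ γ n
    score≤ = ℕ.≤-trans (double (ψ n) (mono (ℕ.≤-trans (ℕ.m≤n+m (ω n) L) (ℕ.n≤1+n (L + ω n)))) nW<)
      (mono (s≤s (ℕ.m≤n+m (ψ n) (L * d))))

    -- The sum over the cube has at most `2 ^ K n` terms, each with coefficients bounded through
    -- four tables. As all factors are powers of two, the exponents add up to that of `β`, whose
    -- successor gives strictness.
    coeffs-fit : 2 ^ K n * (4 * (2 ^ γ n * X)) ^ 4 < 2 ^ β n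
    coeffs-fit = begin-strict
      2 ^ K n * (4 * (2 ^ γ n * X)) ^ 4
        ≡⟨ cong (λ z → 2 ^ K n * (4 * (2 ^ γ n * z)) ^ 4) X≡ ⟩
      2 ^ K n * (2 ^ 2 * (2 ^ γ n * 2 ^ (sm * K n))) ^ 4
        ≡⟨ cong (λ z → 2 ^ K n * (2 ^ 2 * z) ^ 4) (2^-+ (γ n) (sm * K n)) ⟩
      2 ^ K n * (2 ^ 2 * 2 ^ (γ n + sm * K n)) ^ 4
        ≡⟨ cong (λ z → 2 ^ K n * z ^ 4) (2^-+ 2 (γ n + sm * K n)) ⟩
      2 ^ K n * (2 ^ (2 + (γ n + sm * K n))) ^ 4
        ≡⟨ cong (2 ^ K n *_) (ℕ.^-*-assoc 2 (2 + (γ n + sm * K n)) 4) ⟩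
      2 ^ K n * 2 ^ ((2 + (γ n + sm * K n)) * 4)
        ≡⟨ 2^-+ (K n) ((2 + (γ n + sm * K n)) * 4) ⟩
      2 ^ (K n + (2 + (γ n + sm * K n)) * 4)
        <⟨ ℕ.^-monoʳ-< 2 (s≤s (s≤s z≤n)) (ℕ.n<1+n (K n + (2 + (γ n + sm * K n)) * 4)) ⟩
      2 ^ β n ∎
      where open ℕ.≤-Reasoning

    -- Each of the four summands is at most `2 ^ σ n`, since `σ` is the sum of their exponents. Two
    -- doublings and the strict inequality account for the 3 in `ρ`.
    fit : (n * 2 ^ ψ n + Z) + (D * X + n * X) < 2 ^ ρ n
    fit = ℕ.≤-<-trans (double (suc (σ n)) (double (σ n) t₁ t₂) (double (σ n) t₃ t₄))
      (ℕ.^-monoʳ-< 2 (s≤s (s≤s z≤n)) (ℕ.n<1+n (2 + σ n)))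
      where
      e₁ = L + ψ n
      e₂ = β n + sm * 5
      e₃ = L * d + sm * K n
      e₄ = L + sm * K n
      t₁ : n * 2 ^ ψ n ≤ 2 ^ σ n
      t₁ = ℕ.≤-trans (ℕ.*-monoˡ-≤ (2 ^ ψ n) n≤) (ℕ.≤-trans (ℕ.≤-reflexive (2^-+ L (ψ n)))
        (mono (ℕ.≤-trans (ℕ.m≤m+n e₁ e₂) (ℕ.m≤m+n (e₁ + e₂) (e₃ + e₄)))))
      t₂ : Z ≤ 2 ^ σ n
      t₂ = ℕ.≤-trans (ℕ.≤-reflexive (trans (cong (2 ^ β n *_) (ℕ.^-*-assoc 2 sm 5)) (2^-+ (β n) (sm * 5))))
        (mono (ℕ.≤-trans (ℕ.m≤n+m e₂ e₁) (ℕ.m≤m+n (e₁ + e₂) (e₃ + e₄))))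
      t₃ : D * X ≤ 2 ^ σ n
      t₃ = ℕ.≤-trans (ℕ.*-mono-≤ (^-≤-2^ d n≤) (ℕ.≤-reflexive X≡)) (ℕ.≤-trans (ℕ.≤-reflexive (2^-+ (L * d) (sm * K n)))
        (mono (ℕ.≤-trans (ℕ.m≤m+n e₃ e₄) (ℕ.m≤n+m (e₃ + e₄) (e₁ + e₂)))))
      t₄ : n * X ≤ 2 ^ σ n
      t₄ = ℕ.≤-trans (ℕ.*-mono-≤ n≤ (ℕ.≤-reflexive X≡)) (ℕ.≤-trans (ℕ.≤-reflexive (2^-+ L (sm * K n)))
        (mono (ℕ.≤-trans (ℕ.m≤n+m e₄ e₃) (ℕ.m≤n+m (e₃ + e₄) (e₁ + e₂)))))

    isSIP : IsSIPFor (MaxWeightBipartiteMatching n c d) V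
    isSIP = record
      { complete = λ τ v f → let open MaxWeightBipartiteMatching f in
          protocol-complete fit (s≤s z≤n) n≤ W≤ {τ} {graph} {v} describes maximum short
            (2 ^ γ n) D≤ n≤C score≤ coeffs-fit nW< bipartite
      ; sound = λ τ v f P → let open MaxWeightBipartiteMatching f in
          protocol-sound fit (s≤s z≤n) n≤ W≤ {τ} {graph} {v} describes maximum short P (error-bound (K n)) }

    length-phases : ∀ k → length (phases k) ≡ k * 2
    length-phases zero    = refl
    length-phases (suc k) = cong (λ l → suc (suc l)) (length-phases k)

    sum-phases : ∀ k → sum (map (λ r → Round.challenge r + Round.response r) (phases k)) ≡ k * (Γ + m n)
    sum-phases zero    = refl
    sum-phases (suc k) = trans
      (cong (λ z → Γ + (m n + 0 + z)) (sum-phases k))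
      (lemma Γ (m n) (k * (Γ + m n)))
      where
      lemma : ∀ a b e → a + (b + 0 + e) ≡ (a + b) + e
      lemma = ℕ-solve

  rounds∈ : (λ n → Verifier.rounds (V n)) ∈O log
  rounds∈ = O-cong (λ n → cong suc (length-phases n (K n))) (O-+ (O-const 1) (O-*ʳ 2 K∈))

  space∈ : (λ n → Verifier.space (V n)) ∈O log²
  space∈ = O-*ʳ 2 (O-+ (O-log*log K∈ m∈) (O-+ (O-*ˡ 6 (O-+ (O-log² (O-const 1)) ρ∈))
    (O-+ (O-log² (O-const 1)) (O-+ (O-log² A∈) Γ∈))))

  -- The answers cost `n * A n` bits. The sumcheck costs only a cube of `log n`, which is absorbed
  -- because the square of `log n` is at most `6 * n`.
  communication∈ : (λ n → Verifier.communication (V n)) ∈O (λ n → n * log n)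
  communication∈ = O-cong (λ n → cong (n * A n +_) (sum-phases n (K n)))
    (O-+ (O-* (O-refl {id}) A∈) (O-≤ 6 (λ n 2≤n → cubic n (log²≤6n n 2≤n)) (O-* K∈ (O-+ Γ∈ (O-log² m∈)))))
    where
    cubic : ∀ n → log n * log n ≤ 6 * n → log n * log² n ≤ 6 * (n * log n)
    cubic n le = ℕ.≤-trans (ℕ.≤-reflexive (lemma (log n)))
      (ℕ.≤-trans (ℕ.*-monoˡ-≤ (log n) le) (ℕ.≤-reflexive (ℕ.*-assoc 6 n (log n))))
      where
      lemma : ∀ l → l * (l * (l * 1)) ≡ (l * l) * l
      lemma = ℕ-solve

theorem5 : (c d : ℕ) →
    Σ[ V ∈ ((n : ℕ) → Verifier (Update n (n ^ c))) ]
    ( (∀ n → IsSIPFor (MaxWeightBipartiteMatching n c d) (V n))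
    × (λ n → Verifier.rounds (V n)) ∈O log
    × (λ n → Verifier.space (V n)) ∈O (λ n → log n ^ 2)
    × (λ n → Verifier.communication (V n)) ∈O (λ n → n * log n) )
theorem5 c d = V , isSIP , rounds∈ , space∈ , communication∈
  where open Parameters c d
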